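{- Let $R_0$ be either the ring $\mathbb{Z}_k$ of integers modulo $k$ ($k\ge2$) or the field $\mathbb{F}_p$ of prime order $p$. For $a\in R_0$, $\tau\in\mathbb{H}$ and $z\in\mathbb{C}$ put $$\psi_a(\tau):=\sum_{\substack{b\in\mathbb{Z}\\ b\equiv a\ (\mathrm{mod}\ |R_0|)}}\exp\Bigl(\frac{1}{|R_0|}\pi i\tau b^2\Bigr),\qquad \phi_a(\tau,z):=\sum_{\substack{b\in\mathbb{Z}\\ b\equiv a\ (\mathrm{mod}\ |R_0|)}}\exp\Bigl(\frac{1}{|R_0|}\pi i\tau b^2+2\pi i z b\Bigr).$$ Let $G$ be a finite permutation group on the coordinates of $R_0^n$, let $C\subseteq R_0^n$ be a $G$-code, let $H$ be a subgroup of $G$ such that $|H|$ has an inverse in $R_0$, let $t$ be the number of orbits of $H$ on the coordinates, and let $T\subseteq E:=\{1,\dots,t\}$. Then $$\mathrm{CJ}^{H}_{C\theta_H,T}\bigl(\{x_a\leftarrow\psi_a(\tau),\; y_a\leftarrow\phi_a(\tau,z)\}_{a\in R_0}\bigr)$$ is an $H$-Jacobi theta series; that is, there exist a lattice $D$ in $\mathbb{R}^n\theta_H$ and $y\in D$ such that this expression equals $\vartheta^{H}_{D,y}(\tau,z)$ for all $\tau\in\mathbb{H}$, $z\in\mathbb{C}$.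
   Context: $\mathbb{H}=\{\tau\in\mathbb{C}:\mathrm{Im}(\tau)>0\}$. A permutation group $G$ on the coordinate set $\{1,\dots,n\}$ acts on $V=R_0^n$ and on $\Gamma=\mathbb{R}^n$ on the right by $(vg)_i=v_{ig^{ -1}}$. A $G$-code is an $R_0$-submodule $C\subseteq R_0^n$ with $Cg\subseteq C$ for all $g\in G$. For $H\le G$, $v\theta_H:=\frac1{|H|}\sum_{h\in H}vh$, on $\mathbb{R}^n$, and on $R_0^n$ when $|H|\cdot 1$ is a unit in $R_0$; $X\theta_H:=\{v\theta_H:v\in X\}$. Let $O_1,\dots,O_t$ be the orbits of $H$ on $\{1,\dots,n\}$ and $m_i=|O_i|$. Codes: every $u\in V\theta_H$ is uniquely $u=\sum_{i=1}^tu_i\mathbf{1}_{O_i}$ with $u_i\in R_0$, where $\mathbf 1_{O_i}\in V$ has entry $1$ on $O_i$ and $0$ elsewhere. For an $R_0$-submodule $X\subseteq V\theta_H$ and $T\subseteq E=\{1,\dots,t\}$, the complete $H$-Jacobi polynomial is $\mathrm{CJ}^H_{X,T}(\{x_a,y_a\}_{a\in R_0}):=\sum_{u\in X}\prod_{a\in R_0}x_a^{n^H_{a,T}(u)}y_a^{n^H_{a,E\setminus T}(u)}$, where $n^H_{a,S}(u)$ is the number of $i\in S$ with $u_i=a$. Lattices: every $u\in\Gamma\theta_H$ is uniquely $u=\sum_{i=1}^tu_i\overline{O_i}$ with $u_i\in\mathbb{R}$, where $\overline{O_i}\in\Gamma$ has entries $1/\sqrt{m_i}$ on $O_i$ and $0$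 elsewhere; the $H$-inner product is $\langle u,v\rangle_H:=\sum_{i=1}^tu_iv_i$. A lattice in $\Gamma\theta_H$ is the $\mathbb{Z}$-span of an $\mathbb{R}$-basis of $\Gamma\theta_H$. For a lattice $D$ in $\Gamma\theta_H$ and $y\in D$, the $H$-Jacobi theta series of $D$ with respect to $y$ is $\vartheta^H_{D,y}(\tau,z):=\sum_{x\in D}\exp\bigl(\pi i\tau\langle x,x\rangle_H+2\pi iz\langle x,y\rangle_H\bigr)$. -}

module Defs where

open import Level using (Level; 0ℓ; _⊔_) renaming (suc to lsuc)
open import Function.Base using (_∘_)
open import Function.Bundles using (_⇔_)
open import Data.Empty using (⊥-elim)
open import Data.Bool.Base using (true; false; if_then_else_)
open import Data.Maybe.Base using (Maybe; just; nothing)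
open import Data.Nat.Base as ℕ using (ℕ; zero; suc; NonZero; NonTrivial; _!)
import Data.Nat.Properties as ℕₚ
open import Data.Nat.DivMod using (_mod_)
open import Data.Nat.Tactic.RingSolver using () renaming (solve-∀ to ℕ-solve-∀)
open import Data.Integer.Base as ℤ using (ℤ; +_; -[1+_])
import Data.Integer.Properties as ℤₚ
import Data.Integer.Divisibility as ℤ∣
open import Data.Fin.Base as Fin using (Fin; toℕ)
import Data.Fin.Properties as Finₚ
open import Data.Fin.Permutation as Perm using (Permutation′; _⟨$⟩ʳ_; _⟨$⟩ˡ_; _∘ₚ_)
open import Data.Fin.Subset as Subset using (Subset; _∩_; ∁; ∣_∣)
open import Data.Vec.Base as Vec using (Vec; lookup; tabulate; []; _∷_)
import Data.Vec.Properties as Vecₚ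
open import Data.Vec.Functional as Vector using (Vector)
open import Data.List.Base as List using (List; length)
open import Data.List.Relation.Unary.All using (All)
open import Data.List.Relation.Unary.Any using (Any; here; there)
open import Data.List.Relation.Unary.AllPairs using (AllPairs)
open import Data.List.Relation.Unary.Unique.Propositional using (Unique)
open import Data.List.Relation.Binary.Subset.Propositional using (_⊆_)
open import Data.Product.Base using (Σ-syntax; ∃-syntax; _×_; _,_; proj₁; proj₂)
open import Data.Sum.Base using (_⊎_; inj₁; inj₂)
open import Relation.Nullary using (¬_; yes; no; does)
open import Relation.Nullary.Decidable using (dec-true; dec-false)
open import Relation.Unary using (Pred; Decidable; U)
open import Relation.Binary.Core using (Rel)
open import Relation.Binary.Structures using (IsStrictPartialOrder)
open import Relation.Binary.PropositionalEquality as ≡ using (_≡_)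
open import Algebra.Bundles using (CommutativeRing; Semiring; RawSemiring)
open import Algebra.Apartness.Bundles using (HeytingField)
import Algebra.Definitions.RawSemiring as RawSemiringDefinitions
import Algebra.Definitions.RawMonoid as SumDefinitions
import Algebra.Properties.Ring as RingProperties
import Algebra.Properties.Semiring.Mult as SemiringMult
import Algebra.Solver.Ring as RingSolver
import Algebra.Solver.Ring.AlmostCommutativeRing as ACR

private
  variable
    c ℓ₁ ℓ₂ : Level

-- The real numbers, axiomatised as a Cauchy-complete Archimedean ordered
-- field. Every model is isomorphic to ℝ in classical mathematics, and
-- Bishop's constructive reals are a model, so nothing below assumes
-- excluded middle or a decidable order.
record RealField c ℓ₁ ℓ₂ : Set (lsuc (c ⊔ ℓ₁ ⊔ ℓ₂)) where
  field
    heytingField : HeytingField c ℓ₁ ℓ₂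

  open HeytingField heytingField public
    using (Carrier; _≈_; _#_; _+_; _*_; -_; 0#; 1#; isHeytingField)
  open HeytingField heytingField using (heytingCommutativeRing)
  open Algebra.Apartness.Bundles.HeytingCommutativeRing heytingCommutativeRing public
    using (commutativeRing)
  open CommutativeRing commutativeRing using (_-_; semiring)
  open SemiringMult semiring using () renaming (_×_ to infixr 8 _·_)

  infix 4 _<_
  field
    _<_                  : Rel Carrier ℓ₂
    isStrictPartialOrder : IsStrictPartialOrder _≈_ _<_
    #⇒<                  : ∀ {x y} → x # y → x < y ⊎ y < x
    <⇒#                  : ∀ {x y} → x < y → x # y
    +-monoˡ-<            : ∀ {x y} z → x < y → x + z < y + z
    *-pos                : ∀ {x y} → 0# < x → 0# < y → 0# < x * y
    archimedean          : ∀ x → ∃[ n ] x < n · 1#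

  -- ∣ x − y ∣ < ε
  Near : Carrier → Carrier → Carrier → Set ℓ₂
  Near ε x y = (x - y < ε) × (y - x < ε)

  Cauchy : (ℕ → Carrier) → Set (c ⊔ ℓ₂)
  Cauchy s = ∀ ε → 0# < ε → ∃[ N ] ∀ m n → N ℕ.≤ m → N ℕ.≤ n → Near ε (s m) (s n)

  _⟶_ : (ℕ → Carrier) → Carrier → Set (c ⊔ ℓ₂)
  s ⟶ l = ∀ ε → 0# < ε → ∃[ N ] ∀ n → N ℕ.≤ n → Near ε (s n) l

  field
    complete : ∀ s → Cauchy s → ∃[ l ] s ⟶ l

module RealFacts (ℝ : RealField c ℓ₁ ℓ₂) where

  open RealField ℝ public
  open Algebra.Apartness.Bundles.HeytingField heytingField public
    using (#⇒invertible; invertible⇒#; #-cotrans; tight)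
  open CommutativeRing commutativeRing public
    using ( _-_; refl; sym; trans; reflexive; setoid; ring; semiring; +-cong; +-congˡ; +-congʳ
          ; *-cong; *-congˡ; *-congʳ; -‿cong; +-identityˡ; +-identityʳ; *-identityˡ
          ; *-identityʳ; +-comm; *-comm; +-assoc; *-assoc; -‿inverseˡ; -‿inverseʳ; zeroˡ; zeroʳ
          ; distribˡ; distribʳ )
  open SemiringMult semiring public using (×1-homo-*; ×-homo-+) renaming (_×_ to infixr 8 _·_)
  open RingProperties ring public using (-‿involutive; -‿+-comm; -‿distribˡ-*; -‿distribʳ-*; -0#≈0#)
  open IsStrictPartialOrder isStrictPartialOrder public
    using () renaming (irrefl to <-irrefl; trans to <-trans; <-respˡ-≈ to <-respˡ; <-respʳ-≈ to <-respʳ)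

  fromℕ : ℕ → Carrier
  fromℕ n = n · 1#

  fromℤ : ℤ → Carrier
  fromℤ (+ n)    = fromℕ n
  fromℤ -[1+ n ] = - fromℕ (suc n)

  open import Relation.Binary.Reasoning.Setoid setoid

  fromℕ-+ : ∀ m n → fromℕ (m ℕ.+ n) ≈ fromℕ m + fromℕ n
  fromℕ-+ = ×-homo-+ 1#

  fromℤ-⊖ : ∀ m n → fromℤ (m ℤ.⊖ n) ≈ fromℕ m - fromℕ n
  fromℤ-⊖ m zero = sym (trans (+-congˡ -0#≈0#) (+-identityʳ _))
  fromℤ-⊖ zero (suc n) = sym (+-identityˡ _)
  fromℤ-⊖ (suc m) (suc n) = begin
    fromℤ (suc m ℤ.⊖ suc n)                ≡⟨ ≡.cong fromℤ (ℤₚ.[1+m]⊖[1+n]≡m⊖n m n) ⟩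
    fromℤ (m ℤ.⊖ n)                        ≈⟨ fromℤ-⊖ m n ⟩
    fromℕ m - fromℕ n                      ≈⟨ +-congˡ (sym (+-identityˡ _)) ⟩
    fromℕ m + (0# - fromℕ n)               ≈⟨ +-congˡ (+-congʳ (sym (-‿inverseʳ 1#))) ⟩
    fromℕ m + ((1# - 1#) - fromℕ n)        ≈⟨ +-congˡ (+-assoc _ _ _) ⟩
    fromℕ m + (1# + (- 1# - fromℕ n))      ≈⟨ sym (+-assoc _ _ _) ⟩
    (fromℕ m + 1#) + (- 1# - fromℕ n)      ≈⟨ +-cong (+-comm _ _) (-‿+-comm _ _) ⟩
    fromℕ (suc m) - fromℕ (suc n)          ∎

  fromℤ-neg : ∀ a → fromℤ (ℤ.- a) ≈ - fromℤ a
  fromℤ-neg (+ zero)    = sym -0#≈0#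
  fromℤ-neg (+ suc n)   = refl
  fromℤ-neg -[1+ n ]    = sym (-‿involutive _)

  fromℤ-+ : ∀ a b → fromℤ (a ℤ.+ b) ≈ fromℤ a + fromℤ b
  fromℤ-+ (+ m)    (+ n)    = fromℕ-+ m n
  fromℤ-+ (+ m)    -[1+ n ] = fromℤ-⊖ m (suc n)
  fromℤ-+ -[1+ m ] (+ n)    = trans (fromℤ-⊖ n (suc m)) (+-comm _ _)
  fromℤ-+ -[1+ m ] -[1+ n ] = begin
    - fromℕ (suc (suc (m ℕ.+ n)))       ≡⟨ ≡.cong (λ k → - fromℕ (suc k)) (≡.sym (ℕₚ.+-suc m n)) ⟩
    - fromℕ (suc m ℕ.+ suc n)           ≈⟨ -‿cong (fromℕ-+ (suc m) (suc n)) ⟩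
    - (fromℕ (suc m) + fromℕ (suc n))   ≈⟨ sym (-‿+-comm _ _) ⟩
    - fromℕ (suc m) - fromℕ (suc n)     ∎

  private
    fromℤ-*⁺ : ∀ a n → fromℤ (a ℤ.* + n) ≈ fromℤ a * fromℕ n
    fromℤ-*⁺ a zero = trans (reflexive (≡.cong fromℤ (ℤₚ.*-zeroʳ a))) (sym (zeroʳ _))
    fromℤ-*⁺ a (suc n) = begin
      fromℤ (a ℤ.* + suc n)            ≡⟨ ≡.cong fromℤ (ℤₚ.*-suc a (+ n)) ⟩
      fromℤ (a ℤ.+ a ℤ.* + n)          ≈⟨ fromℤ-+ a (a ℤ.* + n) ⟩
      fromℤ a + fromℤ (a ℤ.* + n)      ≈⟨ +-cong (sym (*-identityʳ _)) (fromℤ-*⁺ a n) ⟩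
      fromℤ a * 1# + fromℤ a * fromℕ n ≈⟨ sym (distribˡ _ _ _) ⟩
      fromℤ a * fromℕ (suc n)          ∎

  fromℤ-* : ∀ a b → fromℤ (a ℤ.* b) ≈ fromℤ a * fromℤ b
  fromℤ-* a (+ n)    = fromℤ-*⁺ a n
  fromℤ-* a -[1+ n ] = begin
    fromℤ (a ℤ.* -[1+ n ])       ≡⟨ ≡.cong fromℤ (≡.sym (ℤₚ.neg-distribʳ-* a (+ suc n))) ⟩
    fromℤ (ℤ.- (a ℤ.* + suc n))  ≈⟨ fromℤ-neg (a ℤ.* + suc n) ⟩
    - fromℤ (a ℤ.* + suc n)      ≈⟨ -‿cong (fromℤ-*⁺ a (suc n)) ⟩
    - (fromℤ a * fromℕ (suc n))  ≈⟨ -‿distribʳ-* _ _ ⟩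
    fromℤ a * - fromℕ (suc n)    ∎

  private
    solverRing = ACR.fromCommutativeRing commutativeRing

    fromℤ-morphism : ACR._-Raw-AlmostCommutative⟶_ ℤ.+-*-rawRing solverRing
    fromℤ-morphism = record
      { ⟦_⟧    = fromℤ
      ; +-homo = fromℤ-+
      ; *-homo = fromℤ-*
      ; -‿homo = fromℤ-neg
      ; 0-homo = refl
      ; 1-homo = +-identityʳ 1#
      }

    coeff≟ : ∀ a b → Maybe (fromℤ a ≈ fromℤ b)
    coeff≟ a b with a ℤₚ.≟ b
    ... | yes eq = just (reflexive (≡.cong fromℤ eq))
    ... | no _   = nothing

  module Solver = RingSolver ℤ.+-*-rawRing solverRing fromℤ-morphism coeff≟

  infix 4 _≤_
  _≤_ : Rel Carrier ℓ₂
  x ≤ y = ¬ y < x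

  <-cotrans : ∀ {x y} → x < y → ∀ z → x < z ⊎ z < y
  <-cotrans x<y z with #-cotrans (<⇒# x<y) z
  ... | inj₁ x#z with #⇒< x#z
  ...   | inj₁ x<z = inj₁ x<z
  ...   | inj₂ z<x = inj₂ (<-trans z<x x<y)
  <-cotrans x<y z | inj₂ z#y with #⇒< z#y
  ...   | inj₁ z<y = inj₂ z<y
  ...   | inj₂ y<z = inj₁ (<-trans x<y y<z)

  <⇒≤ : ∀ {x y} → x < y → x ≤ y
  <⇒≤ x<y y<x = <-irrefl refl (<-trans x<y y<x)

  ≤-refl : ∀ {x} → x ≤ x
  ≤-refl = <-irrefl refl

  ≤-respˡ : ∀ {x x′ y} → x ≈ x′ → x ≤ y → x′ ≤ y
  ≤-respˡ eq x≤y y<x′ = x≤y (<-respʳ (sym eq) y<x′)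

  ≤-respʳ : ∀ {x y y′} → y ≈ y′ → x ≤ y → x ≤ y′
  ≤-respʳ eq x≤y y′<x = x≤y (<-respˡ (sym eq) y′<x)

  ≤-trans : ∀ {x y z} → x ≤ y → y ≤ z → x ≤ z
  ≤-trans {y = y} x≤y y≤z z<x with <-cotrans z<x y
  ... | inj₁ z<y = y≤z z<y
  ... | inj₂ y<x = x≤y y<x

  ≤-<-trans : ∀ {x y z} → x ≤ y → y < z → x < z
  ≤-<-trans {x} x≤y y<z with <-cotrans y<z x
  ... | inj₁ y<x = ⊥-elim (x≤y y<x)
  ... | inj₂ x<z = x<z

  <-≤-trans : ∀ {x y z} → x < y → y ≤ z → x < z
  <-≤-trans {z = z} x<y y≤z with <-cotrans x<y z
  ... | inj₁ x<z = x<z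
  ... | inj₂ z<y = ⊥-elim (y≤z z<y)

  ≤-antisym : ∀ {x y} → x ≤ y → y ≤ x → x ≈ y
  ≤-antisym {x} {y} x≤y y≤x = proj₁ (tight x y) λ x#y → case (#⇒< x#y)
    where
    case : x < y ⊎ y < x → _
    case (inj₁ x<y) = y≤x x<y
    case (inj₂ y<x) = x≤y y<x

  private
    x+z-z : ∀ x z → (x + z) + (- z) ≈ x
    x+z-z x z = Solver.solve 2 (λ x z → (x :+ z) :+ (:- z) := x) refl x z
      where open Solver

  +-monoʳ-< : ∀ {x y} z → x < y → z + x < z + y
  +-monoʳ-< z x<y = <-respˡ (+-comm _ _) (<-respʳ (+-comm _ _) (+-monoˡ-< z x<y))

  +-monoˡ-≤ : ∀ {x y} z → x ≤ y → x + z ≤ y + z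
  +-monoˡ-≤ {x} {y} z x≤y lt =
    x≤y (<-respˡ (x+z-z y z) (<-respʳ (x+z-z x z) (+-monoˡ-< (- z) lt)))

  +-mono-≤ : ∀ {x y u v} → x ≤ y → u ≤ v → x + u ≤ y + v
  +-mono-≤ {x} {y} {u} {v} x≤y u≤v =
    ≤-trans (+-monoˡ-≤ u x≤y) (≤-respˡ (+-comm _ _) (≤-respʳ (+-comm _ _) (+-monoˡ-≤ y u≤v)))

  ≤⇒0≤ : ∀ {x y} → x ≤ y → 0# ≤ y - x
  ≤⇒0≤ {x} x≤y = ≤-respˡ (-‿inverseʳ x) (+-monoˡ-≤ (- x) x≤y)

  0≤⇒≤ : ∀ {x y} → 0# ≤ y - x → x ≤ y
  0≤⇒≤ {x} {y} le = ≤-respˡ (+-identityˡ x) (≤-respʳ eq (+-monoˡ-≤ x le))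
    where
    eq : y - x + x ≈ y
    eq = Solver.solve 2 (λ x y → (y :+ (:- x)) :+ x := y) refl x y
      where open Solver

  <⇒0< : ∀ {x y} → x < y → 0# < y - x
  <⇒0< {x} x<y = <-respˡ (-‿inverseʳ x) (+-monoˡ-< (- x) x<y)

  0<⇒< : ∀ {x y} → 0# < y - x → x < y
  0<⇒< {x} {y} lt = <-respˡ (+-identityˡ x) (<-respʳ eq (+-monoˡ-< x lt))
    where
    eq : y - x + x ≈ y
    eq = Solver.solve 2 (λ x y → (y :+ (:- x)) :+ x := y) refl x y
      where open Solver

  neg-mono-≤ : ∀ {x y} → x ≤ y → - y ≤ - x
  neg-mono-≤ {x} {y} x≤y = 0≤⇒≤ (≤-respʳ eq (≤⇒0≤ x≤y))
    where
    eq : y - x ≈ - x - (- y)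
    eq = Solver.solve 2 (λ x y → y :+ (:- x) := (:- x) :+ (:- (:- y))) refl x y
      where open Solver

  0<1 : 0# < 1#
  0<1 with #⇒< (invertible⇒# {1#} {0#} (1# , eq , trans (*-comm _ _) eq))
    where
    eq : 1# * (1# - 0#) ≈ 1#
    eq = trans (*-identityˡ _) (trans (+-congˡ -0#≈0#) (+-identityʳ _))
  ... | inj₂ 0<1 = 0<1
  ... | inj₁ 1<0 = <-respʳ eq (*-pos 0<-1 0<-1)
    where
    0<-1 : 0# < - 1#
    0<-1 = <-respʳ (+-identityˡ _) (<⇒0< 1<0)
    eq : - 1# * - 1# ≈ 1#
    eq = trans (Solver.solve 1 (λ u → (:- u) :* (:- u) := u :* u) refl 1#) (*-identityˡ 1#)
      where open Solver

  *-nonneg : ∀ {x y} → 0# ≤ x → 0# ≤ y → 0# ≤ x * y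
  *-nonneg {x} {y} 0≤x 0≤y xy<0 = contra (#⇒< x#0) (#⇒< y#0)
    where
    inv = #⇒invertible (<⇒# xy<0)
    w = proj₁ inv
    invˡ : ∀ a b → w * (x * y - 0#) ≈ 1# → (a * b) ≈ x * y → (b * w) * (a - 0#) ≈ 1#
    invˡ a b eq ab = begin
      (b * w) * (a - 0#)    ≈⟨ Solver.solve 3 (λ a b w → (b :* w) :* (a :+ (:- con (+ 0))) := w :* ((a :* b) :+ (:- con (+ 0)))) refl a b w ⟩
      w * (a * b - 0#)      ≈⟨ *-congˡ (+-congʳ ab) ⟩
      w * (x * y - 0#)      ≈⟨ eq ⟩
      1#                    ∎
      where open Solver
    x#0 : x # 0#
    x#0 = invertible⇒# (_ , invˡ x y (proj₁ (proj₂ inv)) refl , trans (*-comm _ _) (invˡ x y (proj₁ (proj₂ inv)) refl))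
    y#0 : y # 0#
    y#0 = invertible⇒# (_ , invˡ y x (proj₁ (proj₂ inv)) (*-comm _ _) , trans (*-comm _ _) (invˡ y x (proj₁ (proj₂ inv)) (*-comm _ _)))
    contra : x < 0# ⊎ 0# < x → y < 0# ⊎ 0# < y → _
    contra (inj₁ x<0) _          = 0≤x x<0
    contra (inj₂ _)   (inj₁ y<0) = 0≤y y<0
    contra (inj₂ 0<x) (inj₂ 0<y) = <⇒≤ (*-pos 0<x 0<y) xy<0

  *-monoˡ-≤ : ∀ {x y} z → 0# ≤ z → x ≤ y → x * z ≤ y * z
  *-monoˡ-≤ {x} {y} z 0≤z x≤y = 0≤⇒≤ (≤-respʳ eq (*-nonneg (≤⇒0≤ x≤y) 0≤z))
    where
    eq : (y - x) * z ≈ y * z - x * z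
    eq = Solver.solve 3 (λ x y z → (y :+ (:- x)) :* z := (y :* z) :+ (:- (x :* z))) refl x y z
      where open Solver

  *-cancelˡ-≤ : ∀ {x y} z → 0# < z → x * z ≤ y * z → x ≤ y
  *-cancelˡ-≤ {x} {y} z 0<z le y<x = le (0<⇒< (<-respʳ eq (*-pos (<⇒0< y<x) 0<z)))
    where
    eq : (x - y) * z ≈ x * z - y * z
    eq = Solver.solve 3 (λ x y z → (y :+ (:- x)) :* z := (y :* z) :+ (:- (x :* z))) refl y x z
      where open Solver

  fromℕ-nonneg : ∀ n → 0# ≤ fromℕ n
  fromℕ-nonneg zero    = ≤-refl
  fromℕ-nonneg (suc n) = ≤-respˡ (+-identityˡ 0#) (+-mono-≤ (<⇒≤ 0<1) (fromℕ-nonneg n))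

  fromℕ-pos : ∀ n .{{_ : NonZero n}} → 0# < fromℕ n
  fromℕ-pos (suc n) = <-≤-trans 0<1 (≤-respˡ (+-identityʳ 1#) (+-mono-≤ (≤-refl {1#}) (fromℕ-nonneg n)))

  fromℕ-mono-≤ : ∀ {m n} → m ℕ.≤ n → fromℕ m ≤ fromℕ n
  fromℕ-mono-≤ {n = n} ℕ.z≤n = fromℕ-nonneg n
  fromℕ-mono-≤ (ℕ.s≤s m≤n) = +-mono-≤ (≤-refl {1#}) (fromℕ-mono-≤ m≤n)

  private
    abstract
      fromℕ-inv : ∀ n .{{_ : NonZero n}} → ∃[ r ] r * (fromℕ n - 0#) ≈ 1#
      fromℕ-inv n = let (r , eq , _) = #⇒invertible (#-sym (<⇒# (fromℕ-pos n))) in r , eq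
        where
        open Algebra.Apartness.Bundles.HeytingField heytingField using (#-sym)

  1/ : ∀ n .{{_ : NonZero n}} → Carrier
  1/ n = proj₁ (fromℕ-inv n)

  1/-inverse : ∀ n .{{_ : NonZero n}} → 1/ n * fromℕ n ≈ 1#
  1/-inverse n = trans (*-congˡ (sym (trans (+-congˡ -0#≈0#) (+-identityʳ _)))) (proj₂ (fromℕ-inv n))

  1/-nonneg : ∀ n .{{_ : NonZero n}} → 0# ≤ 1/ n
  1/-nonneg n = *-cancelˡ-≤ (fromℕ n) (fromℕ-pos n)
    (≤-respˡ (sym (zeroˡ _)) (≤-respʳ (sym (1/-inverse n)) (<⇒≤ 0<1)))

  private
    frac-clear : ∀ a d e .{{_ : NonZero d}} → (fromℕ a * 1/ d) * (fromℕ d * e) ≈ fromℕ a * e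
    frac-clear a d e = begin
      (fromℕ a * 1/ d) * (fromℕ d * e)   ≈⟨ Solver.solve 4 (λ a r d e → (a :* r) :* (d :* e) := (r :* d) :* (a :* e)) refl (fromℕ a) (1/ d) (fromℕ d) e ⟩
      (1/ d * fromℕ d) * (fromℕ a * e)   ≈⟨ *-congʳ (1/-inverse d) ⟩
      1# * (fromℕ a * e)                 ≈⟨ *-identityˡ _ ⟩
      fromℕ a * e                        ∎
      where open Solver

  frac-mono-≤ : ∀ a d b e .{{_ : NonZero d}} .{{_ : NonZero e}} → a ℕ.* e ℕ.≤ b ℕ.* d →
                fromℕ a * 1/ d ≤ fromℕ b * 1/ e
  frac-mono-≤ a d b e le = *-cancelˡ-≤ (fromℕ d * fromℕ e) (*-pos (fromℕ-pos d) (fromℕ-pos e))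
    (≤-respˡ (trans (×1-homo-* a e) (sym (frac-clear a d (fromℕ e))))
    (≤-respʳ (trans (×1-homo-* b d) (sym (trans (*-congˡ (*-comm _ _)) (frac-clear b e (fromℕ d)))))
      (fromℕ-mono-≤ le)))

  1/-mono-≤ : ∀ m n .{{_ : NonZero m}} .{{_ : NonZero n}} → m ℕ.≤ n → 1/ n ≤ 1/ m
  1/-mono-≤ m n m≤n = ≤-respˡ (one n) (≤-respʳ (one m) (frac-mono-≤ 1 n 1 m (ℕₚ.+-monoˡ-≤ 0 m≤n)))
    where
    one : ∀ n .{{_ : NonZero n}} → fromℕ 1 * 1/ n ≈ 1/ n
    one n = trans (*-congʳ (+-identityʳ 1#)) (*-identityˡ _)

  1/-telescope : ∀ n → 1/ (suc n) - 1/ (suc (suc n)) ≈ 1/ (suc n ℕ.* suc (suc n))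
  1/-telescope n = begin
    r - s                                ≈⟨ sym (*-identityˡ _) ⟩
    1# * (r - s)                         ≈⟨ *-congʳ (sym (1/-inverse (suc n ℕ.* suc (suc n)))) ⟩
    (q * fromℕ (suc n ℕ.* suc (suc n))) * (r - s)
                                         ≈⟨ *-congʳ (*-congˡ (×1-homo-* (suc n) (suc (suc n)))) ⟩
    (q * (a * (1# + a))) * (r - s)       ≈⟨ solve 5 (λ q a u r s → (q :* (a :* (u :+ a))) :* (r :+ (:- s)) := q :* (((r :* a) :* (u :+ a)) :+ (:- ((s :* (u :+ a)) :* a)))) refl q a 1# r s ⟩
    q * ((r * a) * (1# + a) - (s * (1# + a)) * a)
                                         ≈⟨ *-congˡ (+-cong (trans (*-congʳ (1/-inverse (suc n))) (*-identityˡ _)) (-‿cong (trans (*-congʳ (1/-inverse (suc (suc n)))) (*-identityˡ _)))) ⟩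
    q * ((1# + a) - a)                   ≈⟨ *-congˡ (x+z-z 1# a) ⟩
    q * 1#                               ≈⟨ *-identityʳ _ ⟩
    q                                    ∎
    where
    open Solver
    r = 1/ (suc n)
    s = 1/ (suc (suc n))
    q = 1/ (suc n ℕ.* suc (suc n))
    a = fromℕ (suc n)

  -- ∣ x ∣ ≤ B
  Bounded : Carrier → Carrier → Set ℓ₂
  Bounded B x = (- B ≤ x) × (x ≤ B)

  bounded-+ : ∀ {B C x y} → Bounded B x → Bounded C y → Bounded (B + C) (x + y)
  bounded-+ (l , u) (l′ , u′) = ≤-respˡ (-‿+-comm _ _) (+-mono-≤ l l′) , +-mono-≤ u u′

  bounded-neg : ∀ {B x} → Bounded B x → Bounded B (- x)
  bounded-neg {B} (l , u) = neg-mono-≤ u , ≤-respʳ (-‿involutive B) (neg-mono-≤ l)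

  bounded-mono : ∀ {B C x} → B ≤ C → Bounded B x → Bounded C x
  bounded-mono B≤C (l , u) = ≤-trans (neg-mono-≤ B≤C) l , ≤-trans u B≤C

  bounded-resp : ∀ {B x y} → x ≈ y → Bounded B x → Bounded B y
  bounded-resp eq (l , u) = ≤-respʳ eq l , ≤-respˡ eq u

  private
    two*-nonneg : ∀ {x} → 0# ≤ x + x → 0# ≤ x
    two*-nonneg le x<0 = le (<-respʳ (+-identityˡ 0#) (<-trans (+-monoˡ-< _ x<0) (+-monoʳ-< 0# x<0)))

  bounded-* : ∀ {B C x y} → Bounded B x → Bounded C y → Bounded (B * C) (x * y)
  bounded-* {B} {C} {x} {y} (l , u) (l′ , u′) =
      0≤⇒≤ (two*-nonneg (≤-respʳ eq₁ (+-mono₀ (*-nonneg B-x C+y) (*-nonneg B+x C+y′))))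
    , 0≤⇒≤ (two*-nonneg (≤-respʳ eq₂ (+-mono₀ (*-nonneg B-x C+y″) (*-nonneg B+x C-y))))
    where
    open Solver
    +-mono₀ : ∀ {a b} → 0# ≤ a → 0# ≤ b → 0# ≤ a + b
    +-mono₀ p q = ≤-respˡ (+-identityˡ 0#) (+-mono-≤ p q)
    B-x = ≤⇒0≤ u
    B+x = ≤⇒0≤ l
    C-y = ≤⇒0≤ u′
    C+y = C-y
    C+y′ = ≤⇒0≤ l′
    C+y″ = ≤⇒0≤ l′
    eq₁ : (B - x) * (C - y) + (x - - B) * (y - - C) ≈ (x * y - - (B * C)) + (x * y - - (B * C))
    eq₁ = solve 4 (λ B C x y → (B :+ (:- x)) :* (C :+ (:- y)) :+ (x :+ (:- (:- B))) :* (y :+ (:- (:- C)))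
                     := (x :* y :+ (:- (:- (B :* C)))) :+ (x :* y :+ (:- (:- (B :* C))))) refl B C x y
    eq₂ : (B - x) * (y - - C) + (x - - B) * (C - y) ≈ (B * C - x * y) + (B * C - x * y)
    eq₂ = solve 4 (λ B C x y → (B :+ (:- x)) :* (y :+ (:- (:- C))) :+ (x :+ (:- (:- B))) :* (C :+ (:- y))
                     := (B :* C :+ (:- (x :* y))) :+ (B :* C :+ (:- (x :* y)))) refl B C x y

  1/-pos : ∀ n .{{_ : NonZero n}} → 0# < 1/ n
  1/-pos n = pos (#⇒< (invertible⇒# {1/ n} {0#} (fromℕ n , trans (*-comm _ _) inv , inv)))
    where
    inv : (1/ n - 0#) * fromℕ n ≈ 1#
    inv = trans (*-congʳ (trans (+-congˡ -0#≈0#) (+-identityʳ _))) (1/-inverse n)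
    pos : 1/ n < 0# ⊎ 0# < 1/ n → 0# < 1/ n
    pos (inj₁ r<0) = ⊥-elim (1/-nonneg n r<0)
    pos (inj₂ 0<r) = 0<r

  private
    rearrange : ∀ a k w r e → ((a - k * w) * r) * e ≈ (r * a) * e - (k * r) * (w * e)
    rearrange = Solver.solve 5 (λ a k w r e → ((a :+ (:- (k :* w))) :* r) :* e
                                         := ((r :* a) :* e) :+ (:- ((k :* r) :* (w :* e)))) refl
      where open Solver

    neg-inverse : ∀ w e → - w * e ≈ w * (0# - e)
    neg-inverse = Solver.solve 2 (λ w e → (:- w) :* e := w :* (con (+ 0) :+ (:- e))) refl
      where open Solver

    inverse : ∀ ε → 0# < ε → ∃[ w ] w * ε ≈ 1#
    inverse ε 0<ε = let (w , eq , _) = #⇒invertible (<⇒# 0<ε) in - w , trans (neg-inverse w ε) eq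

    squeeze : ∀ a k w r ε → k * w < a → 0# < r → 0# < ε → r * a ≈ 1# → w * ε ≈ 1# → k * r < ε
    squeeze a k w r ε lt 0<r 0<ε ra wε = 0<⇒< (<-respʳ eq (*-pos (*-pos (<⇒0< lt) 0<r) 0<ε))
      where
      eq : ((a - k * w) * r) * ε ≈ ε - k * r
      eq = trans (rearrange a k w r ε)
        (+-cong (trans (*-congʳ ra) (*-identityˡ _)) (-‿cong (trans (*-congˡ wε) (*-identityʳ _))))

  rate-small : ∀ K ε → 0# < ε → ∃[ N ] ∀ n → N ℕ.≤ n → fromℕ K * 1/ (suc n) < ε
  rate-small K ε 0<ε = N , λ n N≤n → squeeze (fromℕ (suc n)) (fromℕ K) w (1/ (suc n)) ε
      (lt n N≤n) (1/-pos (suc n)) 0<ε (1/-inverse (suc n)) (proj₂ (inverse ε 0<ε))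
    where
    w = proj₁ (inverse ε 0<ε)
    N = proj₁ (archimedean (fromℕ K * w))
    lt : ∀ n → N ℕ.≤ n → fromℕ K * w < fromℕ (suc n)
    lt n N≤n = <-≤-trans (proj₂ (archimedean (fromℕ K * w))) (fromℕ-mono-≤ {N} {suc n} (ℕₚ.m≤n⇒m≤1+n N≤n))

  bounded⇒near : ∀ {B ε x y} → B < ε → Bounded B (x - y) → Near ε x y
  bounded⇒near {B} {ε} {x} {y} B<ε (l , u) =
      ≤-<-trans u B<ε
    , ≤-<-trans (≤-respˡ eq (≤-respʳ (-‿involutive B) (neg-mono-≤ l))) B<ε
    where
    eq : - (x - y) ≈ y - x
    eq = Solver.solve 2 (λ x y → :- (x :+ (:- y)) := y :+ (:- x)) refl x y
      where open Solver

  near-sym : ∀ {ε x y} → Near ε x y → Near ε y x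
  near-sym (p , q) = q , p

  rate⇒Cauchy : ∀ s K N → (∀ n m → N ℕ.≤ n → n ℕ.≤ m → Bounded (fromℕ K * 1/ (suc n)) (s m - s n)) → Cauchy s
  rate⇒Cauchy s K N rate ε 0<ε = N ℕ.⊔ N′ , λ m n N≤m N≤n → near m n N≤m N≤n (ℕₚ.≤-total m n)
    where
    N′ = proj₁ (rate-small K ε 0<ε)
    small = proj₂ (rate-small K ε 0<ε)
    dir : ∀ n m → N ℕ.⊔ N′ ℕ.≤ n → n ℕ.≤ m → Near ε (s m) (s n)
    dir n m le n≤m = bounded⇒near (small n (ℕₚ.≤-trans (ℕₚ.m≤n⊔m N N′) le))
                                  (rate n m (ℕₚ.≤-trans (ℕₚ.m≤m⊔n N N′) le) n≤m)
    near : ∀ m n → N ℕ.⊔ N′ ℕ.≤ m → N ℕ.⊔ N′ ℕ.≤ n → m ℕ.≤ n ⊎ n ℕ.≤ m → Near ε (s m) (s n)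
    near m n N≤m N≤n (inj₁ m≤n) = near-sym (dir m n N≤m m≤n)
    near m n N≤m N≤n (inj₂ n≤m) = dir n m N≤n n≤m

  partialSum : (ℕ → Carrier) → ℕ → Carrier
  partialSum f zero    = 0#
  partialSum f (suc n) = partialSum f n + f n

  -- a series whose n-th term is eventually at most K / ((n+1)(n+2)) in absolute value
  series-Cauchy : ∀ f K N → (∀ n → N ℕ.≤ n → Bounded (fromℕ K * 1/ (suc n ℕ.* suc (suc n))) (f n)) →
                  Cauchy (partialSum f)
  series-Cauchy f K N bnd = rate⇒Cauchy (partialSum f) K N rate
    where
    k = fromℕ K
    tail : ∀ n j → N ℕ.≤ n →
           Bounded (k * (1/ (suc n) - 1/ (suc (j ℕ.+ n)))) (partialSum f (j ℕ.+ n) - partialSum f n)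
    tail n zero N≤n = ≤-respˡ (sym (trans (-‿cong z) -0#≈0#)) (≤-respʳ (sym (-‿inverseʳ _)) ≤-refl)
                    , ≤-respʳ (sym z) (≤-respˡ (sym (-‿inverseʳ _)) ≤-refl)
      where
      z : k * (1/ (suc n) - 1/ (suc n)) ≈ 0#
      z = trans (*-congˡ (-‿inverseʳ _)) (zeroʳ k)
    tail n (suc j) N≤n = bounded-mono (≤-respʳ eqB ≤-refl) (bounded-resp eqS
        (bounded-+ (tail n j N≤n) (bnd (j ℕ.+ n) (ℕₚ.≤-trans N≤n (ℕₚ.m≤n+m n j)))))
      where
      open Solver
      p = partialSum f
      eqS : (p (j ℕ.+ n) - p n) + f (j ℕ.+ n) ≈ (p (j ℕ.+ n) + f (j ℕ.+ n)) - p n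
      eqS = solve 3 (λ a b c → (a :+ (:- b)) :+ c := (a :+ c) :+ (:- b)) refl (p (j ℕ.+ n)) (p n) (f (j ℕ.+ n))
      r₀ = 1/ (suc n)
      r₁ = 1/ (suc (j ℕ.+ n))
      r₂ = 1/ (suc (suc (j ℕ.+ n)))
      eqB : k * (r₀ - r₁) + k * 1/ (suc (j ℕ.+ n) ℕ.* suc (suc (j ℕ.+ n))) ≈ k * (r₀ - r₂)
      eqB = trans (+-congˡ (*-congˡ (sym (1/-telescope (j ℕ.+ n)))))
                  (solve 4 (λ k a b c → k :* (a :+ (:- b)) :+ k :* (b :+ (:- c)) := k :* (a :+ (:- c))) refl k r₀ r₁ r₂)
    rate : ∀ n m → N ℕ.≤ n → n ℕ.≤ m → Bounded (k * 1/ (suc n)) (partialSum f m - partialSum f n)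
    rate n m N≤n n≤m = ≡.subst (λ i → Bounded (k * 1/ (suc n)) (partialSum f i - partialSum f n))
      (ℕₚ.m∸n+n≡m n≤m) (bounded-mono (0≤⇒≤ (≤-respʳ eq (*-nonneg (fromℕ-nonneg K) (1/-nonneg (suc (j ℕ.+ n)))))) (tail n j N≤n))
      where
      open Solver
      j = m ℕ.∸ n
      eq : k * 1/ (suc (j ℕ.+ n)) ≈ k * 1/ (suc n) - k * (1/ (suc n) - 1/ (suc (j ℕ.+ n)))
      eq = solve 3 (λ k a b → k :* b := k :* a :+ (:- (k :* (a :+ (:- b))))) refl k (1/ (suc n)) (1/ (suc (j ℕ.+ n)))

  lim : ∀ s → Cauchy s → Carrier
  lim s cauchy = proj₁ (complete s cauchy)

  lim-≤ : ∀ s (cauchy : Cauchy s) B N → (∀ n → N ℕ.≤ n → s n ≤ B) → lim s cauchy ≤ B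
  lim-≤ s cauchy B N s≤B B<l with proj₂ (complete s cauchy) (lim s cauchy - B) (<⇒0< B<l)
  ... | N′ , near = s≤B n (ℕₚ.m≤m⊔n N N′) (0<⇒< (<-respʳ eq (<⇒0< (proj₂ (near n (ℕₚ.m≤n⊔m N N′))))))
    where
    n = N ℕ.⊔ N′
    eq : (lim s cauchy - B) - (lim s cauchy - s n) ≈ s n - B
    eq = solve 3 (λ l b x → (l :+ (:- b)) :+ (:- (l :+ (:- x))) := x :+ (:- b)) refl (lim s cauchy) B (s n)
      where open Solver

  ≤-lim : ∀ s (cauchy : Cauchy s) B N → (∀ n → N ℕ.≤ n → B ≤ s n) → B ≤ lim s cauchy
  ≤-lim s cauchy B N B≤s l<B with proj₂ (complete s cauchy) (B - lim s cauchy) (<⇒0< l<B)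
  ... | N′ , near = B≤s n (ℕₚ.m≤m⊔n N N′) (0<⇒< (<-respʳ eq (<⇒0< (proj₁ (near n (ℕₚ.m≤n⊔m N N′))))))
    where
    n = N ℕ.⊔ N′
    eq : (B - lim s cauchy) - (s n - lim s cauchy) ≈ B - s n
    eq = solve 3 (λ l b x → (b :+ (:- l)) :+ (:- (x :+ (:- l))) := b :+ (:- x)) refl (lim s cauchy) B (s n)
      where open Solver

-- ⌊√x⌋
isqrt : ℕ → ℕ
isqrt x = search x
  module ISqrt where
  search : ℕ → ℕ
  search zero    = zero
  search (suc b) with suc b ℕ.* suc b ℕₚ.≤? x
  ... | yes _ = suc b
  ... | no  _ = search b

isqrt-lower : ∀ x → isqrt x ℕ.* isqrt x ℕ.≤ x
isqrt-lower x = go x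
  where
  go : ∀ b → ISqrt.search x b ℕ.* ISqrt.search x b ℕ.≤ x
  go zero    = ℕ.z≤n
  go (suc b) with suc b ℕ.* suc b ℕₚ.≤? x
  ... | yes p = p
  ... | no  _ = go b

isqrt-upper : ∀ x → x ℕ.< suc (isqrt x) ℕ.* suc (isqrt x)
isqrt-upper x = go x (ℕₚ.m≤m*n (suc x) (suc x))
  where
  go : ∀ b → x ℕ.< suc b ℕ.* suc b → x ℕ.< suc (ISqrt.search x b) ℕ.* suc (ISqrt.search x b)
  go zero    lt = lt
  go (suc b) lt with suc b ℕ.* suc b ℕₚ.≤? x
  ... | yes _ = lt
  ... | no  p = go b (ℕₚ.≰⇒> p)

private
  square-cancel-≤ : ∀ a b → a ℕ.* a ℕ.≤ b ℕ.* b → a ℕ.≤ b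
  square-cancel-≤ a b le with a ℕₚ.≤? b
  ... | yes p = p
  ... | no  p = ⊥-elim (ℕₚ.<⇒≱ (ℕₚ.*-mono-< (ℕₚ.≰⇒> p) (ℕₚ.≰⇒> p)) le)

  isqrt-compare : ∀ M d e → isqrt (M ℕ.* (e ℕ.* e)) ℕ.* d ℕ.≤ suc (isqrt (M ℕ.* (d ℕ.* d))) ℕ.* e
  isqrt-compare M d e = square-cancel-≤ _ _ (begin
    (b ℕ.* d) ℕ.* (b ℕ.* d)             ≡⟨ sq b d ⟩
    (b ℕ.* b) ℕ.* (d ℕ.* d)             ≤⟨ ℕₚ.*-monoˡ-≤ (d ℕ.* d) (isqrt-lower (M ℕ.* (e ℕ.* e))) ⟩
    (M ℕ.* (e ℕ.* e)) ℕ.* (d ℕ.* d)     ≡⟨ swap M (e ℕ.* e) (d ℕ.* d) ⟩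
    (M ℕ.* (d ℕ.* d)) ℕ.* (e ℕ.* e)     ≤⟨ ℕₚ.*-monoˡ-≤ (e ℕ.* e) (ℕₚ.<⇒≤ (isqrt-upper (M ℕ.* (d ℕ.* d)))) ⟩
    (suc a ℕ.* suc a) ℕ.* (e ℕ.* e)     ≡⟨ sq (suc a) e ⟨
    (suc a ℕ.* e) ℕ.* (suc a ℕ.* e)     ∎)
    where
    open ℕₚ.≤-Reasoning
    a = isqrt (M ℕ.* (d ℕ.* d))
    b = isqrt (M ℕ.* (e ℕ.* e))
    sq : ∀ x y → (x ℕ.* y) ℕ.* (x ℕ.* y) ≡ (x ℕ.* x) ℕ.* (y ℕ.* y)
    sq = ℕ-solve-∀
    swap : ∀ x y z → (x ℕ.* y) ℕ.* z ≡ (x ℕ.* z) ℕ.* y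
    swap = ℕ-solve-∀

module RealConstants (ℝ : RealField c ℓ₁ ℓ₂) where

  open RealFacts ℝ

  -- √M is the limit of ⌊√(M(N+1)²)⌋ / (N+1)
  √-approx : ℕ → ℕ → Carrier
  √-approx M N = fromℕ (isqrt (M ℕ.* (suc N ℕ.* suc N))) * 1/ (suc N)

  √-approx-upper : ∀ M m n → √-approx M m ≤ √-approx M n + 1/ (suc n)
  √-approx-upper M m n = ≤-respʳ eq (frac-mono-≤ b (suc m) (suc a) (suc n) (isqrt-compare M (suc n) (suc m)))
    where
    a = isqrt (M ℕ.* (suc n ℕ.* suc n))
    b = isqrt (M ℕ.* (suc m ℕ.* suc m))
    eq : (1# + fromℕ a) * 1/ (suc n) ≈ fromℕ a * 1/ (suc n) + 1/ (suc n)
    eq = trans (distribʳ _ _ _) (trans (+-comm _ _) (+-congˡ (*-identityˡ _)))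

  private
    sub-≤ : ∀ {x y z} → x ≤ y + z → x - y ≤ z
    sub-≤ {x} {y} {z} le = ≤-respʳ eq (+-monoˡ-≤ (- y) le)
      where
      eq : (y + z) - y ≈ z
      eq = solve 2 (λ y z → (y :+ z) :+ (:- y) := z) refl y z
        where open Solver

    neg-sub : ∀ x y → - (x - y) ≈ y - x
    neg-sub = solve 2 (λ x y → :- (x :+ (:- y)) := y :+ (:- x)) refl
      where open Solver

    fromℕ-1 : fromℕ 1 ≈ 1#
    fromℕ-1 = +-identityʳ 1#

  √-approx-near : ∀ M n m → n ℕ.≤ m → Bounded (1/ (suc n)) (√-approx M m - √-approx M n)
  √-approx-near M n m n≤m =
      ≤-respʳ (neg-sub (√-approx M n) (√-approx M m)) (neg-mono-≤ (≤-trans (sub-≤ (√-approx-upper M n m))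
        (1/-mono-≤ (suc n) (suc m) (ℕ.s≤s n≤m))))
    , sub-≤ (√-approx-upper M m n)

  abstract
    √-Cauchy : ∀ M → Cauchy (√-approx M)
    √-Cauchy M = rate⇒Cauchy (√-approx M) 1 0 λ n m _ n≤m →
      bounded-mono (≤-respʳ (sym (trans (*-congʳ fromℕ-1) (*-identityˡ _))) ≤-refl) (√-approx-near M n m n≤m)

  √ : ℕ → Carrier
  √ M = lim (√-approx M) (√-Cauchy M)

  √-nonneg : ∀ M → 0# ≤ √ M
  √-nonneg M = ≤-lim (√-approx M) (√-Cauchy M) 0# 0 λ n _ → *-nonneg (fromℕ-nonneg (isqrt (M ℕ.* (suc n ℕ.* suc n)))) (1/-nonneg (suc n))

  private
    add-back : ∀ x y → (x - y) + y ≈ x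
    add-back = solve 2 (λ x y → (x :+ (:- y)) :+ y := x) refl
      where open Solver

    √-error : ∀ M n → Bounded (1/ (suc n)) (√ M - √-approx M n)
    √-error M n =
        ≤-respˡ (x+y-x s r) (+-monoˡ-≤ (- s) (≤-lim (√-approx M) (√-Cauchy M) (- r + s) n λ m n≤m →
          ≤-respʳ (add-back (√-approx M m) s) (+-monoˡ-≤ s (proj₁ (√-approx-near M n m n≤m)))))
      , sub-≤ (lim-≤ (√-approx M) (√-Cauchy M) (s + r) n λ m n≤m → √-approx-upper M m n)
      where
      s = √-approx M n
      r = 1/ (suc n)
      x+y-x : ∀ s r → (- r + s) - s ≈ - r
      x+y-x = solve 2 (λ s r → ((:- r) :+ s) :+ (:- s) := :- r) refl
        where open Solver

    scaled : ∀ x d r → r * d ≈ 1# → (x * (d * d)) * (r * r) ≈ x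
    scaled x d r rd =
      trans (solve 3 (λ x d r → (x :* (d :* d)) :* (r :* r) := x :* ((r :* d) :* (r :* d))) refl x d r)
        (trans (*-congˡ (trans (*-cong rd rd) (*-identityˡ 1#))) (*-identityʳ x))
      where open Solver

    scaled-sq : ∀ y r → (y * y) * (r * r) ≈ (y * r) * (y * r)
    scaled-sq = solve 2 (λ y r → (y :* y) :* (r :* r) := (y :* r) :* (y :* r)) refl
      where open Solver

    rescale : ∀ x y d r → r * d ≈ 1# → 0# ≤ r → x * (d * d) ≤ y * y → x ≤ (y * r) * (y * r)
    rescale x y d r rd 0≤r le = ≤-respˡ (scaled x d r rd) (≤-respʳ (scaled-sq y r) (*-monoˡ-≤ (r * r) (*-nonneg 0≤r 0≤r) le))

    unscale : ∀ x y d r → r * d ≈ 1# → 0# ≤ r → y * y ≤ x * (d * d) → (y * r) * (y * r) ≤ x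
    unscale x y d r rd 0≤r le = ≤-respʳ (scaled x d r rd) (≤-respˡ (scaled-sq y r) (*-monoˡ-≤ (r * r) (*-nonneg 0≤r 0≤r) le))

    -- M lies between s² and (s + 1/(n+1))², where s is the n-th approximation
    √-approx-sq-lower : ∀ M n → √-approx M n * √-approx M n ≤ fromℕ M
    √-approx-sq-lower M n = unscale (fromℕ M) (fromℕ a) (fromℕ (suc n)) (1/ (suc n)) (1/-inverse (suc n)) (1/-nonneg (suc n))
      (≤-respˡ (×1-homo-* a a) (≤-respʳ (trans (×1-homo-* M (suc n ℕ.* suc n)) (*-congˡ (×1-homo-* (suc n) (suc n))))
        (fromℕ-mono-≤ (isqrt-lower (M ℕ.* (suc n ℕ.* suc n))))))
      where a = isqrt (M ℕ.* (suc n ℕ.* suc n))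

    √-approx-sq-upper : ∀ M n → let t = √-approx M n + 1/ (suc n) in fromℕ M ≤ t * t
    √-approx-sq-upper M n = ≤-respʳ (*-cong eq eq)
      (rescale (fromℕ M) (fromℕ (suc a)) (fromℕ (suc n)) (1/ (suc n)) (1/-inverse (suc n)) (1/-nonneg (suc n))
      (≤-respʳ (×1-homo-* (suc a) (suc a)) (≤-respˡ (trans (×1-homo-* M (suc n ℕ.* suc n)) (*-congˡ (×1-homo-* (suc n) (suc n))))
        (fromℕ-mono-≤ (ℕₚ.<⇒≤ (isqrt-upper (M ℕ.* (suc n ℕ.* suc n))))))))
      where
      a = isqrt (M ℕ.* (suc n ℕ.* suc n))
      eq : (1# + fromℕ a) * 1/ (suc n) ≈ fromℕ a * 1/ (suc n) + 1/ (suc n)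
      eq = trans (distribʳ _ _ _) (trans (+-comm _ _) (+-congˡ (*-identityˡ _)))

    √-approx-≤ : ∀ M n → √-approx M n ≤ fromℕ M
    √-approx-≤ M n = ≤-respʳ (trans (*-congˡ one) (*-identityʳ _))
      (frac-mono-≤ a (suc n) M 1 (≡.subst (ℕ._≤ M ℕ.* suc n) (≡.sym (ℕₚ.*-identityʳ a)) (square-cancel-≤ a (M ℕ.* suc n)
        (ℕₚ.≤-trans (isqrt-lower (M ℕ.* (suc n ℕ.* suc n))) (expand M (suc n))))))
      where
      a = isqrt (M ℕ.* (suc n ℕ.* suc n))
      one : 1/ 1 ≈ 1#
      one = trans (sym (*-identityʳ _)) (trans (*-congˡ (sym fromℕ-1)) (1/-inverse 1))
      expand : ∀ M d → M ℕ.* (d ℕ.* d) ℕ.≤ (M ℕ.* d) ℕ.* (M ℕ.* d)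
      expand zero    d = ℕ.z≤n
      expand (suc M) d = ℕₚ.≤-trans (ℕₚ.*-monoˡ-≤ (d ℕ.* d) (ℕₚ.m≤m*n (suc M) (suc M))) (ℕₚ.≤-reflexive (eq (suc M) d))
        where
        eq : ∀ M d → (M ℕ.* M) ℕ.* (d ℕ.* d) ≡ (M ℕ.* d) ℕ.* (M ℕ.* d)
        eq = ℕ-solve-∀

  squeeze-≈ : ∀ {x y} K → (∀ n → Bounded (fromℕ K * 1/ (suc n)) (x - y)) → x ≈ y
  squeeze-≈ {x} {y} K bnd = ≤-antisym
      (λ y<x → let (n , small) = rate-small K (x - y) (<⇒0< y<x) in proj₂ (bnd n) (small n ℕₚ.≤-refl))
      (λ x<y → let (n , small) = rate-small K (y - x) (<⇒0< x<y) in
         ≤-respˡ (neg-sub x y) (≤-respʳ (-‿involutive _) (neg-mono-≤ (proj₁ (bnd n)))) (small n ℕₚ.≤-refl))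

  √-square : ∀ M → √ M * √ M ≈ fromℕ M
  √-square M = squeeze-≈ (2 ℕ.* suc (2 ℕ.* M)) bnd
    where
    bnd : ∀ n → Bounded (fromℕ (2 ℕ.* suc (2 ℕ.* M)) * 1/ (suc n)) (√ M * √ M - fromℕ M)
    bnd n = bounded-mono B+B≤ (bounded-resp eq (bounded-+ (bounded-* err (bounded-+ err s+s)) (bounded-neg gap)))
      where
      open Solver
      l = √ M
      s = √-approx M n
      r = 1/ (suc n)
      B = r * (r + (s + s))
      err = √-error M n
      0≤r = 1/-nonneg (suc n)
      +-nonneg : ∀ {a b} → 0# ≤ a → 0# ≤ b → 0# ≤ a + b
      +-nonneg p q = ≤-respˡ (+-identityˡ 0#) (+-mono-≤ p q)
      0≤s : 0# ≤ s
      0≤s = *-nonneg (fromℕ-nonneg (isqrt (M ℕ.* (suc n ℕ.* suc n)))) 0≤r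
      self : ∀ {a} → 0# ≤ a → Bounded a a
      self 0≤a = ≤-trans (≤-respʳ -0#≈0# (neg-mono-≤ 0≤a)) 0≤a , ≤-refl
      s+s : Bounded (s + s) (s + s)
      s+s = self (+-nonneg 0≤s 0≤s)
      gap : Bounded B (fromℕ M - s * s)
      gap = ≤-trans (≤-respʳ -0#≈0# (neg-mono-≤ (*-nonneg 0≤r (+-nonneg 0≤r (+-nonneg 0≤s 0≤s)))))
                    (≤⇒0≤ (√-approx-sq-lower M n))
          , sub-≤ (≤-respʳ (solve 2 (λ s r → (s :+ r) :* (s :+ r) := s :* s :+ r :* (r :+ (s :+ s))) refl s r)
                           (√-approx-sq-upper M n))
      eq : (l - s) * ((l - s) + (s + s)) - (fromℕ M - s * s) ≈ l * l - fromℕ M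
      eq = solve 3 (λ l s m → (l :+ (:- s)) :* ((l :+ (:- s)) :+ (s :+ s)) :+ (:- (m :+ (:- (s :* s))))
                     := l :* l :+ (:- m)) refl l s (fromℕ M)
      r≤1 : r ≤ 1#
      r≤1 = *-cancelˡ-≤ (fromℕ (suc n)) (fromℕ-pos (suc n)) (≤-respˡ (sym (1/-inverse (suc n)))
              (≤-respʳ (sym (*-identityˡ _)) (≤-respˡ fromℕ-1 (fromℕ-mono-≤ (ℕ.s≤s (ℕ.z≤n {n}))))))
      s≤M = √-approx-≤ M n
      m = fromℕ M
      K = fromℕ (2 ℕ.* suc (2 ℕ.* M))
      c≈ : (1# + (m + m)) + (1# + (m + m)) ≈ K
      c≈ = sym (begin
        fromℕ (2 ℕ.* suc (2 ℕ.* M))           ≈⟨ twice (suc (2 ℕ.* M)) ⟩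
        fromℕ (suc (2 ℕ.* M)) + fromℕ (suc (2 ℕ.* M)) ≈⟨ +-cong (+-congˡ (twice M)) (+-congˡ (twice M)) ⟩
        (1# + (m + m)) + (1# + (m + m))       ∎)
        where
        open import Relation.Binary.Reasoning.Setoid setoid
        twice : ∀ k → fromℕ (2 ℕ.* k) ≈ fromℕ k + fromℕ k
        twice k = trans (fromℕ-+ k (k ℕ.+ 0)) (+-congˡ (reflexive (≡.cong fromℕ (ℕₚ.+-identityʳ k))))
      B≤ : B ≤ (1# + (m + m)) * r
      B≤ = ≤-respˡ (*-comm _ _) (*-monoˡ-≤ r 0≤r (+-mono-≤ r≤1 (+-mono-≤ s≤M s≤M)))
      B+B≤ : B + B ≤ K * r
      B+B≤ = ≤-respʳ (trans (sym (distribʳ _ _ _)) (*-congʳ c≈)) (+-mono-≤ B≤ B≤)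

  -- Leibniz: π = Σ_{n≥0} (4/(4n+1) − 4/(4n+3)) = Σ_{n≥0} 8/((4n+1)(4n+3))
  πTerm : ℕ → Carrier
  πTerm n = fromℕ 8 * 1/ (suc (4 ℕ.* n) ℕ.* suc (suc (suc (4 ℕ.* n))))

  private
    πTerm-bound : ∀ n → 8 ℕ.* (suc n ℕ.* suc (suc n)) ℕ.≤ 6 ℕ.* (suc (4 ℕ.* n) ℕ.* suc (suc (suc (4 ℕ.* n))))
    πTerm-bound n = ℕₚ.≤-trans (ℕₚ.m≤m+n _ (2 ℕ.+ 72 ℕ.* n ℕ.+ 88 ℕ.* (n ℕ.* n))) (ℕₚ.≤-reflexive (eq n))
      where
      eq : ∀ n → 8 ℕ.* (suc n ℕ.* suc (suc n)) ℕ.+ (2 ℕ.+ 72 ℕ.* n ℕ.+ 88 ℕ.* (n ℕ.* n))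
               ≡ 6 ℕ.* (suc (4 ℕ.* n) ℕ.* suc (suc (suc (4 ℕ.* n))))
      eq = ℕ-solve-∀

  abstract
    π-Cauchy : Cauchy (partialSum πTerm)
    π-Cauchy = series-Cauchy πTerm 6 0 λ n _ →
        ≤-trans (≤-respʳ -0#≈0# (neg-mono-≤ (*-nonneg (fromℕ-nonneg 6) (1/-nonneg (suc n ℕ.* suc (suc n))))))
                (*-nonneg (fromℕ-nonneg 8) (1/-nonneg (suc (4 ℕ.* n) ℕ.* suc (suc (suc (4 ℕ.* n))))))
      , frac-mono-≤ 8 (suc (4 ℕ.* n) ℕ.* suc (suc (suc (4 ℕ.* n)))) 6 (suc n ℕ.* suc (suc n)) (πTerm-bound n)

  π : Carrier
  π = lim (partialSum πTerm) π-Cauchy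

module Complex (ℝ : RealField c ℓ₁ ℓ₂) where

  open RealFacts ℝ
  open RealConstants ℝ using (π)

  infix 5 _+i_
  record ℂ : Set c where
    constructor _+i_
    field
      re im : Carrier
  open ℂ public

  infix  4 _≈ᶜ_
  infixl 6 _+ᶜ_
  infixl 7 _*ᶜ_
  infix  8 -ᶜ_

  _≈ᶜ_ : Rel ℂ ℓ₁
  w ≈ᶜ z = (re w ≈ re z) × (im w ≈ im z)

  _+ᶜ_ _*ᶜ_ : ℂ → ℂ → ℂ
  w +ᶜ z = (re w + re z) +i (im w + im z)
  w *ᶜ z = (re w * re z - im w * im z) +i (re w * im z + im w * re z)

  -ᶜ_ : ℂ → ℂ
  -ᶜ z = (- re z) +i (- im z)

  ofReal : Carrier → ℂ
  ofReal x = x +i 0#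

  0ᶜ 1ᶜ 𝕚 : ℂ
  0ᶜ = ofReal 0#
  1ᶜ = ofReal 1#
  𝕚  = 0# +i 1#

  ℂ-commutativeRing : CommutativeRing c ℓ₁
  ℂ-commutativeRing = record
    { Carrier = ℂ ; _≈_ = _≈ᶜ_ ; _+_ = _+ᶜ_ ; _*_ = _*ᶜ_ ; -_ = -ᶜ_ ; 0# = 0ᶜ ; 1# = 1ᶜ
    ; isCommutativeRing = record
      { isRing = record
        { +-isAbelianGroup = record
          { isGroup = record
            { isMonoid = record
              { isSemigroup = record
                { isMagma = record
                  { isEquivalence = record
                    { refl  = refl , refl
                    ; sym   = λ (p , q) → sym p , sym q
                    ; trans = λ (p , q) (p′ , q′) → trans p p′ , trans q q′
                    }
                  ; ∙-cong = λ (p , q) (p′ , q′) → +-cong p p′ , +-cong q q′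
                  }
                ; assoc = λ _ _ _ → +-assoc _ _ _ , +-assoc _ _ _
                }
              ; identity = (λ _ → +-identityˡ _ , +-identityˡ _) , (λ _ → +-identityʳ _ , +-identityʳ _)
              }
            ; inverse = (λ _ → -‿inverseˡ _ , -‿inverseˡ _) , (λ _ → -‿inverseʳ _ , -‿inverseʳ _)
            ; ⁻¹-cong = λ (p , q) → -‿cong p , -‿cong q
            }
          ; comm = λ _ _ → +-comm _ _ , +-comm _ _
          }
        ; *-cong = λ (p , q) (p′ , q′) →
            +-cong (*-cong p p′) (-‿cong (*-cong q q′)) , +-cong (*-cong p q′) (*-cong q p′)
        ; *-assoc = λ (a +i b) (x +i y) (u +i v) → assoc-re a b x y u v , assoc-im a b x y u v
        ; *-identity = (λ (a +i b) → 1*-re a b , 1*-im a b)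
                     , (λ (a +i b) → trans (*-comm′ a b) (1*-re a b) , trans (*-comm″ a b) (1*-im a b))
        ; distrib = (λ (a +i b) (x +i y) (u +i v) → distribˡ-re a b x y u v , distribˡ-im a b x y u v)
                  , (λ (a +i b) (x +i y) (u +i v) → distribʳ-re a b x y u v , distribʳ-im a b x y u v)
        }
      ; *-comm = λ (a +i b) (x +i y) → comm-re a b x y , comm-im a b x y
      }
    }
    where
    open Solver
    assoc-re : ∀ a b x y u v → (a * x - b * y) * u - (a * y + b * x) * v ≈ a * (x * u - y * v) - b * (x * v + y * u)
    assoc-re = solve 6 (λ a b x y u v → (a :* x :- b :* y) :* u :- (a :* y :+ b :* x) :* v := a :* (x :* u :- y :* v) :- b :* (x :* v :+ y :* u)) refl
    assoc-im : ∀ a b x y u v → (a * x - b * y) * v + (a * y + b * x) * u ≈ a * (x * v + y * u) + b * (x * u - y * v)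
    assoc-im = solve 6 (λ a b x y u v → (a :* x :- b :* y) :* v :+ (a :* y :+ b :* x) :* u := a :* (x :* v :+ y :* u) :+ b :* (x :* u :- y :* v)) refl
    1*-re : ∀ a b → 1# * a - 0# * b ≈ a
    1*-re a b = trans (+-cong (*-identityˡ a) (trans (-‿cong (zeroˡ b)) -0#≈0#)) (+-identityʳ a)
    1*-im : ∀ a b → 1# * b + 0# * a ≈ b
    1*-im a b = trans (+-cong (*-identityˡ b) (zeroˡ a)) (+-identityʳ b)
    *-comm′ : ∀ a b → a * 1# - b * 0# ≈ 1# * a - 0# * b
    *-comm′ a b = +-cong (*-comm _ _) (-‿cong (*-comm _ _))
    *-comm″ : ∀ a b → a * 0# + b * 1# ≈ 1# * b + 0# * a
    *-comm″ a b = trans (+-comm _ _) (+-cong (*-comm _ _) (*-comm _ _))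
    distribˡ-re : ∀ a b x y u v → a * (x + u) - b * (y + v) ≈ (a * x - b * y) + (a * u - b * v)
    distribˡ-re = solve 6 (λ a b x y u v → a :* (x :+ u) :- b :* (y :+ v) := (a :* x :- b :* y) :+ (a :* u :- b :* v)) refl
    distribˡ-im : ∀ a b x y u v → a * (y + v) + b * (x + u) ≈ (a * y + b * x) + (a * v + b * u)
    distribˡ-im = solve 6 (λ a b x y u v → a :* (y :+ v) :+ b :* (x :+ u) := (a :* y :+ b :* x) :+ (a :* v :+ b :* u)) refl
    distribʳ-re : ∀ a b x y u v → (x + u) * a - (y + v) * b ≈ (x * a - y * b) + (u * a - v * b)
    distribʳ-re = solve 6 (λ a b x y u v → (x :+ u) :* a :- (y :+ v) :* b := (x :* a :- y :* b) :+ (u :* a :- v :* b)) refl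
    distribʳ-im : ∀ a b x y u v → (x + u) * b + (y + v) * a ≈ (x * b + y * a) + (u * b + v * a)
    distribʳ-im = solve 6 (λ a b x y u v → (x :+ u) :* b :+ (y :+ v) :* a := (x :* b :+ y :* a) :+ (u :* b :+ v :* a)) refl
    comm-re : ∀ a b x y → a * x - b * y ≈ x * a - y * b
    comm-re a b x y = +-cong (*-comm _ _) (-‿cong (*-comm _ _))
    comm-im : ∀ a b x y → a * y + b * x ≈ x * b + y * a
    comm-im a b x y = trans (+-comm _ _) (+-cong (*-comm _ _) (*-comm _ _))

  ℂ-rawSemiring : RawSemiring c ℓ₁
  ℂ-rawSemiring = Semiring.rawSemiring (CommutativeRing.semiring ℂ-commutativeRing)

  open RawSemiringDefinitions ℂ-rawSemiring public using () renaming (_^_ to _^ᶜ_)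

  infixr 7 _∙_
  _∙_ : Carrier → ℂ → ℂ
  a ∙ z = (a * re z) +i (a * im z)

  -- zⁿ / n!
  expTerm : ℂ → ℕ → ℂ
  expTerm z n = 1/ (n !) {{ℕₚ._!≢0 n}} ∙ (z ^ᶜ n)

  private
    bound : ∀ x → ∃[ N ] Bounded (fromℕ N) x
    bound x = let (m , x<m) = archimedean x ; (n , -x<n) = archimedean (- x) in
      m ℕ.⊔ n
      , ≤-respʳ (-‿involutive x) (neg-mono-≤ (≤-trans (<⇒≤ -x<n) (fromℕ-mono-≤ (ℕₚ.m≤n⊔m m n))))
      , ≤-trans (<⇒≤ x<m) (fromℕ-mono-≤ (ℕₚ.m≤m⊔n m n))

    0≤⇒bounded : ∀ {x} → 0# ≤ x → Bounded x x
    0≤⇒bounded 0≤x = ≤-trans (≤-respʳ -0#≈0# (neg-mono-≤ 0≤x)) 0≤x , ≤-refl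

    power-bound : ∀ z M → Bounded (fromℕ M) (re z) → Bounded (fromℕ M) (im z) → ∀ n →
                  Bounded (fromℕ ((M ℕ.+ M) ℕ.^ n)) (re (z ^ᶜ n)) × Bounded (fromℕ ((M ℕ.+ M) ℕ.^ n)) (im (z ^ᶜ n))
    power-bound z M bre bim zero =
        bounded-mono (≤-respˡ (+-identityʳ 1#) ≤-refl) (0≤⇒bounded (<⇒≤ 0<1))
      , bounded-mono (fromℕ-nonneg 1) (0≤⇒bounded ≤-refl)
    power-bound z M bre bim (suc n) with power-bound z M bre bim n
    ... | bre′ , bim′ =
        bounded-mono double (bounded-+ (bounded-* bre bre′) (bounded-neg (bounded-* bim bim′)))
      , bounded-mono double (bounded-+ (bounded-* bre bim′) (bounded-* bim bre′))
      where
      P = (M ℕ.+ M) ℕ.^ n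
      double : fromℕ M * fromℕ P + fromℕ M * fromℕ P ≤ fromℕ ((M ℕ.+ M) ℕ.* P)
      double = ≤-respˡ (trans (×1-homo-* (M ℕ.+ M) P) (trans (*-congʳ (fromℕ-+ M M)) (distribʳ _ _ _))) ≤-refl

    factorial-bound : ∀ P n → P ℕ.+ 2 ℕ.≤ n →
      P ℕ.^ n ℕ.* (suc n ℕ.* suc (suc n)) ℕ.≤ (P ℕ.^ (P ℕ.+ 2) ℕ.* (suc (P ℕ.+ 2) ℕ.* suc (suc (P ℕ.+ 2)))) ℕ.* n !
    factorial-bound P n N≤n = ≡.subst (λ m → P ℕ.^ m ℕ.* (suc m ℕ.* suc (suc m)) ℕ.≤ K ℕ.* m !) (ℕₚ.m∸n+n≡m N≤n) (go (n ℕ.∸ N))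
      where
      open ℕₚ.≤-Reasoning
      N = P ℕ.+ 2
      K = P ℕ.^ N ℕ.* (suc N ℕ.* suc (suc N))
      go : ∀ j → let m = j ℕ.+ N in P ℕ.^ m ℕ.* (suc m ℕ.* suc (suc m)) ℕ.≤ K ℕ.* m !
      go zero    = ℕₚ.m≤m*n K (N !) {{ℕₚ._!≢0 N}}
      go (suc j) = begin
        (P ℕ.* Q) ℕ.* (suc (suc m) ℕ.* suc (suc (suc m)))  ≡⟨ shuffle₁ P Q m ⟩
        (P ℕ.* (3 ℕ.+ m)) ℕ.* (Q ℕ.* suc (suc m))          ≤⟨ ℕₚ.*-monoˡ-≤ (Q ℕ.* suc (suc m)) ratio ⟩
        (suc m ℕ.* suc m) ℕ.* (Q ℕ.* suc (suc m))          ≡⟨ shuffle₂ Q m ⟩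
        suc m ℕ.* (Q ℕ.* (suc m ℕ.* suc (suc m)))          ≤⟨ ℕₚ.*-monoʳ-≤ (suc m) (go j) ⟩
        suc m ℕ.* (K ℕ.* m !)                              ≡⟨ shuffle₃ (suc m) K (m !) ⟩
        K ℕ.* (suc m ℕ.* m !)                              ∎
        where
        m = j ℕ.+ N
        Q = P ℕ.^ m
        shuffle₁ : ∀ P Q m → (P ℕ.* Q) ℕ.* (suc (suc m) ℕ.* suc (suc (suc m))) ≡ (P ℕ.* (3 ℕ.+ m)) ℕ.* (Q ℕ.* suc (suc m))
        shuffle₁ = ℕ-solve-∀
        shuffle₂ : ∀ Q m → (suc m ℕ.* suc m) ℕ.* (Q ℕ.* suc (suc m)) ≡ suc m ℕ.* (Q ℕ.* (suc m ℕ.* suc (suc m)))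
        shuffle₂ = ℕ-solve-∀
        shuffle₃ : ∀ x y z → x ℕ.* (y ℕ.* z) ≡ y ℕ.* (x ℕ.* z)
        shuffle₃ = ℕ-solve-∀
        -- with m = P + 2 + j:  P(m + 3) ≤ (m + 1)²
        expand : ∀ P j → P ℕ.* (3 ℕ.+ (j ℕ.+ (P ℕ.+ 2))) ℕ.+ (9 ℕ.+ P ℕ.+ j ℕ.* P ℕ.+ 6 ℕ.* j ℕ.+ j ℕ.* j)
                       ≡ suc (j ℕ.+ (P ℕ.+ 2)) ℕ.* suc (j ℕ.+ (P ℕ.+ 2))
        expand = ℕ-solve-∀
        ratio : P ℕ.* (3 ℕ.+ m) ℕ.≤ suc m ℕ.* suc m
        ratio = ℕₚ.≤-trans (ℕₚ.m≤m+n _ _) (ℕₚ.≤-reflexive (expand P j))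

    exp-part-Cauchy : ∀ P (x : ℕ → Carrier) → (∀ n → Bounded (fromℕ (P ℕ.^ n)) (x n)) →
                      Cauchy (partialSum λ n → 1/ (n !) {{ℕₚ._!≢0 n}} * x n)
    exp-part-Cauchy P x bnd = series-Cauchy (λ n → 1/ (n !) {{ℕₚ._!≢0 n}} * x n) K (P ℕ.+ 2) small
      where
      K = P ℕ.^ (P ℕ.+ 2) ℕ.* (suc (P ℕ.+ 2) ℕ.* suc (suc (P ℕ.+ 2)))
      ratio≤ : ∀ n → P ℕ.+ 2 ℕ.≤ n →
               fromℕ (P ℕ.^ n) * 1/ (n !) {{ℕₚ._!≢0 n}} ≤ fromℕ K * 1/ (suc n ℕ.* suc (suc n))
      ratio≤ n N≤n = frac-mono-≤ (P ℕ.^ n) (n !) K (suc n ℕ.* suc (suc n)) {{ℕₚ._!≢0 n}} (factorial-bound P n N≤n)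
      small : ∀ n → P ℕ.+ 2 ℕ.≤ n →
              Bounded (fromℕ K * 1/ (suc n ℕ.* suc (suc n))) (1/ (n !) {{ℕₚ._!≢0 n}} * x n)
      small n N≤n = bounded-mono (≤-respˡ (*-comm _ _) (ratio≤ n N≤n))
        (bounded-* (0≤⇒bounded (1/-nonneg (n !) {{ℕₚ._!≢0 n}})) (bnd n))

    common-bound : ∀ x y → ∃[ N ] Bounded (fromℕ N) x × Bounded (fromℕ N) y
    common-bound x y = common (bound x) (bound y)
      where
      common : ∃[ m ] Bounded (fromℕ m) x → ∃[ n ] Bounded (fromℕ n) y → ∃[ N ] Bounded (fromℕ N) x × Bounded (fromℕ N) y
      common (m , bx) (n , by) = m ℕ.⊔ n
        , bounded-mono (fromℕ-mono-≤ {m} {m ℕ.⊔ n} (ℕₚ.m≤m⊔n m n)) bx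
        , bounded-mono (fromℕ-mono-≤ {n} {m ℕ.⊔ n} (ℕₚ.m≤n⊔m m n)) by

    exp-Cauchy′ : ∀ z M → Bounded (fromℕ M) (re z) × Bounded (fromℕ M) (im z) →
                  Cauchy (partialSum λ n → re (expTerm z n)) × Cauchy (partialSum λ n → im (expTerm z n))
    exp-Cauchy′ z M (bre , bim) =
        exp-part-Cauchy (M ℕ.+ M) (λ n → re (z ^ᶜ n)) (λ n → proj₁ (power-bound z M bre bim n))
      , exp-part-Cauchy (M ℕ.+ M) (λ n → im (z ^ᶜ n)) (λ n → proj₂ (power-bound z M bre bim n))

  abstract
    exp-Cauchy : ∀ z → Cauchy (partialSum λ n → re (expTerm z n)) × Cauchy (partialSum λ n → im (expTerm z n))
    exp-Cauchy z = exp-Cauchy′ z (proj₁ (common-bound (re z) (im z))) (proj₂ (common-bound (re z) (im z)))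

  -- exp z = Σ_{n≥0} zⁿ / n!
  exp : ℂ → ℂ
  exp z = lim _ (proj₁ (exp-Cauchy z)) +i lim _ (proj₂ (exp-Cauchy z))

  -- Convergence in the maximum norm on ℝ².
  Nearᶜ : Carrier → ℂ → ℂ → Set ℓ₂
  Nearᶜ ε w z = Near ε (re w) (re z) × Near ε (im w) (im z)

  sumOver : ∀ {i} {I : Set i} → (I → ℂ) → List I → ℂ
  sumOver f = List.foldr (λ x s → f x +ᶜ s) 0ᶜ

  -- Σ_{x ∈ P} f x = s, as the limit along the finite subsets of P, so no order of
  -- summation is chosen; in ℂ this is absolute convergence.
  HasSum : ∀ {i p} {I : Set i} → Pred I p → (I → ℂ) → ℂ → Set (c ⊔ ℓ₂ ⊔ i ⊔ p)
  HasSum {I = I} P f s = ∀ ε → 0# < ε →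
    Σ[ F ∈ List I ] All P F × Unique F ×
      (∀ F′ → All P F′ → Unique F′ → F ⊆ F′ → Nearᶜ ε (sumOver f F′) s)

-- A group of permutations of Fin n, listed without repetition.
record PermutationGroup (n : ℕ) : Set where
  field
    elements : List (Permutation′ n)
    distinct : AllPairs (λ g h → ¬ g Perm.≈ h) elements

  infix 4 _∈G
  _∈G : Permutation′ n → Set
  g ∈G = Any (g Perm.≈_) elements

  field
    id∈ : Perm.id ∈G
    ∘∈  : ∀ {g h} → g ∈G → h ∈G → g ∘ₚ h ∈G
    ⁻¹∈ : ∀ {g} → g ∈G → Perm.flip g ∈G

  order : ℕ
  order = length elements

  instance
    order≢0 : NonZero order
    order≢0 = nonEmpty {elements} {Perm.id} id∈
      where
      nonEmpty : ∀ {xs : List (Permutation′ n)} {g} → Any (g Perm.≈_) xs → NonZero (length xs)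
      nonEmpty (here _)  = _
      nonEmpty (there _) = _

infix 4 _≤ᴳ_
_≤ᴳ_ : ∀ {n} → PermutationGroup n → PermutationGroup n → Set
H ≤ᴳ G = ∀ g → PermutationGroup._∈G H g → PermutationGroup._∈G G g

-- An enumeration O₁, …, O_t of the orbits of H. With permutations acting on the right,
-- i·h is h ⟨$⟩ʳ i, and g ∘ₚ h first applies g.
record Orbits {n} (H : PermutationGroup n) : Set where
  open PermutationGroup H
  field
    t       : ℕ
    orbitOf : Fin n → Fin t
    same    : ∀ i j → orbitOf i ≡ orbitOf j ⇔ (∃[ h ] h ∈G × h ⟨$⟩ʳ i ≡ j)
    rep     : Fin t → Fin n
    rep∈    : ∀ i → orbitOf (rep i) ≡ i

  orbit : Fin t → Subset n
  orbit i = tabulate λ j → does (orbitOf j Finₚ.≟ i)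

  size : Fin t → ℕ
  size i = ∣ orbit i ∣

  instance
    size≢0 : ∀ {i} → NonZero (size i)
    size≢0 {i} = nonZero (orbit i) (rep i) (Vecₚ.lookup⇒[]= (rep i) (orbit i)
      (≡.trans (Vecₚ.lookup∘tabulate _ (rep i)) (dec-true (orbitOf (rep i) Finₚ.≟ i) (rep∈ i))))
      where
      nonZero : ∀ {m} (S : Subset m) j → j Subset.∈ S → NonZero ∣ S ∣
      nonZero (true ∷ S)  _           _               = _
      nonZero (false ∷ S) (Fin.suc j) (Vec.there j∈S) = nonZero S j j∈S

-- R₀ = ℤ/k for k ≥ 2, represented by residues; 𝔽_p is the case k = p prime.
module Code (k : ℕ) .{{k≥2 : NonTrivial k}} where

  private instance
    k≢0 : NonZero k
    k≢0 = ℕ.nonTrivial⇒nonZero k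

  R₀ : Set
  R₀ = Fin k

  infixl 6 _⊕_
  infixl 7 _⊗_
  _⊕_ _⊗_ : R₀ → R₀ → R₀
  a ⊕ b = (toℕ a ℕ.+ toℕ b) mod k
  a ⊗ b = (toℕ a ℕ.* toℕ b) mod k

  0ᴿ 1ᴿ : R₀
  0ᴿ = 0 mod k
  1ᴿ = 1 mod k

  -- m · 1
  fromℕᴿ : ℕ → R₀
  fromℕᴿ m = m mod k

  -- b ≡ a (mod k)
  Residue : R₀ → Pred ℤ 0ℓ
  Residue a b = + k ℤ∣.∣ b ℤ.- + toℕ a

  V : ℕ → Set
  V n = Vec R₀ n

  allV : ∀ n → List (V n)
  allV zero    = [] List.∷ List.[]
  allV (suc n) = List.cartesianProductWith _∷_ (List.allFin k) (allV n)

  module _ {n : ℕ} where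

    infixl 6 _⊕ᵛ_
    infixr 7 _⊗ᵛ_
    infixl 8 _◃_

    _⊕ᵛ_ : V n → V n → V n
    _⊕ᵛ_ = Vec.zipWith _⊕_

    _⊗ᵛ_ : R₀ → V n → V n
    r ⊗ᵛ v = Vec.map (r ⊗_) v

    0ᵛ : V n
    0ᵛ = Vec.replicate n 0ᴿ

    -- (v g)_i = v_{i g⁻¹}
    _◃_ : V n → Permutation′ n → V n
    v ◃ g = tabulate λ i → lookup v (g ⟨$⟩ˡ i)

    -- V n is finite, so a decidable subset is classically an arbitrary one.
    record GCode (G : PermutationGroup n) : Set₁ where
      field
        _∈C    : Pred (V n) 0ℓ
        _∈C?   : Decidable _∈C
        0∈     : 0ᵛ ∈C
        ⊕∈     : ∀ {u v} → u ∈C → v ∈C → (u ⊕ᵛ v) ∈C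
        ⊗∈     : ∀ r {v} → v ∈C → (r ⊗ᵛ v) ∈C
        act∈   : ∀ {g v} → PermutationGroup._∈G G g → v ∈C → (v ◃ g) ∈C

    module _ (H : PermutationGroup n) where
      open PermutationGroup H

      -- v θ_H, where r is the inverse of |H| in R₀
      θ : R₀ → V n → V n
      θ r v = r ⊗ᵛ List.foldr (λ h s → v ◃ h ⊕ᵛ s) 0ᵛ elements

      -- C θ_H, listed without repetition
      imageθ : {G : PermutationGroup n} → R₀ → GCode G → List (V n)
      imageθ r C = List.deduplicate (Vecₚ.≡-dec Finₚ._≟_) (List.map (θ r) (List.filter _∈C? (allV n)))
        where open GCode C

    module _ {H : PermutationGroup n} (O : Orbits H) where
      open Orbits O

      -- u = Σ u_i 1_{O_i} means that u_i is the value of u on O_i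
      coord : V n → Fin t → R₀
      coord u i = lookup u (rep i)

      -- n^H_{a,S}(u)
      count : R₀ → Subset t → V n → ℕ
      count a S u = ∣ S ∩ tabulate (λ i → does (coord u i Finₚ.≟ a)) ∣

      -- the value of CJ^H_{X,T} at x, y in a semiring
      CJ : ∀ {c ℓ} (A : RawSemiring c ℓ) → List (V n) → Subset t →
           (x y : R₀ → RawSemiring.Carrier A) → RawSemiring.Carrier A
      CJ A X T x y = List.foldr (λ u s → monomial u + s) 0# X
        where
        open RawSemiring A using (_+_; _*_; 0#)
        open RawSemiringDefinitions A using (_^_; product)
        monomial : V n → RawSemiring.Carrier A
        monomial u = product λ a → x a ^ count a T u * y a ^ count a (∁ T) u

module Theta (ℝ : RealField c ℓ₁ ℓ₂) where

  open RealFacts ℝ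
  open RealConstants ℝ using (π; √; √-square)
  open Complex ℝ
  open SumDefinitions (Semiring.+-rawMonoid semiring) using (sum)

  Γ : ℕ → Set c
  Γ n = Vector Carrier n

  infix 4 _≈ᵛ_
  _≈ᵛ_ : ∀ {n} → Rel (Γ n) ℓ₁
  u ≈ᵛ v = ∀ i → u i ≈ v i

  -- Σ_j a_j v_j
  combination : ∀ {n r} → (Fin r → Carrier) → (Fin r → Γ n) → Γ n
  combination a v i = sum λ j → a j * v j i

  private
    sum-zero : ∀ {m} {f : Fin m → Carrier} → (∀ j → f j ≈ 0#) → sum f ≈ 0#
    sum-zero {zero}  _   = refl
    sum-zero {suc m} f≈0 = trans (+-cong (f≈0 Fin.zero) (sum-zero λ j → f≈0 (Fin.suc j))) (+-identityˡ 0#)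

    sum-single : ∀ {m} {f : Fin m → Carrier} i → (∀ j → ¬ j ≡ i → f j ≈ 0#) → sum f ≈ f i
    sum-single Fin.zero    f≈0 = trans (+-congˡ (sum-zero λ j → f≈0 (Fin.suc j) λ ())) (+-identityʳ _)
    sum-single (Fin.suc i) f≈0 = trans (+-cong (f≈0 Fin.zero λ ())
      (sum-single i λ j j≢i → f≈0 (Fin.suc j) λ eq → j≢i (Finₚ.suc-injective eq))) (+-identityˡ _)

  module _ {n : ℕ} (H : PermutationGroup n) where
    open PermutationGroup H

    θᴿ : Γ n → Γ n
    θᴿ v i = 1/ order * List.foldr (λ h s → v (h ⟨$⟩ˡ i) + s) 0# elements

    InΓθ : Pred (Γ n) (c ⊔ ℓ₁)
    InΓθ u = ∃[ v ] u ≈ᵛ θᴿ v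

    -- The ℤ-span of an ℝ-basis of ℝⁿθ_H.
    record Lattice : Set (c ⊔ ℓ₁) where
      field
        rank        : ℕ
        basis       : Fin rank → Γ n
        basis∈      : ∀ j → InΓθ (basis j)
        independent : ∀ a → combination a basis ≈ᵛ (λ _ → 0#) → ∀ j → a j ≈ 0#
        spanning    : ∀ u → InΓθ u → ∃[ a ] u ≈ᵛ combination a basis

      -- independent makes this injective, so summing over D is summing over ℤ^rank
      point : Vec ℤ rank → Γ n
      point b = combination (fromℤ ∘ lookup b) basis

      infix 4 _∈D
      _∈D : Pred (Γ n) ℓ₁
      y ∈D = ∃[ b ] y ≈ᵛ point b

  module _ {n : ℕ} {H : PermutationGroup n} (O : Orbits H) where
    open Orbits O

    -- Ō_i has entries 1/√m_i = √m_i/m_i on O_i and 0 elsewhere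
    Ō : Fin t → Γ n
    Ō i j = if does (orbitOf j Finₚ.≟ i) then √ (size i) * 1/ (size i) else 0#

    -- the coefficients in u = Σ_i u_i Ō_i, by coordᴿ-unique
    coordᴿ : Γ n → Fin t → Carrier
    coordᴿ u i = √ (size i) * u (rep i)

    coordᴿ-unique : ∀ u a → u ≈ᵛ combination a Ō → ∀ i → a i ≈ coordᴿ u i
    coordᴿ-unique u a u≈ i = sym (begin
      √ (size i) * u (rep i)                            ≈⟨ *-congˡ (u≈ (rep i)) ⟩
      √ (size i) * (sum λ j → a j * Ō j (rep i))        ≈⟨ *-congˡ (sum-single i (λ j j≢i → trans (*-congˡ (off-orbit j j≢i)) (zeroʳ _))) ⟩
      √ (size i) * (a i * Ō i (rep i))                  ≈⟨ *-congˡ (*-congˡ on-orbit) ⟩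
      √ (size i) * (a i * (√ (size i) * 1/ (size i)))   ≈⟨ regroup (√ (size i)) (a i) (1/ (size i)) ⟩
      a i * (1/ (size i) * (√ (size i) * √ (size i)))   ≈⟨ *-congˡ (*-congˡ (√-square (size i))) ⟩
      a i * (1/ (size i) * fromℕ (size i))              ≈⟨ *-congˡ (1/-inverse (size i)) ⟩
      a i * 1#                                          ≈⟨ *-identityʳ (a i) ⟩
      a i                                               ∎)
      where
      open import Relation.Binary.Reasoning.Setoid setoid
      regroup : ∀ s x r → s * (x * (s * r)) ≈ x * (r * (s * s))
      regroup = solve 3 (λ s x r → s :* (x :* (s :* r)) := x :* (r :* (s :* s))) refl
        where open Solver
      on-orbit : Ō i (rep i) ≈ √ (size i) * 1/ (size i)
      on-orbit = reflexive (≡.cong (if_then √ (size i) * 1/ (size i) else 0#)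
        (dec-true (orbitOf (rep i) Finₚ.≟ i) (rep∈ i)))
      off-orbit : ∀ j → ¬ j ≡ i → Ō j (rep i) ≈ 0#
      off-orbit j j≢i = reflexive (≡.cong (if_then √ (size j) * 1/ (size j) else 0#)
        (dec-false (orbitOf (rep i) Finₚ.≟ j) λ p → j≢i (≡.trans (≡.sym p) (rep∈ i))))

    ⟨_,_⟩ : Γ n → Γ n → Carrier
    ⟨ u , v ⟩ = sum λ i → coordᴿ u i * coordᴿ v i

    -- s = ϑ^H_{D,y}(τ,z). The three Is…Value relations assert that the series converges, with sum s.
    IsThetaValue : Lattice H → Γ n → (τ z s : ℂ) → Set (c ⊔ ℓ₂)
    IsThetaValue D y τ z s = HasSum U term s
      where
      open Lattice D
      term : Vec ℤ rank → ℂ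
      term b = exp (ofReal π *ᶜ 𝕚 *ᶜ τ *ᶜ ofReal ⟨ point b , point b ⟩
                    +ᶜ ofReal (fromℕ 2 * π) *ᶜ 𝕚 *ᶜ z *ᶜ ofReal ⟨ point b , y ⟩)

  module _ (k : ℕ) .{{k≥2 : NonTrivial k}} where
    open Code k

    private instance
      k≢0 : NonZero k
      k≢0 = ℕ.nonTrivial⇒nonZero k

    IsPsiValue : R₀ → (τ s : ℂ) → Set (c ⊔ ℓ₂)
    IsPsiValue a τ = HasSum (Residue a) λ b →
      exp (ofReal (1/ k * π) *ᶜ 𝕚 *ᶜ τ *ᶜ ofReal (fromℤ (b ℤ.* b)))

    IsPhiValue : R₀ → (τ z s : ℂ) → Set (c ⊔ ℓ₂)
    IsPhiValue a τ z = HasSum (Residue a) λ b →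
      exp (ofReal (1/ k * π) *ᶜ 𝕚 *ᶜ τ *ᶜ ofReal (fromℤ (b ℤ.* b))
           +ᶜ ofReal (fromℕ 2 * π) *ᶜ 𝕚 *ᶜ z *ᶜ ofReal (fromℤ b))

{-# OPTIONS --safe #-}

-- Let L ⊆ ℤᵗ consist of the w whose residues modulo k are the orbit coordinates of a word of
-- C θ_H. It is a subgroup containing kℤᵗ, so it has a ℤ-basis, and D = { Σ (wᵢ/√k) Ōᵢ : w ∈ L }
-- is a lattice. For y = Σ_{i ∉ T} √k Ōᵢ ∈ D and x given by w one has ⟨x,x⟩ = Σ wᵢ²/k and
-- ⟨x,y⟩ = Σ_{i ∉ T} wᵢ, so each term of ϑ_{D,y} is a product over the orbits of terms of ψ (i ∈ T)
-- or φ (i ∉ T). Summing over each residue class separately gives the complete Jacobi polynomial.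
-- All sums converge absolutely because ∣ exp z ∣ = exp (Re z) and exp (- c b² - d b) = O(1/b²).
module Submission where

open import Level using (Level; 0ℓ; _⊔_)
open import Algebra.Bundles using (CommutativeMonoid; CommutativeRing; CommutativeSemiring)
import Algebra.Definitions.RawSemiring as RawSemiringDefinitions
import Algebra.Properties.Semiring.Mult as SemiringMult
open import Data.Bool.Base using (Bool; true; false; if_then_else_)
open import Data.Empty using (⊥-elim)
open import Data.Fin.Base as Fin using (Fin; zero; suc; toℕ)
open import Data.Fin.Permutation as Perm using (Permutation′; _⟨$⟩ʳ_; _⟨$⟩ˡ_; _∘ₚ_)
import Data.Fin.Properties as Finₚ
open import Data.Fin.Subset using (Subset; ∣_∣; _∩_; ∁)
open import Data.Integer.Base as ℤ using (ℤ; -[1+_])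
import Data.Integer.DivMod as ℤ/
import Data.Integer.Divisibility as ℤ∣
import Data.Integer.Divisibility.Signed as ℤ∣ₛ
import Data.Integer.Properties as ℤₚ
open import Data.Integer.Tactic.RingSolver using () renaming (solve-∀ to ℤ-solve-∀)
open import Data.List.Base as List using (List; []; _∷_; _++_; downFrom; upTo)
open import Data.List.Membership.Propositional using (_∈_; find; lose)
open import Data.List.Membership.Propositional.Properties
open import Data.List.Relation.Binary.Permutation.Propositional as Permutation
  using (_↭_; ↭-sym; ↭-trans; prep)
open import Data.List.Relation.Binary.Permutation.Propositional.Properties
  using (shift; ∈-resp-↭; ++-identityʳ)
open import Data.List.Relation.Binary.Permutation.Setoid.Properties using (Unique-resp-↭)
open import Data.List.Relation.Binary.Subset.Propositional using (_⊆_)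
open import Data.List.Relation.Unary.All as All using (All; []; _∷_)
import Data.List.Relation.Unary.All.Properties as Allₚ
open import Data.List.Relation.Unary.AllPairs using (AllPairs; []; _∷_)
open import Data.List.Relation.Unary.Any as Any using (here; there)
open import Data.List.Relation.Unary.Unique.Propositional using (Unique)
import Data.List.Relation.Unary.Unique.Propositional.Properties as Uniqueₚ
import Data.List.Relation.Unary.Unique.DecPropositional.Properties as DecUnique
open import Data.Nat.Base as ℕ using (ℕ; zero; suc; NonZero; NonTrivial; _!)
import Data.Nat.DivMod as ℕ/
import Data.Nat.Divisibility as ℕ∣
open import Data.Nat.Induction using (<-rec)
import Data.Nat.Properties as ℕₚ
open import Data.Product.Base using (Σ-syntax; ∃-syntax; _×_; _,_; proj₁; proj₂; map₁)
open import Data.Product.Properties using (,-injectiveˡ; ,-injectiveʳ)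
open import Data.Sum.Base using (_⊎_; inj₁; inj₂)
open import Data.Vec.Base as Vec using (Vec; []; _∷_; lookup; tabulate)
import Data.Vec.Properties as Vecₚ
open import Function.Base using (_∘_)
open import Function.Bundles using (Equivalence)
open import Relation.Binary.PropositionalEquality as ≡ using (_≡_)
open import Relation.Nullary using (¬_; Dec; yes; no; does)
open import Relation.Nullary.Decidable using (map′; _×-dec_)
open import Relation.Unary using (Pred; Decidable; U)
open import Defs

-- The order on the reals is undecidable, so no real or complex absolute value is formed: estimates
-- are two-sided bounds or compare squares of moduli. Since `HasSum` is a limit along all finite
-- subsets, every infinite sum passes through one criterion, `Dominated`: if a nonnegative majorant
-- has Cauchy sums along an exhaustion of the index set, then the limit along one convenient
-- sequence of finite lists is already the limit along all finite sets. It is applied on ℕ × ℕ for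
-- exp (w + z), on residue classes of ℤ for ψ and φ, and on L.
--
-- The basis of L is built as a bijection β from ℤᵗ with an explicit inverse. The bijection
-- reindexes the theta series, which is summed over integer coefficient vectors. Independence and
-- spanning over ℝ need no determinant: γ = k β⁻¹ is defined on all integer vectors, and the
-- identities βγ = k and γβ = k carry over to real ones. The vector γ is also the reason why y lies
-- in D: the vector with entries k outside T and 0 on T belongs to L.

private
  variable
    c ℓ ℓ₁ ℓ₂ ℓᵃ ℓᵇ : Level
    A : Set ℓᵃ
    B : Set ℓᵇ

-- Finite sums over lists

∈-remove : ∀ {x y : A} ls {rs} → y ∈ ls ++ x ∷ rs → ¬ y ≡ x → y ∈ ls ++ rs
∈-remove []       (here eq) y≢x = ⊥-elim (y≢x eq)
∈-remove []       (there p) _   = p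
∈-remove (l ∷ ls) (here eq) _   = here eq
∈-remove (l ∷ ls) (there p) y≢x = there (∈-remove ls p y≢x)

-- Plays the part of a set difference. Equality on `A` need not be decidable, so each element of
-- `xs` is located in `ys` by its membership proof and cut out there.
complement : {xs ys : List A} → Unique xs → xs ⊆ ys → ∃[ zs ] ys ↭ xs ++ zs
complement {xs = []}     {ys} _             _     = ys , Permutation.refl
complement {xs = x ∷ xs} {ys} (x∉xs ∷ uniq) xs⊆ys
  with ls , rs , ≡.refl ← ∈-∃++ (xs⊆ys (here ≡.refl))
  with zs , perm ← complement {ys = ls ++ rs} uniq
         (λ p → ∈-remove ls (xs⊆ys (there p)) λ eq → All.lookup x∉xs p (≡.sym eq))
  = zs , ↭-trans (shift x ls rs) (prep x perm)

unique-↭ : {xs ys : List A} → xs ↭ ys → Unique xs → Unique ys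
unique-↭ {A = A} p = Unique-resp-↭ (≡.setoid A) (Permutation.↭⇒↭ₛ p)

unique-++⁻ : (xs : List A) {ys : List A} → Unique (xs ++ ys) →
             Unique ys × (∀ {z} → z ∈ xs → ¬ z ∈ ys)
unique-++⁻ []       uniq         = uniq , λ ()
unique-++⁻ (x ∷ xs) (x∉ ∷ uniq) = proj₁ rec , λ
    { (here ≡.refl) q → All.lookup x∉ (∈-++⁺ʳ xs q) ≡.refl
    ; (there p)     q → proj₂ rec p q }
  where rec = unique-++⁻ xs uniq

-- A leftover element of `ys` would also lie in `xs` and hence occur twice in `ys`.
⊆-antisym-↭ : {xs ys : List A} → Unique xs → Unique ys → xs ⊆ ys → ys ⊆ xs → ys ↭ xs
⊆-antisym-↭ {xs = xs} ux uy xs⊆ys ys⊆xs with complement ux xs⊆ys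
... | []     , p = ↭-trans p (++-identityʳ xs)
... | z ∷ zs , p = ⊥-elim (proj₂ (unique-++⁻ xs (unique-↭ p uy))
                     (ys⊆xs (∈-resp-↭ (↭-sym p) (∈-++⁺ʳ xs (here ≡.refl)))) (here ≡.refl))

module ListSum (M : CommutativeMonoid c ℓ) where
  open CommutativeMonoid M
  open import Algebra.Properties.CommutativeSemigroup commutativeSemigroup using (x∙yz≈y∙xz; interchange)

  ∑ : (A → Carrier) → List A → Carrier
  ∑ f = List.foldr (λ x s → f x ∙ s) ε

  ∑-cong-∈ : {f g : A → Carrier} (xs : List A) → (∀ {x} → x ∈ xs → f x ≈ g x) → ∑ f xs ≈ ∑ g xs
  ∑-cong-∈ []       _  = refl
  ∑-cong-∈ (x ∷ xs) eq = ∙-cong (eq (here ≡.refl)) (∑-cong-∈ xs (eq ∘ there))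

  ∑-cong : {f g : A → Carrier} (xs : List A) → (∀ x → f x ≈ g x) → ∑ f xs ≈ ∑ g xs
  ∑-cong xs eq = ∑-cong-∈ xs λ {x} _ → eq x

  ∑-++ : (f : A → Carrier) (xs : List A) {ys : List A} → ∑ f (xs ++ ys) ≈ ∑ f xs ∙ ∑ f ys
  ∑-++ f []       = sym (identityˡ _)
  ∑-++ f (x ∷ xs) = trans (∙-congˡ (∑-++ f xs)) (sym (assoc _ _ _))

  ∑-↭ : (f : A → Carrier) {xs ys : List A} → xs ↭ ys → ∑ f xs ≈ ∑ f ys
  ∑-↭ f Permutation.refl        = refl
  ∑-↭ f (prep x p)              = ∙-congˡ (∑-↭ f p)
  ∑-↭ f (Permutation.swap x y p)  = trans (x∙yz≈y∙xz _ _ _) (∙-congˡ (∙-congˡ (∑-↭ f p)))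
  ∑-↭ f (Permutation.trans p q) = trans (∑-↭ f p) (∑-↭ f q)

  ∑-map : (f : B → Carrier) (g : A → B) (xs : List A) → ∑ f (List.map g xs) ≡ ∑ (f ∘ g) xs
  ∑-map f g []       = ≡.refl
  ∑-map f g (x ∷ xs) = ≡.cong (f (g x) ∙_) (∑-map f g xs)

  ∑-concatMap : (f : B → Carrier) (g : A → List B) (xs : List A) →
                ∑ f (List.concatMap g xs) ≈ ∑ (λ x → ∑ f (g x)) xs
  ∑-concatMap f g []       = refl
  ∑-concatMap f g (x ∷ xs) = trans (∑-++ f (g x)) (∙-congˡ (∑-concatMap f g xs))

  ∑-∙ : (f g : A → Carrier) (xs : List A) → ∑ (λ x → f x ∙ g x) xs ≈ ∑ f xs ∙ ∑ g xs
  ∑-∙ f g []       = sym (identityˡ ε)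
  ∑-∙ f g (x ∷ xs) = trans (∙-congˡ (∑-∙ f g xs)) (interchange _ _ _ _)

-- Boxes and distributivity

box : ∀ {n} → (Fin n → List A) → List (Vec A n)
box {n = zero}  ls = [] ∷ []
box {n = suc n} ls = List.cartesianProductWith _∷_ (ls zero) (box (ls ∘ suc))

∈-box⁺ : ∀ {n} {ls : Fin n → List A} (v : Vec A n) → (∀ i → lookup v i ∈ ls i) → v ∈ box ls
∈-box⁺ []      _ = here ≡.refl
∈-box⁺ (x ∷ v) p = ∈-cartesianProductWith⁺ _∷_ (p zero) (∈-box⁺ v (p ∘ suc))

∈-box⁻ : ∀ {n} {ls : Fin n → List A} {v : Vec A n} → v ∈ box ls → ∀ i → lookup v i ∈ ls i
∈-box⁻ {n = suc n} {ls} p i with ∈-cartesianProductWith⁻ _∷_ (ls zero) (box (ls ∘ suc)) p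
∈-box⁻ {n = suc n} {ls} p zero    | x , v , x∈ , v∈ , ≡.refl = x∈
∈-box⁻ {n = suc n} {ls} p (suc i) | x , v , x∈ , v∈ , ≡.refl = ∈-box⁻ v∈ i

box-unique : ∀ {n} {ls : Fin n → List A} → (∀ i → Unique (ls i)) → Unique (box ls)
box-unique {n = zero}  _ = [] ∷ []
box-unique {n = suc n} u =
  Uniqueₚ.cartesianProductWith⁺ _∷_ Vecₚ.∷-injective (u zero) (box-unique (u ∘ suc))

module Distributivity (R : CommutativeSemiring c ℓ) where
  open CommutativeSemiring R hiding (zero)
  open ListSum +-commutativeMonoid public
  open import Relation.Binary.Reasoning.Setoid setoid
  open import Algebra.Properties.CommutativeSemigroup *-commutativeSemigroup using (interchange)

  ∏ : ∀ {n} → (Fin n → Carrier) → Carrier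
  ∏ {zero}  f = 1#
  ∏ {suc n} f = f zero * ∏ (f ∘ suc)

  ∏-cong : ∀ {n} {f g : Fin n → Carrier} → (∀ i → f i ≈ g i) → ∏ f ≈ ∏ g
  ∏-cong {zero}  eq = refl
  ∏-cong {suc n} eq = *-cong (eq zero) (∏-cong (eq ∘ suc))

  ∏-* : ∀ {n} (f g : Fin n → Carrier) → ∏ (λ i → f i * g i) ≈ ∏ f * ∏ g
  ∏-* {zero}  f g = sym (*-identityˡ 1#)
  ∏-* {suc n} f g = trans (*-congˡ (∏-* (f ∘ suc) (g ∘ suc))) (interchange _ _ _ _)

  *-distribˡ-∑ : (x : Carrier) (f : A → Carrier) (xs : List A) → x * ∑ f xs ≈ ∑ (λ y → x * f y) xs
  *-distribˡ-∑ x f []       = zeroʳ x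
  *-distribˡ-∑ x f (y ∷ ys) = trans (distribˡ _ _ _) (+-congˡ (*-distribˡ-∑ x f ys))

  ∑-cartesianProductWith : {C : Set ℓᵃ} (h : A → B → C) (k : C → Carrier) (f : A → Carrier) (g : B → Carrier) →
    (∀ x y → k (h x y) ≈ f x * g y) → ∀ xs ys → ∑ k (List.cartesianProductWith h xs ys) ≈ ∑ f xs * ∑ g ys
  ∑-cartesianProductWith h k f g eq []       ys = sym (zeroˡ _)
  ∑-cartesianProductWith h k f g eq (x ∷ xs) ys = begin
    ∑ k (List.map (h x) ys ++ rest)               ≈⟨ ∑-++ k (List.map (h x) ys) ⟩
    ∑ k (List.map (h x) ys) + ∑ k rest            ≡⟨ ≡.cong (_+ ∑ k rest) (∑-map k (h x) ys) ⟩
    ∑ (k ∘ h x) ys + ∑ k rest                     ≈⟨ +-cong (∑-cong ys (eq x)) (∑-cartesianProductWith h k f g eq xs ys) ⟩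
    ∑ (λ y → f x * g y) ys + ∑ f xs * ∑ g ys      ≈⟨ +-congʳ (*-distribˡ-∑ (f x) g ys) ⟨
    f x * ∑ g ys + ∑ f xs * ∑ g ys                ≈⟨ distribʳ _ _ _ ⟨
    (f x + ∑ f xs) * ∑ g ys                       ∎
    where rest = List.cartesianProductWith h xs ys

  -- The expansion of a product of finite sums. It is applied over ℂ to the terms of a residue class
  -- of ℤᵗ and over ℝ to their majorants.
  ∑-box : ∀ {n} (f : Fin n → A → Carrier) (ls : Fin n → List A) →
          ∑ (λ v → ∏ λ i → f i (lookup v i)) (box ls) ≈ ∏ λ i → ∑ (f i) (ls i)
  ∑-box {n = zero}  f ls = +-identityʳ 1#
  ∑-box {n = suc n} f ls = begin
    ∑ (λ v → ∏ λ i → f i (lookup v i)) (box ls)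
      ≈⟨ ∑-cartesianProductWith _∷_ _ (f zero) (λ v → ∏ λ i → f (suc i) (lookup v i)) (λ _ _ → refl) (ls zero) (box (ls ∘ suc)) ⟩
    ∑ (f zero) (ls zero) * ∑ (λ v → ∏ λ i → f (suc i) (lookup v i)) (box (ls ∘ suc))
      ≈⟨ *-congˡ (∑-box (f ∘ suc) (ls ∘ suc)) ⟩
    ∑ (f zero) (ls zero) * ∏ (λ i → ∑ (f (suc i)) (ls (suc i))) ∎

-- Limits and unconditional sums

module Limits (ℝ : RealField c ℓ₁ ℓ₂) where
  open RealFacts ℝ
  open Distributivity (CommutativeRing.commutativeSemiring commutativeRing) public
    using () renaming (∑ to ∑ʳ; ∏ to ∏ʳ)

  half : Carrier → Carrier
  half ε = 1/ 2 * ε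

  half-pos : ∀ {ε} → 0# < ε → 0# < half ε
  half-pos = *-pos (1/-pos 2)

  half+half : ∀ ε → half ε + half ε ≈ ε
  half+half ε = trans (trans (+-cong (sym (*-identityˡ _)) (sym (*-identityˡ _))) (regroup 1# (1/ 2) ε))
    (trans (*-congʳ (trans (*-congˡ (+-congˡ (sym (+-identityʳ 1#)))) (1/-inverse 2))) (*-identityˡ ε))
    where
    open Solver
    regroup : ∀ u h ε → u * (h * ε) + u * (h * ε) ≈ (h * (u + u)) * ε
    regroup = solve 3 (λ u h ε → u :* (h :* ε) :+ u :* (h :* ε) := (h :* (u :+ u)) :* ε) refl

  +-mono-< : ∀ {x y u v} → x < y → u < v → x + u < y + v
  +-mono-< {y = y} {u} x<y u<v = <-trans (+-monoˡ-< u x<y) (+-monoʳ-< y u<v)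

  near-resp : ∀ {ε ε′ x x′ y y′} → ε ≈ ε′ → x ≈ x′ → y ≈ y′ → Near ε x y → Near ε′ x′ y′
  near-resp eqε eqx eqy (p , q) =
      <-respʳ eqε (<-respˡ (+-cong eqx (-‿cong eqy)) p)
    , <-respʳ eqε (<-respˡ (+-cong eqy (-‿cong eqx)) q)

  near-+ : ∀ {δ ε x x′ y y′} → Near δ x x′ → Near ε y y′ → Near (δ + ε) (x + y) (x′ + y′)
  near-+ (p , q) (p′ , q′) = <-respˡ (regroup _ _ _ _) (+-mono-< p p′) , <-respˡ (regroup _ _ _ _) (+-mono-< q q′)
    where
    open Solver
    regroup : ∀ x x′ y y′ → (x - x′) + (y - y′) ≈ (x + y) - (x′ + y′)
    regroup = solve 4 (λ x x′ y y′ → (x :- x′) :+ (y :- y′) := (x :+ y) :- (x′ :+ y′)) refl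

  near-trans : ∀ {δ ε x y z} → Near δ x y → Near ε y z → Near (δ + ε) x z
  near-trans {x = x} {y} {z} (p , q) (p′ , q′) =
      <-respˡ (telescope x y z) (+-mono-< p p′)
    , <-respˡ (trans (+-comm _ _) (telescope z y x)) (+-mono-< q q′)
    where
    open Solver
    telescope : ∀ x y z → (x - y) + (y - z) ≈ x - z
    telescope = solve 3 (λ x y z → (x :- y) :+ (y :- z) := x :- z) refl

  near-refl : ∀ {ε x} → 0# < ε → Near ε x x
  near-refl 0<ε = <-respˡ (sym (-‿inverseʳ _)) 0<ε , <-respˡ (sym (-‿inverseʳ _)) 0<ε

  near⇒bounded : ∀ {ε x y} → Near ε x y → Bounded ε (x - y)
  near⇒bounded {x = x} {y} (p , q) = ≤-respʳ (neg-sub y x) (neg-mono-≤ (<⇒≤ q)) , <⇒≤ p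
    where
    open Solver
    neg-sub : ∀ y x → - (y - x) ≈ x - y
    neg-sub = solve 2 (λ y x → :- (y :- x) := x :- y) refl

  natural-bound : ∀ x → ∃[ N ] Bounded (fromℕ N) x
  natural-bound x = let (m , x<m) = archimedean x ; (n , -x<n) = archimedean (- x) in
    m ℕ.⊔ n
    , ≤-respʳ (-‿involutive x) (neg-mono-≤ (≤-trans (<⇒≤ -x<n) (fromℕ-mono-≤ (ℕₚ.m≤n⊔m m n))))
    , ≤-trans (<⇒≤ x<m) (fromℕ-mono-≤ (ℕₚ.m≤m⊔n m n))

  ⟶-unique : ∀ {s l m} → s ⟶ l → s ⟶ m → l ≈ m
  ⟶-unique {s} s⟶l s⟶m = ≤-antisym (le s⟶m s⟶l) (le s⟶l s⟶m)
    where
    le : ∀ {l m} → s ⟶ l → s ⟶ m → m ≤ l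
    -- If both limits were within half of the gap m - l at a common index, the gap would be smaller
    -- than itself.
    le {l} {m} s⟶l s⟶m l<m = <-irrefl refl (<-respʳ (half+half _) (proj₂ (near-trans {x = l} {s n} {m}
        (near-sym (near₁ n (ℕₚ.m≤m⊔n N₁ N₂))) (near₂ n (ℕₚ.m≤n⊔m N₁ N₂)))))
      where
      ε = m - l
      lim₁ = s⟶l (half ε) (half-pos (<⇒0< l<m))
      lim₂ = s⟶m (half ε) (half-pos (<⇒0< l<m))
      N₁ = proj₁ lim₁
      N₂ = proj₁ lim₂
      near₁ = proj₂ lim₁
      near₂ = proj₂ lim₂
      n = N₁ ℕ.⊔ N₂

  ⟶-cong : ∀ {s t l m} → (∀ n → s n ≈ t n) → l ≈ m → s ⟶ l → t ⟶ m
  ⟶-cong eq l≈m s⟶l ε 0<ε = let (N , near) = s⟶l ε 0<ε in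
    N , λ n N≤n → near-resp refl (eq n) l≈m (near n N≤n)

  ⟶-const : ∀ x → (λ _ → x) ⟶ x
  ⟶-const x ε 0<ε = 0 , λ _ _ → near-refl 0<ε

  ⟶-+ : ∀ {s t l m} → s ⟶ l → t ⟶ m → (λ n → s n + t n) ⟶ (l + m)
  ⟶-+ s⟶l t⟶m ε 0<ε =
    let (N₁ , near₁) = s⟶l (half ε) (half-pos 0<ε) ; (N₂ , near₂) = t⟶m (half ε) (half-pos 0<ε) in
    N₁ ℕ.⊔ N₂ , λ n le → near-resp (half+half ε) refl refl
      (near-+ (near₁ n (ℕₚ.≤-trans (ℕₚ.m≤m⊔n N₁ N₂) le)) (near₂ n (ℕₚ.≤-trans (ℕₚ.m≤n⊔m N₁ N₂) le)))

  ⟶-neg : ∀ {s l} → s ⟶ l → (λ n → - s n) ⟶ (- l)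
  ⟶-neg s⟶l ε 0<ε = let (N , near) = s⟶l ε 0<ε in
    N , λ n N≤n → <-respˡ (flip _ _) (proj₂ (near n N≤n)) , <-respˡ (flip _ _) (proj₁ (near n N≤n))
    where
    open Solver
    flip : ∀ x y → x - y ≈ - y - - x
    flip = solve 2 (λ x y → x :- y := (:- y) :- (:- x)) refl

  1/1≤1 : ∀ n → 1/ (suc n) ≤ 1#
  1/1≤1 n = *-cancelˡ-≤ (fromℕ (suc n)) (fromℕ-pos (suc n)) (≤-respˡ (sym (1/-inverse (suc n)))
              (≤-respʳ (sym (*-identityˡ _)) (≤-respˡ (+-identityʳ 1#) (fromℕ-mono-≤ (ℕ.s≤s (ℕ.z≤n {n}))))))

  ⟶-* : ∀ {s t l m} → s ⟶ l → t ⟶ m → (λ n → s n * t n) ⟶ (l * m)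
  ⟶-* {s} {t} {l} {m} s⟶l t⟶m ε 0<ε = N₁ ℕ.⊔ N₂ , λ n le →
    bounded⇒near small (bounded-mono r-bound (bounded-resp (expand (s n) (t n) l m)
      (bounded-+ (bounded-+ (bounded-* (d₁ n le) (d₂ n le)) (bounded-* bl (d₂ n le))) (bounded-* (d₁ n le) bm))))
    where
    L = proj₁ (natural-bound l)
    M = proj₁ (natural-bound m)
    bl = proj₂ (natural-bound l)
    bm = proj₂ (natural-bound m)
    -- The error splits as (s - l)(t - m) + l (t - m) + (s - l) m. The successor in `suc (L + M)`
    -- pays for the first product, where r * r ≤ r.
    rate = rate-small (suc (L ℕ.+ M)) ε 0<ε
    r = 1/ (suc (proj₁ rate))
    small = proj₂ rate (proj₁ rate) ℕₚ.≤-refl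
    0<r = 1/-pos (suc (proj₁ rate))
    N₁ = proj₁ (s⟶l r 0<r)
    N₂ = proj₁ (t⟶m r 0<r)
    d₁ : ∀ n → N₁ ℕ.⊔ N₂ ℕ.≤ n → Bounded r (s n - l)
    d₁ n le = near⇒bounded (proj₂ (s⟶l r 0<r) n (ℕₚ.≤-trans (ℕₚ.m≤m⊔n N₁ N₂) le))
    d₂ : ∀ n → N₁ ℕ.⊔ N₂ ℕ.≤ n → Bounded r (t n - m)
    d₂ n le = near⇒bounded (proj₂ (t⟶m r 0<r) n (ℕₚ.≤-trans (ℕₚ.m≤n⊔m N₁ N₂) le))
    open Solver
    expand : ∀ x y l m → ((x - l) * (y - m) + l * (y - m)) + (x - l) * m ≈ x * y - l * m
    expand = solve 4 (λ x y l m → ((x :- l) :* (y :- m) :+ l :* (y :- m)) :+ (x :- l) :* m := x :* y :- l :* m) refl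
    collect : ∀ u r l m → (u * r + l * r) + r * m ≈ (u + (l + m)) * r
    collect = solve 4 (λ u r l m → (u :* r :+ l :* r) :+ r :* m := (u :+ (l :+ m)) :* r) refl
    r-bound : (r * r + fromℕ L * r) + r * fromℕ M ≤ fromℕ (suc (L ℕ.+ M)) * r
    r-bound = ≤-respʳ (trans (collect 1# r (fromℕ L) (fromℕ M)) (*-congʳ (+-congˡ (sym (fromℕ-+ L M)))))
      (+-mono-≤ (+-mono-≤ (*-monoˡ-≤ r (<⇒≤ 0<r) (1/1≤1 (proj₁ rate))) ≤-refl) ≤-refl)

  ⟶-∏ : ∀ {n} {s : Fin n → ℕ → Carrier} {l : Fin n → Carrier} → (∀ i → s i ⟶ l i) → (λ N → ∏ʳ λ i → s i N) ⟶ ∏ʳ l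
  ⟶-∏ {zero}  _   = ⟶-const 1#
  ⟶-∏ {suc n} lim = ⟶-* (lim zero) (⟶-∏ (lim ∘ suc))

  ⟶⇒Cauchy : ∀ {s l} → s ⟶ l → Cauchy s
  ⟶⇒Cauchy s⟶l ε 0<ε = let (N , near) = s⟶l (half ε) (half-pos 0<ε) in
    N , λ m n N≤m N≤n → near-resp (half+half ε) refl refl (near-trans (near m N≤m) (near-sym (near n N≤n)))

  ∑-nonneg : {g : A → Carrier} → (∀ x → 0# ≤ g x) → ∀ xs → 0# ≤ ∑ʳ g xs
  ∑-nonneg 0≤g []       = ≤-refl
  ∑-nonneg 0≤g (x ∷ xs) = ≤-respˡ (+-identityˡ 0#) (+-mono-≤ (0≤g x) (∑-nonneg 0≤g xs))

  ∑-mono-⊆ : {g : A → Carrier} → (∀ x → 0# ≤ g x) → ∀ {xs ys} → Unique xs → xs ⊆ ys → ∑ʳ g xs ≤ ∑ʳ g ys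
  ∑-mono-⊆ {g = g} 0≤g {xs} ux xs⊆ys with zs , p ← complement ux xs⊆ys =
    ≤-respˡ (+-identityʳ _) (≤-respʳ (trans (sym (∑-++ g xs)) (sym (∑-↭ g p)))
      (+-mono-≤ (≤-refl {∑ʳ g xs}) (∑-nonneg 0≤g zs)))
    where open Distributivity (CommutativeRing.commutativeSemiring commutativeRing) using (∑-++; ∑-↭)

module ComplexLimits (ℝ : RealField c ℓ₁ ℓ₂) where
  open RealFacts ℝ
  open Limits ℝ
  open Complex ℝ

  ℂ-commutativeSemiring : CommutativeSemiring c ℓ₁
  ℂ-commutativeSemiring = CommutativeRing.commutativeSemiring ℂ-commutativeRing

  open CommutativeRing ℂ-commutativeRing public using ()
    renaming (refl to reflᶜ; sym to symᶜ; trans to transᶜ; setoid to setoidᶜ; +-cong to +ᶜ-cong; *-cong to *ᶜ-cong; *-identityˡ to *ᶜ-identityˡ)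
  open Distributivity ℂ-commutativeSemiring using (∑; ∏; ∑-↭; ∑-++; ∑-cong; ∑-map)

  Boundedᶜ : Carrier → ℂ → Set ℓ₂
  Boundedᶜ B z = Bounded B (re z) × Bounded B (im z)

  infix 4 _⟶ᶜ_
  _⟶ᶜ_ : (ℕ → ℂ) → ℂ → Set (c ⊔ ℓ₂)
  s ⟶ᶜ l = ((λ n → re (s n)) ⟶ re l) × ((λ n → im (s n)) ⟶ im l)

  ⟶ᶜ-unique : ∀ {s l m} → s ⟶ᶜ l → s ⟶ᶜ m → l ≈ᶜ m
  ⟶ᶜ-unique (p , q) (p′ , q′) = ⟶-unique p p′ , ⟶-unique q q′

  ⟶ᶜ-cong : ∀ {s t l m} → (∀ n → s n ≈ᶜ t n) → l ≈ᶜ m → s ⟶ᶜ l → t ⟶ᶜ m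
  ⟶ᶜ-cong eq (eqr , eqi) (p , q) = ⟶-cong (λ n → proj₁ (eq n)) eqr p , ⟶-cong (λ n → proj₂ (eq n)) eqi q

  ⟶ᶜ-const : ∀ z → (λ _ → z) ⟶ᶜ z
  ⟶ᶜ-const z = ⟶-const (re z) , ⟶-const (im z)

  ⟶ᶜ-+ : ∀ {s t l m} → s ⟶ᶜ l → t ⟶ᶜ m → (λ n → s n +ᶜ t n) ⟶ᶜ (l +ᶜ m)
  ⟶ᶜ-+ (p , q) (p′ , q′) = ⟶-+ p p′ , ⟶-+ q q′

  ⟶ᶜ-* : ∀ {s t l m} → s ⟶ᶜ l → t ⟶ᶜ m → (λ n → s n *ᶜ t n) ⟶ᶜ (l *ᶜ m)
  ⟶ᶜ-* (p , q) (p′ , q′) = ⟶-+ (⟶-* p p′) (⟶-neg (⟶-* q q′)) , ⟶-+ (⟶-* p q′) (⟶-* q p′)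

  ⟶ᶜ-∑ : {s : A → ℕ → ℂ} {l : A → ℂ} → (∀ x → s x ⟶ᶜ l x) → ∀ xs → (λ N → ∑ (λ x → s x N) xs) ⟶ᶜ ∑ l xs
  ⟶ᶜ-∑ lim []       = ⟶ᶜ-const 0ᶜ
  ⟶ᶜ-∑ lim (x ∷ xs) = ⟶ᶜ-+ (lim x) (⟶ᶜ-∑ lim xs)

  ⟶ᶜ-∏ : ∀ {n} {s : Fin n → ℕ → ℂ} {l : Fin n → ℂ} → (∀ i → s i ⟶ᶜ l i) → (λ N → ∏ λ i → s i N) ⟶ᶜ ∏ l
  ⟶ᶜ-∏ {zero}  _   = ⟶ᶜ-const 1ᶜ
  ⟶ᶜ-∏ {suc n} lim = ⟶ᶜ-* (lim zero) (⟶ᶜ-∏ (lim ∘ suc))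

  module _ {i} {I : Set i} where

    Exhausts : ∀ {p} → Pred I p → (ℕ → List I) → Set _
    Exhausts P B = ∀ x → P x → ∃[ N ] ∀ M → N ℕ.≤ M → x ∈ B M

    exhausts-⊆ : ∀ {p} {P : Pred I p} {B} → Exhausts P B → ∀ xs → All P xs → ∃[ N ] ∀ M → N ℕ.≤ M → xs ⊆ B M
    exhausts-⊆ ex []       _          = 0 , λ _ _ ()
    exhausts-⊆ ex (x ∷ xs) (px ∷ pxs) =
      let (N₁ , in₁) = ex x px ; (N₂ , in₂) = exhausts-⊆ ex xs pxs in
      N₁ ℕ.⊔ N₂ , λ M le → λ
        { (here ≡.refl) → in₁ M (ℕₚ.≤-trans (ℕₚ.m≤m⊔n N₁ N₂) le)
        ; (there p)     → in₂ M (ℕₚ.≤-trans (ℕₚ.m≤n⊔m N₁ N₂) le) p }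

    HasSum-cong : ∀ {p} {P : Pred I p} {f g : I → ℂ} {s t : ℂ} →
                  (∀ x → f x ≈ᶜ g x) → s ≈ᶜ t → HasSum P f s → HasSum P g t
    HasSum-cong eq (eqr , eqi) hs ε 0<ε = let (F , pF , uF , near) = hs ε 0<ε in
      F , pF , uF , λ F′ pF′ uF′ F⊆F′ →
        near-resp refl (proj₁ (∑-cong F′ eq)) eqr (proj₁ (near F′ pF′ uF′ F⊆F′)) ,
        near-resp refl (proj₂ (∑-cong F′ eq)) eqi (proj₂ (near F′ pF′ uF′ F⊆F′))

    HasSum⇒⟶ᶜ : ∀ {p} {P : Pred I p} {f : I → ℂ} {s} B → (∀ N → Unique (B N)) → (∀ N → All P (B N)) → Exhausts P B →
                HasSum P f s → (λ N → ∑ f (B N)) ⟶ᶜ s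
    HasSum⇒⟶ᶜ {f = f} {s} B uB pB ex hs = (λ ε 0<ε → let (N , near) = go ε 0<ε in N , λ n le → proj₁ (near n le))
                                         , (λ ε 0<ε → let (N , near) = go ε 0<ε in N , λ n le → proj₂ (near n le))
      where
      go : ∀ ε → 0# < ε → ∃[ N ] ∀ n → N ℕ.≤ n → Nearᶜ ε (∑ f (B n)) s
      go ε 0<ε = let (F , pF , uF , near) = hs ε 0<ε ; (N , F⊆) = exhausts-⊆ ex F pF in
        N , λ n le → near (B n) (pB n) (uB n) (F⊆ n le)

    -- Sums over the exhausting lists D of the dominating g bound the sums of f over anything
    -- outside D N, so the net over finite sets and the sequence over B have the same limit.
    module Dominated {p} {P : Pred I p} (f : I → ℂ) (g : I → Carrier)
      (D : ℕ → List I) (uD : ∀ N → Unique (D N)) (exD : Exhausts U D)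
      (B : ℕ → List I) (uB : ∀ N → Unique (B N)) (pB : ∀ N → All P (B N))
      (D∩P⊆B : ∀ N {x} → x ∈ D N → P x → x ∈ B N)
      (0≤g : ∀ x → 0# ≤ g x) (f≤g : ∀ x → P x → Boundedᶜ (g x) (f x))
      (gCauchy : Cauchy (λ N → ∑ʳ g (D N)))
      where

      ∑-bounded : ∀ xs → All P xs → Boundedᶜ (∑ʳ g xs) (∑ f xs)
      ∑-bounded []       _          = (zero-bounded , zero-bounded)
        where
        zero-bounded : Bounded 0# 0#
        zero-bounded = ≤-respˡ (sym -0#≈0#) ≤-refl , ≤-refl
      ∑-bounded (x ∷ xs) (px ∷ pxs) =
          bounded-+ (proj₁ (f≤g x px)) (proj₁ (∑-bounded xs pxs))
        , bounded-+ (proj₂ (f≤g x px)) (proj₂ (∑-bounded xs pxs))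

      -- `R` together with `D N` fits into a later list of the exhaustion, so its sum is at most the
      -- difference of two late partial sums of the majorant.
      tail-small : ∀ ε → 0# < ε → ∃[ N ] ∀ R → Unique R → (∀ {x} → x ∈ R → ¬ x ∈ D N) → ∑ʳ g R < ε
      tail-small ε 0<ε = N , λ R uR disjoint →
        let (M , ⊆D) = exhausts-⊆ exD (D N ++ R) (All.universal (λ _ → _) _)
            M′ = M ℕ.⊔ N
            u : Unique (D N ++ R)
            u = Uniqueₚ.++⁺ (uD N) uR λ (p , q) → disjoint q p
        in ≤-<-trans (sub-≤ (≤-respˡ (∑-++ʳ g (D N)) (∑-mono-⊆ 0≤g u (⊆D M′ (ℕₚ.m≤m⊔n M N)))))
             (proj₁ (proj₂ (gCauchy ε 0<ε) M′ N (ℕₚ.m≤n⊔m M N) ℕₚ.≤-refl))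
        where
        N = proj₁ (gCauchy ε 0<ε)
        open Distributivity (CommutativeRing.commutativeSemiring commutativeRing) using () renaming (∑-++ to ∑-++ʳ)
        sub-≤ : ∀ {x y z} → x + y ≤ z → y ≤ z - x
        sub-≤ {x} {y} {z} le = ≤-respˡ (cancel x y) (+-monoˡ-≤ (- x) le)
          where
          open Solver
          cancel : ∀ x y → (x + y) - x ≈ y
          cancel = solve 2 (λ x y → (x :+ y) :- x := y) refl

      -- By `D∩P⊆B`, the members of `F` outside `B N` are also outside `D N`, so `tail-small` bounds
      -- their total contribution.
      extension-near : ∀ ε → 0# < ε → ∃[ N ] ∀ F → All P F → Unique F → B N ⊆ F →
                       Nearᶜ ε (∑ f F) (∑ f (B N))
      extension-near ε 0<ε = N , extend
        where
        N = proj₁ (tail-small ε 0<ε)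
        extend : ∀ F → All P F → Unique F → B N ⊆ F → Nearᶜ ε (∑ f F) (∑ f (B N))
        extend F pF uF B⊆F with R , perm ← complement (uB N) B⊆F =
            bounded⇒near small (bounded-resp (sym (proj₁ diff)) (proj₁ bnd))
          , bounded⇒near small (bounded-resp (sym (proj₂ diff)) (proj₂ bnd))
          where
          pR : All P R
          pR = Allₚ.++⁻ʳ (B N) (All.tabulate λ x∈ → All.lookup pF (∈-resp-↭ (↭-sym perm) x∈))
          uR = unique-++⁻ (B N) (unique-↭ perm uF)
          small : ∑ʳ g R < ε
          small = proj₂ (tail-small ε 0<ε) R (proj₁ uR) λ x∈R x∈D →
            proj₂ uR (D∩P⊆B N x∈D (All.lookup pR x∈R)) x∈R
          bnd = ∑-bounded R pR
          open Solver
          cancel : ∀ {s} x y → s ≈ x + y → s - x ≈ y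
          cancel x y eq = trans (+-congʳ eq) (solve 2 (λ x y → (x :+ y) :- x := y) refl x y)
          diff : (re (∑ f F) - re (∑ f (B N)) ≈ re (∑ f R)) × (im (∑ f F) - im (∑ f (B N)) ≈ im (∑ f R))
          diff = let (eqr , eqi) = transᶜ (∑-↭ f perm) (∑-++ f (B N)) in cancel _ _ eqr , cancel _ _ eqi

      exB : Exhausts P B
      exB x px = let (N , x∈D) = exD x _ in N , λ M le → D∩P⊆B M (x∈D M le) px

      convergent : ∃[ s ] (λ N → ∑ f (B N)) ⟶ᶜ s
      convergent = let (r , r-lim) = complete _ (λ ε 0<ε → let (N , near) = cauchy ε 0<ε in N , λ m n p q → proj₁ (near m n p q))
                       (i , i-lim) = complete _ (λ ε 0<ε → let (N , near) = cauchy ε 0<ε in N , λ m n p q → proj₂ (near m n p q))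
                   in (r +i i) , r-lim , i-lim
        where
        cauchy : ∀ ε → 0# < ε → ∃[ N ] ∀ m n → N ℕ.≤ m → N ℕ.≤ n → Nearᶜ ε (∑ f (B m)) (∑ f (B n))
        cauchy ε 0<ε =
          let (N , near) = extension-near (half ε) (half-pos 0<ε)
              (M , B⊆) = exhausts-⊆ exB (B N) (pB N)
              at = λ m le → near (B m) (pB m) (uB m) (B⊆ m le)
          in M , λ m n p q →
               near-resp (half+half ε) refl refl (near-trans (proj₁ (at m p)) (near-sym (proj₁ (at n q))))
             , near-resp (half+half ε) refl refl (near-trans (proj₂ (at m p)) (near-sym (proj₂ (at n q))))

      hasSum : ∀ {s} → (λ N → ∑ f (B N)) ⟶ᶜ s → HasSum P f s
      hasSum {s} (limr , limi) ε 0<ε =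
        B M , pB M , uB M , λ F pF uF B⊆F →
            near-resp (trans (+-congʳ (half+half _)) (half+half ε)) refl refl
              (near-trans (near-trans (proj₁ (near F pF uF (B⊆F ∘ BN⊆))) (near-sym (proj₁ (near (B M) (pB M) (uB M) BN⊆))))
                (proj₂ (limr δ (half-pos 0<ε)) M Mr≤))
          , near-resp (trans (+-congʳ (half+half _)) (half+half ε)) refl refl
              (near-trans (near-trans (proj₂ (near F pF uF (B⊆F ∘ BN⊆))) (near-sym (proj₂ (near (B M) (pB M) (uB M) BN⊆))))
                (proj₂ (limi δ (half-pos 0<ε)) M Mi≤))
        where
        -- The budget is ε/4 from `F` to `B N`, ε/4 from `B N` to `B M` and ε/2 from `B M` to the
        -- limit.
        δ = half ε
        ext = extension-near (half δ) (half-pos (half-pos 0<ε))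
        N = proj₁ ext
        near = proj₂ ext
        sub = exhausts-⊆ exB (B N) (pB N)
        Mr = proj₁ (limr δ (half-pos 0<ε))
        Mi = proj₁ (limi δ (half-pos 0<ε))
        M = proj₁ sub ℕ.⊔ (Mr ℕ.⊔ Mi)
        Mr≤ = ℕₚ.≤-trans (ℕₚ.m≤m⊔n Mr Mi) (ℕₚ.m≤n⊔m (proj₁ sub) _)
        Mi≤ = ℕₚ.≤-trans (ℕₚ.m≤n⊔m Mr Mi) (ℕₚ.m≤n⊔m (proj₁ sub) _)
        BN⊆ : B N ⊆ B M
        BN⊆ = proj₂ sub M (ℕₚ.m≤m⊔n (proj₁ sub) _)

      summable : ∃[ s ] ((λ N → ∑ f (B N)) ⟶ᶜ s) × HasSum P f s
      summable = proj₁ convergent , proj₂ convergent , hasSum {proj₁ convergent} (proj₂ convergent)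

  -- A finite set `F` that is good for the original sum is carried to `map α F`. Every finite set
  -- above that one is sent by `β` to a set containing `F`, because `β` undoes `α` on `P`.
  HasSum-reindex : ∀ {i j p} {I : Set i} {J : Set j} {P : Pred I p} {f : I → ℂ} {s}
    (β : J → I) (α : I → J) → (∀ y → P (β y)) → (∀ y → α (β y) ≡ y) → (∀ x → P x → β (α x) ≡ x) →
    HasSum P f s → HasSum U (f ∘ β) s
  HasSum-reindex {P = P} {f} {s} β α Pβ αβ βα hs ε 0<ε = let (F , pF , uF , near) = hs ε 0<ε in
    List.map α F , All.universal (λ _ → _) _ , unique-map F pF uF , λ F′ _ uF′ αF⊆F′ →
      let near′ = near (List.map β F′) (Allₚ.map⁺ (All.universal Pβ F′)) (Uniqueₚ.map⁺ β-injective uF′)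
                    λ {x} x∈F → ≡.subst (_∈ List.map β F′) (βα x (All.lookup pF x∈F)) (∈-map⁺ β (αF⊆F′ (∈-map⁺ α x∈F)))
      in ≡.subst (λ t → Nearᶜ ε t s) (∑-map f β F′) near′
    where
    β-injective : ∀ {x y} → β x ≡ β y → x ≡ y
    β-injective {x} {y} eq = ≡.trans (≡.sym (αβ x)) (≡.trans (≡.cong α eq) (αβ y))
    open import Data.List.Relation.Unary.AllPairs using ([]; _∷_)
    -- Off `P` the map `α` may identify elements, so its injectivity has to be drawn from membership
    -- in `P`.
    unique-map : ∀ F → All P F → Unique F → Unique (List.map α F)
    unique-map []      _          _         = []
    unique-map (x ∷ F) (px ∷ pF) (x∉ ∷ uF) =
      Allₚ.map⁺ (All.tabulate λ {y} y∈F eq → All.lookup x∉ y∈F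
        (≡.trans (≡.sym (βα x px)) (≡.trans (≡.cong β eq) (βα y (All.lookup pF y∈F)))))
      ∷ unique-map F pF uF

-- The exponential function

unique-concatMap : (f : A → List B) {xs : List A} → Unique xs → (∀ x → Unique (f x)) →
  (∀ {x x′ y} → x ∈ xs → x′ ∈ xs → y ∈ f x → y ∈ f x′ → x ≡ x′) → Unique (List.concatMap f xs)
unique-concatMap f {[]}     _           uf disjoint = []
unique-concatMap f {x ∷ xs} (x∉xs ∷ uxs) uf disjoint =
  Uniqueₚ.++⁺ (uf x) (unique-concatMap f uxs uf λ p q → disjoint (there p) (there q)) λ (p , q) → clash p (∈-concatMap⁻ f q)
  where
  clash : ∀ {y} → y ∈ f x → ¬ Any.Any (λ x′ → y ∈ f x′) xs
  clash p q with _ , x′∈ , y∈ ← find q = All.lookup x∉xs x′∈ (disjoint (here ≡.refl) (there x′∈) p y∈)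

-- Cauchy products of power series

antidiagonal : ℕ → List (ℕ × ℕ)
antidiagonal zero    = (0 , 0) ∷ []
antidiagonal (suc n) = (0 , suc n) ∷ List.map (map₁ suc) (antidiagonal n)

∈-antidiagonal⁺ : ∀ i j → (i , j) ∈ antidiagonal (i ℕ.+ j)
∈-antidiagonal⁺ zero    zero    = here ≡.refl
∈-antidiagonal⁺ zero    (suc j) = here ≡.refl
∈-antidiagonal⁺ (suc i) j       = there (∈-map⁺ (map₁ suc) (∈-antidiagonal⁺ i j))

∈-antidiagonal⁻ : ∀ n {i j} → (i , j) ∈ antidiagonal n → i ℕ.+ j ≡ n
∈-antidiagonal⁻ zero    (here ≡.refl) = ≡.refl
∈-antidiagonal⁻ (suc n) (here ≡.refl) = ≡.refl
∈-antidiagonal⁻ (suc n) (there p) with _ , q , ≡.refl ← ∈-map⁻ (map₁ suc) p = ≡.cong suc (∈-antidiagonal⁻ n q)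

antidiagonal-unique : ∀ n → Unique (antidiagonal n)
antidiagonal-unique zero    = [] ∷ []
antidiagonal-unique (suc n) =
    Allₚ.map⁺ (All.universal (λ _ ()) (antidiagonal n))
  ∷ Uniqueₚ.map⁺ (λ { {_ , _} {_ , _} ≡.refl → ≡.refl }) (antidiagonal-unique n)

module Convolution (R : CommutativeSemiring c ℓ) where
  open CommutativeSemiring R hiding (zero)
  open Distributivity R
  open SemiringMult semiring using (×-congʳ) renaming (_×_ to infixr 8 _·_)
  open import Algebra.Properties.CommutativeMonoid.Mult +-commutativeMonoid using (×-distrib-+)
  open import Relation.Binary.Reasoning.Setoid setoid
  open import Algebra.Properties.CommutativeSemigroup +-commutativeSemigroup using (interchange; x∙yz≈y∙xz)
  open import Algebra.Properties.CommutativeSemigroup *-commutativeSemigroup using () renaming (x∙yz≈y∙xz to *-exchange)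

  ·-* : ∀ n x y → (n · x) * y ≈ n · (x * y)
  ·-* zero    x y = zeroˡ y
  ·-* (suc n) x y = trans (distribʳ _ _ _) (+-congˡ (·-* n x y))

  *-· : ∀ n x y → x * (n · y) ≈ n · (x * y)
  *-· n x y = trans (*-comm _ _) (trans (·-* n y x) (×-congʳ n (*-comm _ _)))

  -- Coefficients of the product of the power series with coefficients `f` and `g`. The recursion
  -- shifts `f` only, by writing it as f 0 + x f′.
  conv : (f g : ℕ → Carrier) → ℕ → Carrier
  conv f g zero    = f 0 * g 0
  conv f g (suc n) = f 0 * g (suc n) + conv (f ∘ suc) g n

  -- Coefficients of the formal derivative.
  D : (ℕ → Carrier) → ℕ → Carrier
  D f n = suc n · f (suc n)

  conv-cong : ∀ {f f′ g g′ : ℕ → Carrier} → (∀ n → f n ≈ f′ n) → (∀ n → g n ≈ g′ n) → ∀ n → conv f g n ≈ conv f′ g′ n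
  conv-cong p q zero    = *-cong (p 0) (q 0)
  conv-cong p q (suc n) = +-cong (*-cong (p 0) (q (suc n))) (conv-cong (p ∘ suc) q n)

  conv-+ˡ : ∀ f f′ g n → conv (λ i → f i + f′ i) g n ≈ conv f g n + conv f′ g n
  conv-+ˡ f f′ g zero    = distribʳ _ _ _
  conv-+ˡ f f′ g (suc n) = trans (+-cong (distribʳ _ _ _) (conv-+ˡ (f ∘ suc) (f′ ∘ suc) g n)) (interchange _ _ _ _)

  conv-*ˡ : ∀ x f g n → conv (λ i → x * f i) g n ≈ x * conv f g n
  conv-*ˡ x f g zero    = *-assoc _ _ _
  conv-*ˡ x f g (suc n) = trans (+-cong (*-assoc _ _ _) (conv-*ˡ x (f ∘ suc) g n)) (sym (distribˡ _ _ _))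

  conv-*ʳ : ∀ x f g n → conv f (λ i → x * g i) n ≈ x * conv f g n
  conv-*ʳ x f g zero    = *-exchange (f 0) x (g 0)
  conv-*ʳ x f g (suc n) = trans (+-cong (*-exchange (f 0) x (g (suc n))) (conv-*ʳ x (f ∘ suc) g n)) (sym (distribˡ _ _ _))

  -- The product rule for formal power series. If f = f 0 + x f′, then the derivative of f g is f 0
  -- · D g + f′ g + x · D (f′ g), and the induction hypothesis applies to the last term.
  leibniz : ∀ f g n → D (conv f g) n ≈ conv (D f) g n + conv f (D g) n
  leibniz f g zero = begin
    1 · (f 0 * g 1 + f 1 * g 0)                ≈⟨ ×-distrib-+ _ _ 1 ⟩
    1 · (f 0 * g 1) + 1 · (f 1 * g 0)          ≈⟨ +-cong (*-· 1 _ _) (·-* 1 _ _) ⟨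
    f 0 * 1 · g 1 + 1 · f 1 * g 0              ≈⟨ +-comm _ _ ⟩
    1 · f 1 * g 0 + f 0 * 1 · g 1              ∎
  leibniz f g (suc n) = begin
    (2 ℕ.+ n) · (f 0 * g (2 ℕ.+ n) + conv f′ g (suc n))
      ≈⟨ ×-distrib-+ _ _ (2 ℕ.+ n) ⟩
    (2 ℕ.+ n) · (f 0 * g (2 ℕ.+ n)) + (conv f′ g (suc n) + suc n · conv f′ g (suc n))
      ≈⟨ +-cong (*-· (2 ℕ.+ n) _ _) refl ⟨
    f 0 * D g (suc n) + (conv f′ g (suc n) + suc n · conv f′ g (suc n))
      ≈⟨ +-congˡ (+-congˡ (leibniz f′ g n)) ⟩
    f 0 * D g (suc n) + ((f 1 * g (suc n) + conv (f′ ∘ suc) g n) + (conv (D f′) g n + conv f′ (D g) n))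
      ≈⟨ +-congˡ (trans (sym (+-assoc _ _ _)) (+-congʳ (+-assoc _ _ _))) ⟩
    f 0 * D g (suc n) + ((f 1 * g (suc n) + (conv (f′ ∘ suc) g n + conv (D f′) g n)) + conv f′ (D g) n)
      ≈⟨ +-congˡ (+-congʳ (+-cong (*-congʳ (+-identityʳ _)) (conv-+ˡ (f′ ∘ suc) (D f′) g n))) ⟨
    f 0 * D g (suc n) + (conv (D f) g (suc n) + conv f′ (D g) n)
      ≈⟨ x∙yz≈y∙xz _ _ _ ⟩
    conv (D f) g (suc n) + conv f (D g) (suc n) ∎
    where f′ = f ∘ suc

  ∑-antidiagonal : ∀ f g n → ∑ (λ (i , j) → f i * g j) (antidiagonal n) ≈ conv f g n
  ∑-antidiagonal f g zero    = +-identityʳ _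
  ∑-antidiagonal f g (suc n) = +-congˡ (trans (reflexive (∑-map _ (map₁ suc) (antidiagonal n))) (∑-antidiagonal (f ∘ suc) g n))

module Exponential (ℝ : RealField c ℓ₁ ℓ₂) where
  open RealFacts ℝ
  open Limits ℝ
  open Complex ℝ
  open ComplexLimits ℝ
  open Distributivity ℂ-commutativeSemiring
  open Convolution ℂ-commutativeSemiring
  private
    module ℝΣ = Distributivity (CommutativeRing.commutativeSemiring commutativeRing)
  open SemiringMult (CommutativeSemiring.semiring ℂ-commutativeSemiring) using () renaming (_×_ to infixr 8 _·ᶜ_)

  1/-unique : ∀ {x} n .{{_ : NonZero n}} → x * fromℕ n ≈ 1# → x ≈ 1/ n
  1/-unique {x} n eq = trans (sym (*-identityʳ x)) (trans (*-congˡ (sym (1/-inverse n)))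
    (trans (solve 3 (λ x r n → x :* (r :* n) := (x :* n) :* r) refl x (1/ n) (fromℕ n))
      (trans (*-congʳ eq) (*-identityˡ _))))
    where open Solver

  1/! : ℕ → Carrier
  1/! n = 1/ (n !) {{ℕₚ._!≢0 n}}

  1/!-suc : ∀ n → fromℕ (suc n) * 1/! (suc n) ≈ 1/! n
  1/!-suc n = 1/-unique (n !) {{ℕₚ._!≢0 n}} (trans (regroup (fromℕ (suc n)) (1/! (suc n)) (fromℕ (n !)))
    (trans (*-congˡ (sym (×1-homo-* (suc n) (n !)))) (1/-inverse (suc n !) {{ℕₚ._!≢0 (suc n)}})))
    where
    open Solver
    regroup : ∀ x r y → (x * r) * y ≈ r * (x * y)
    regroup = solve 3 (λ x r y → (x :* r) :* y := r :* (x :* y)) refl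

  ·ᶜ-re : ∀ n z → re (n ·ᶜ z) ≈ fromℕ n * re z
  ·ᶜ-re zero    z = sym (zeroˡ _)
  ·ᶜ-re (suc n) z = trans (+-cong (sym (*-identityˡ _)) (·ᶜ-re n z)) (sym (distribʳ _ _ _))

  ·ᶜ-im : ∀ n z → im (n ·ᶜ z) ≈ fromℕ n * im z
  ·ᶜ-im zero    z = sym (zeroˡ _)
  ·ᶜ-im (suc n) z = trans (+-cong (sym (*-identityˡ _)) (·ᶜ-im n z)) (sym (distribʳ _ _ _))

  fromℕ-cancel : ∀ n .{{_ : NonZero n}} {x y} → fromℕ n * x ≈ fromℕ n * y → x ≈ y
  fromℕ-cancel n {x} {y} eq = trans (sym (undo x)) (trans (*-congˡ eq) (undo y))
    where
    undo : ∀ x → 1/ n * (fromℕ n * x) ≈ x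
    undo x = trans (sym (*-assoc _ _ _)) (trans (*-congʳ (1/-inverse n)) (*-identityˡ x))

  ·ᶜ-cancel : ∀ n {w z} → suc n ·ᶜ w ≈ᶜ suc n ·ᶜ z → w ≈ᶜ z
  ·ᶜ-cancel n {w} {z} (eqr , eqi) =
      fromℕ-cancel (suc n) (trans (sym (·ᶜ-re (suc n) w)) (trans eqr (·ᶜ-re (suc n) z)))
    , fromℕ-cancel (suc n) (trans (sym (·ᶜ-im (suc n) w)) (trans eqi (·ᶜ-im (suc n) z)))

  -- The differential equation of x ↦ exp (z x), read off on coefficients.
  expTerm-suc : ∀ z n → D (expTerm z) n ≈ᶜ z *ᶜ expTerm z n
  expTerm-suc z n =
      trans (·ᶜ-re (suc n) (expTerm z (suc n))) (trans (sym (*-assoc _ _ _)) (trans (*-congʳ (1/!-suc n)) (regroup₋ _ _ _ _ _)))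
    , trans (·ᶜ-im (suc n) (expTerm z (suc n))) (trans (sym (*-assoc _ _ _)) (trans (*-congʳ (1/!-suc n)) (regroup₊ _ _ _ _ _)))
    where
    open Solver
    regroup₋ : ∀ r x y u v → r * (x * y - u * v) ≈ x * (r * y) - u * (r * v)
    regroup₋ = solve 5 (λ r x y u v → r :* (x :* y :- u :* v) := x :* (r :* y) :- u :* (r :* v)) refl
    regroup₊ : ∀ r x y u v → r * (x * y + u * v) ≈ x * (r * y) + u * (r * v)
    regroup₊ = solve 5 (λ r x y u v → r :* (x :* y :+ u :* v) := x :* (r :* y) :+ u :* (r :* v)) refl

  1/1 : 1/ 1 ≈ 1#
  1/1 = sym (1/-unique 1 (trans (*-identityˡ _) (+-identityʳ 1#)))

  expTerm-0 : ∀ z → expTerm z 0 ≈ᶜ 1ᶜ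
  expTerm-0 z = trans (*-identityʳ _) 1/1 , zeroʳ _

  -- Takes the place of the binomial theorem. By the product rule both sides solve the differential
  -- equation with factor w + z and have constant term 1; the factor n + 1 from the derivative can
  -- be cancelled, so the coefficients agree by induction.
  expTerm-+ : ∀ w z n → conv (expTerm w) (expTerm z) n ≈ᶜ expTerm (w +ᶜ z) n
  expTerm-+ w z zero    = transᶜ (*ᶜ-cong (expTerm-0 w) (expTerm-0 z)) (transᶜ (*ᶜ-identityˡ 1ᶜ) (symᶜ (expTerm-0 (w +ᶜ z))))
  expTerm-+ w z (suc n) = ·ᶜ-cancel n (begin
    D (conv (expTerm w) (expTerm z)) n
      ≈⟨ leibniz (expTerm w) (expTerm z) n ⟩
    conv (D (expTerm w)) (expTerm z) n +ᶜ conv (expTerm w) (D (expTerm z)) n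
      ≈⟨ +ᶜ-cong (conv-cong (expTerm-suc w) (λ _ → reflᶜ) n) (conv-cong (λ _ → reflᶜ) (expTerm-suc z) n) ⟩
    conv (λ i → w *ᶜ expTerm w i) (expTerm z) n +ᶜ conv (expTerm w) (λ i → z *ᶜ expTerm z i) n
      ≈⟨ +ᶜ-cong (conv-*ˡ w (expTerm w) (expTerm z) n) (conv-*ʳ z (expTerm w) (expTerm z) n) ⟩
    w *ᶜ conv (expTerm w) (expTerm z) n +ᶜ z *ᶜ conv (expTerm w) (expTerm z) n
      ≈⟨ CommutativeSemiring.distribʳ ℂ-commutativeSemiring (conv (expTerm w) (expTerm z) n) w z ⟨
    (w +ᶜ z) *ᶜ conv (expTerm w) (expTerm z) n
      ≈⟨ *ᶜ-cong reflᶜ (expTerm-+ w z n) ⟩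
    (w +ᶜ z) *ᶜ expTerm (w +ᶜ z) n
      ≈⟨ expTerm-suc (w +ᶜ z) n ⟨
    D (expTerm (w +ᶜ z)) n ∎)
    where open import Relation.Binary.Reasoning.Setoid setoidᶜ

  ∑-downFrom : ∀ (f : ℕ → Carrier) n → partialSum f n ≈ ∑ʳ f (downFrom n)
  ∑-downFrom f zero    = refl
  ∑-downFrom f (suc n) = trans (+-comm _ _) (+-congˡ (∑-downFrom f n))

  ∑-re : (f : A → ℂ) (xs : List A) → re (∑ f xs) ≡ ∑ʳ (re ∘ f) xs
  ∑-re f []       = ≡.refl
  ∑-re f (x ∷ xs) = ≡.cong (re (f x) +_) (∑-re f xs)

  ∑-im : (f : A → ℂ) (xs : List A) → im (∑ f xs) ≡ ∑ʳ (im ∘ f) xs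
  ∑-im f []       = ≡.refl
  ∑-im f (x ∷ xs) = ≡.cong (im (f x) +_) (∑-im f xs)

  exp-⟶ : ∀ z → (λ N → ∑ (expTerm z) (downFrom N)) ⟶ᶜ exp z
  exp-⟶ z =
      ⟶-cong (λ n → trans (∑-downFrom _ n) (reflexive (≡.sym (∑-re (expTerm z) (downFrom n))))) refl
        (proj₂ (complete _ (proj₁ (exp-Cauchy z))))
    , ⟶-cong (λ n → trans (∑-downFrom _ n) (reflexive (≡.sym (∑-im (expTerm z) (downFrom n))))) refl
        (proj₂ (complete _ (proj₂ (exp-Cauchy z))))

  ^ᶜ-cong : ∀ {w z} → w ≈ᶜ z → ∀ n → w ^ᶜ n ≈ᶜ z ^ᶜ n
  ^ᶜ-cong eq zero    = reflᶜ
  ^ᶜ-cong eq (suc n) = *ᶜ-cong eq (^ᶜ-cong eq n)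

  exp-cong : ∀ {w z} → w ≈ᶜ z → exp w ≈ᶜ exp z
  exp-cong {w} {z} eq = ⟶ᶜ-unique (exp-⟶ w) (⟶ᶜ-cong
    (λ n → ∑-cong (downFrom n) λ i → *-congˡ (proj₁ (symᶜ (^ᶜ-cong eq i))) , *-congˡ (proj₂ (symᶜ (^ᶜ-cong eq i)))) reflᶜ (exp-⟶ z))

  -- ∣ z ∣ ≤ B
  infix 4 _⊴_
  _⊴_ : ℂ → Carrier → Set ℓ₂
  z ⊴ B = (0# ≤ B) × (re z * re z + im z * im z ≤ B * B)

  *-mono-≤ : ∀ {x y u v} → 0# ≤ x → 0# ≤ v → x ≤ y → u ≤ v → x * u ≤ y * v
  *-mono-≤ {x} {y} {u} {v} 0≤x 0≤v x≤y u≤v =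
    ≤-trans (≤-respˡ (*-comm _ _) (≤-respʳ (*-comm _ _) (*-monoˡ-≤ x 0≤x u≤v))) (*-monoˡ-≤ v 0≤v x≤y)

  -- The sign of x cannot be decided. But if x * x < 0, then 0 < x is excluded, hence 0 ≤ - x, and
  -- the square of - x is nonnegative after all.
  square-nonneg : ∀ x → 0# ≤ x * x
  square-nonneg x xx<0 = *-nonneg 0≤-x 0≤-x (<-respˡ (neg-square x) xx<0)
    where
    neg-square : ∀ x → x * x ≈ - x * - x
    neg-square = solve 1 (λ x → x :* x := (:- x) :* (:- x)) refl
      where open Solver
    x≤0 : x ≤ 0#
    x≤0 0<x = <⇒≤ (*-pos 0<x 0<x) xx<0
    0≤-x : 0# ≤ - x
    0≤-x = ≤-respˡ -0#≈0# (neg-mono-≤ x≤0)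

  +-nonneg : ∀ {x y} → 0# ≤ x → 0# ≤ y → 0# ≤ x + y
  +-nonneg p q = ≤-respˡ (+-identityˡ 0#) (+-mono-≤ p q)

  ⊴-resp : ∀ {w z B C} → w ≈ᶜ z → B ≈ C → w ⊴ B → z ⊴ C
  ⊴-resp (eqr , eqi) eq (0≤B , le) = ≤-respʳ eq 0≤B ,
    ≤-respˡ (+-cong (*-cong eqr eqr) (*-cong eqi eqi)) (≤-respʳ (*-cong eq eq) le)

  ⊴-mono : ∀ {z B C} → B ≤ C → z ⊴ B → z ⊴ C
  ⊴-mono B≤C (0≤B , le) = 0≤C , ≤-trans le (*-mono-≤ 0≤B 0≤C B≤C B≤C)
    where 0≤C = ≤-trans 0≤B B≤C

  ⊴-* : ∀ {w z B C} → w ⊴ B → z ⊴ C → w *ᶜ z ⊴ B * C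
  ⊴-* {w} {z} {B} {C} (0≤B , le) (0≤C , le′) = *-nonneg 0≤B 0≤C ,
    ≤-respˡ (brahmagupta (re w) (im w) (re z) (im z)) (≤-respʳ (interchange B C)
      (*-mono-≤ (+-nonneg (square-nonneg _) (square-nonneg _)) (*-nonneg 0≤C 0≤C) le le′))
    where
    open Solver
    brahmagupta : ∀ a b x y → (a * a + b * b) * (x * x + y * y) ≈ (a * x - b * y) * (a * x - b * y) + (a * y + b * x) * (a * y + b * x)
    brahmagupta = solve 4 (λ a b x y → (a :* a :+ b :* b) :* (x :* x :+ y :* y)
      := (a :* x :- b :* y) :* (a :* x :- b :* y) :+ (a :* y :+ b :* x) :* (a :* y :+ b :* x)) refl
    interchange : ∀ B C → (B * B) * (C * C) ≈ (B * C) * (B * C)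
    interchange = solve 2 (λ B C → (B :* B) :* (C :* C) := (B :* C) :* (B :* C)) refl

  ⊴-ofReal : ∀ {x} → 0# ≤ x → ofReal x ⊴ x
  ⊴-ofReal {x} 0≤x = 0≤x , ≤-respˡ (trans (sym (+-identityʳ _)) (+-congˡ (sym (zeroˡ 0#)))) ≤-refl

  ⊴-∏ : ∀ {n} {z : Fin n → ℂ} {B : Fin n → Carrier} → (∀ i → z i ⊴ B i) → ∏ z ⊴ ∏ʳ B
  ⊴-∏ {zero}  _  = ⊴-ofReal (<⇒≤ 0<1)
  ⊴-∏ {suc n} le = ⊴-* (le Fin.zero) (⊴-∏ (le ∘ Fin.suc))

  square-≤⇒≤ : ∀ {x B} → 0# ≤ B → x * x ≤ B * B → x ≤ B
  square-≤⇒≤ {x} {B} 0≤B le B<x = le (<-≤-trans (0<⇒< pos) ≤-refl)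
    where
    0<x = ≤-<-trans 0≤B B<x
    pos : 0# < x * x - B * B
    pos = <-respʳ (solve 2 (λ x B → (x :- B) :* (x :+ B) := x :* x :- B :* B) refl x B)
      (*-pos (<⇒0< B<x) (<-≤-trans 0<x (≤-respˡ (+-identityʳ x) (+-mono-≤ (≤-refl {x}) 0≤B))))
      where open Solver

  square-≤⇒bounded : ∀ {x B} → 0# ≤ B → x * x ≤ B * B → Bounded B x
  square-≤⇒bounded {x} {B} 0≤B le =
      ≤-respʳ (-‿involutive x) (neg-mono-≤ (square-≤⇒≤ 0≤B (≤-respˡ (solve 1 (λ x → x :* x := (:- x) :* (:- x)) refl x) le)))
    , square-≤⇒≤ 0≤B le
    where open Solver

  ⊴⇒bounded : ∀ {z B} → z ⊴ B → Boundedᶜ B z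
  ⊴⇒bounded {z} {B} (0≤B , le) =
      square-≤⇒bounded 0≤B (≤-trans (≤-respˡ (+-identityʳ _) (+-mono-≤ (≤-refl {re z * re z}) (square-nonneg (im z)))) le)
    , square-≤⇒bounded 0≤B (≤-trans (≤-respˡ (+-identityˡ _) (+-mono-≤ (square-nonneg (re z)) (≤-refl {im z * im z}))) le)

  bounded⇒square-≤ : ∀ {x B} → Bounded B x → x * x ≤ B * B
  bounded⇒square-≤ bx = proj₂ (bounded-* bx bx)

  natural-⊴ : ∀ z → ∃[ M ] z ⊴ fromℕ M
  natural-⊴ z = M , fromℕ-nonneg M , ≤-trans (+-mono-≤ (bounded⇒square-≤ (proj₂ (natural-bound (re z)))) (bounded⇒square-≤ (proj₂ (natural-bound (im z)))))
      (≤-respʳ (*-cong (sym (fromℕ-+ P Q)) (sym (fromℕ-+ P Q))) (0≤⇒≤ (≤-respʳ (cross (fromℕ P) (fromℕ Q))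
        (+-nonneg (*-nonneg (fromℕ-nonneg P) (fromℕ-nonneg Q)) (*-nonneg (fromℕ-nonneg P) (fromℕ-nonneg Q))))))
    where
    P = proj₁ (natural-bound (re z))
    Q = proj₁ (natural-bound (im z))
    M = P ℕ.+ Q
    open Solver
    cross : ∀ p q → p * q + p * q ≈ (p + q) * (p + q) - (p * p + q * q)
    cross = solve 2 (λ p q → p :* q :+ p :* q := (p :+ q) :* (p :+ q) :- (p :* p :+ q :* q)) refl

  ofReal-^-im : ∀ x n → im (ofReal x ^ᶜ n) ≈ 0#
  ofReal-^-im x zero    = refl
  ofReal-^-im x (suc n) = trans (+-cong (trans (*-congˡ (ofReal-^-im x n)) (zeroʳ x)) (zeroˡ _)) (+-identityˡ 0#)

  ofReal-^-re : ∀ x n → re (ofReal x ^ᶜ suc n) ≈ x * re (ofReal x ^ᶜ n)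
  ofReal-^-re x n = trans (+-congˡ (trans (-‿cong (zeroˡ _)) -0#≈0#)) (+-identityʳ _)

  ^ᶜ-⊴ : ∀ {z x} → z ⊴ x → ∀ n → z ^ᶜ n ⊴ re (ofReal x ^ᶜ n)
  ^ᶜ-⊴ z⊴x zero    = ⊴-ofReal (<⇒≤ 0<1)
  ^ᶜ-⊴ {z} {x} z⊴x (suc n) = ⊴-resp reflᶜ (sym (ofReal-^-re x n)) (⊴-* z⊴x (^ᶜ-⊴ z⊴x n))

  expTerm-⊴ : ∀ {z x} → z ⊴ x → ∀ n → expTerm z n ⊴ re (expTerm (ofReal x) n)
  expTerm-⊴ {z} z⊴x n = ⊴-resp (scale (1/! n) (z ^ᶜ n)) refl
    (⊴-* (⊴-ofReal (1/-nonneg (n !) {{ℕₚ._!≢0 n}})) (^ᶜ-⊴ z⊴x n))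
    where
    scale : ∀ r z → ofReal r *ᶜ z ≈ᶜ r ∙ z
    scale r z = trans (+-congˡ (trans (-‿cong (zeroˡ _)) -0#≈0#)) (+-identityʳ _)
              , trans (+-congˡ (zeroˡ _)) (+-identityʳ _)

  -- Both sides are sums of the family wⁱ/i! · zʲ/j! over ℕ × ℕ: exhausted by squares it gives
  -- the product, exhausted by triangles and resummed along antidiagonals it gives exp (w + z).
  exp-+ : ∀ w z → exp (w +ᶜ z) ≈ᶜ exp w *ᶜ exp z
  exp-+ w z = ⟶ᶜ-unique
      (⟶ᶜ-cong (λ N → ∑-cong (downFrom N) λ n → symᶜ (transᶜ (∑-antidiagonal (expTerm w) (expTerm z) n) (expTerm-+ w z n))) reflᶜ (exp-⟶ (w +ᶜ z)))
      (⟶ᶜ-cong (λ N → ∑-concatMap family antidiagonal (downFrom N)) reflᶜ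
        (HasSum⇒⟶ᶜ triangle triangle-unique (λ N → All.universal (λ _ → _) _) triangle-exhausts family-sum))
    where
    -- A common bound for the moduli of w and z, so that one real exponential series majorises both
    -- factors.
    M = proj₁ (natural-⊴ w) ℕ.+ proj₁ (natural-⊴ z)
    w⊴M : w ⊴ fromℕ M
    w⊴M = ⊴-mono (fromℕ-mono-≤ {proj₁ (natural-⊴ w)} {M} (ℕₚ.m≤m+n _ _)) (proj₂ (natural-⊴ w))
    z⊴M : z ⊴ fromℕ M
    z⊴M = ⊴-mono (fromℕ-mono-≤ {proj₁ (natural-⊴ z)} {M} (ℕₚ.m≤n+m _ (proj₁ (natural-⊴ w)))) (proj₂ (natural-⊴ z))

    family : ℕ × ℕ → ℂ
    family (i , j) = expTerm w i *ᶜ expTerm z j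

    majorant : ℕ → Carrier
    majorant i = re (expTerm (ofReal (fromℕ M)) i)

    family⊴ : ∀ ij → family ij ⊴ majorant (proj₁ ij) * majorant (proj₂ ij)
    family⊴ (i , j) = ⊴-* (expTerm-⊴ w⊴M i) (expTerm-⊴ z⊴M j)

    square triangle : ℕ → List (ℕ × ℕ)
    square N   = List.cartesianProductWith _,_ (downFrom N) (downFrom N)
    triangle N = List.concatMap antidiagonal (downFrom N)

    square-unique : ∀ N → Unique (square N)
    square-unique N = Uniqueₚ.cartesianProductWith⁺ _,_ (λ eq → ,-injectiveˡ eq , ,-injectiveʳ eq)
      (Uniqueₚ.downFrom⁺ N) (Uniqueₚ.downFrom⁺ N)

    square-exhausts : Exhausts U square
    square-exhausts (i , j) _ = suc (i ℕ.⊔ j) , λ N lt → ∈-cartesianProductWith⁺ _,_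
      (∈-downFrom⁺ (ℕₚ.≤-trans (ℕ.s≤s (ℕₚ.m≤m⊔n i j)) lt)) (∈-downFrom⁺ (ℕₚ.≤-trans (ℕ.s≤s (ℕₚ.m≤n⊔m i j)) lt))

    triangle-unique : ∀ N → Unique (triangle N)
    triangle-unique N = unique-concatMap antidiagonal (Uniqueₚ.downFrom⁺ N) antidiagonal-unique
      λ {m} {n} _ _ p q → ≡.trans (≡.sym (∈-antidiagonal⁻ m p)) (∈-antidiagonal⁻ n q)

    triangle-exhausts : Exhausts U triangle
    triangle-exhausts (i , j) _ = suc (i ℕ.+ j) , λ N lt →
      ∈-concatMap⁺ antidiagonal (lose (∈-downFrom⁺ lt) (∈-antidiagonal⁺ i j))

    -- Over a square of indices the double sum is the square of a partial sum for exp M.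
    majorant-Cauchy : Cauchy (λ N → ∑ʳ (λ ij → majorant (proj₁ ij) * majorant (proj₂ ij)) (square N))
    majorant-Cauchy = ⟶⇒Cauchy (⟶-cong
      (λ N → sym (ℝΣ.∑-cartesianProductWith _,_ _ majorant majorant (λ _ _ → refl) (downFrom N) (downFrom N))) refl (⟶-* E-lim E-lim))
      where
      E-lim : (λ N → ∑ʳ majorant (downFrom N)) ⟶ re (exp (ofReal (fromℕ M)))
      E-lim = ⟶-cong (λ N → reflexive (∑-re (expTerm (ofReal (fromℕ M))) (downFrom N))) refl (proj₁ (exp-⟶ (ofReal (fromℕ M))))

    family-sum : HasSum U family (exp w *ᶜ exp z)
    family-sum = Dominated.hasSum family _ square square-unique square-exhausts
      square square-unique (λ N → All.universal (λ _ → _) _) (λ N p _ → p)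
      (λ ij → proj₁ (family⊴ ij)) (λ ij _ → ⊴⇒bounded (family⊴ ij)) majorant-Cauchy
      (⟶ᶜ-cong (λ N → symᶜ (∑-cartesianProductWith _,_ family (expTerm w) (expTerm z) (λ _ _ → reflᶜ) (downFrom N) (downFrom N)))
        reflᶜ (⟶ᶜ-* (exp-⟶ w) (exp-⟶ z)))

-- The integers from - N to N - 1. The range is asymmetric because the two constructors of ℤ are
-- paired at equal index; `level` is the stage at which an integer enters.
integersUpTo : ℕ → List ℤ
integersUpTo zero    = []
integersUpTo (suc n) = ℤ.+ n ∷ -[1+ n ] ∷ integersUpTo n

level : ℤ → ℕ
level (ℤ.+ n)  = n
level -[1+ n ] = n

∈-integersUpTo⁺ : ∀ {N} b → level b ℕ.< N → b ∈ integersUpTo N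
∈-integersUpTo⁺ {suc N} b (ℕ.s≤s le) = step b (ℕₚ.m≤n⇒m<n∨m≡n le)
  where
  step : ∀ b → level b ℕ.< N ⊎ level b ≡ N → b ∈ integersUpTo (suc N)
  step b         (inj₁ lt)     = there (there (∈-integersUpTo⁺ b lt))
  step (ℤ.+ n)   (inj₂ ≡.refl) = here ≡.refl
  step -[1+ n ]  (inj₂ ≡.refl) = there (here ≡.refl)

∈-integersUpTo⁻ : ∀ {N b} → b ∈ integersUpTo N → level b ℕ.< N
∈-integersUpTo⁻ {suc N} (here ≡.refl)         = ℕₚ.≤-refl
∈-integersUpTo⁻ {suc N} (there (here ≡.refl)) = ℕₚ.≤-refl
∈-integersUpTo⁻ {suc N} (there (there p))     = ℕₚ.m≤n⇒m≤1+n (∈-integersUpTo⁻ p)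

integersUpTo-unique : ∀ N → Unique (integersUpTo N)
integersUpTo-unique zero    = []
integersUpTo-unique (suc N) =
    ((λ ()) ∷ All.tabulate λ p → λ { ≡.refl → ℕₚ.<-irrefl ≡.refl (∈-integersUpTo⁻ p) })
  ∷ All.tabulate (λ p → λ { ≡.refl → ℕₚ.<-irrefl ≡.refl (∈-integersUpTo⁻ p) })
  ∷ integersUpTo-unique N

-- Decay of the exponential and Gaussian majorants

module ExponentialBounds (ℝ : RealField c ℓ₁ ℓ₂) where
  open RealFacts ℝ
  open Limits ℝ
  open Complex ℝ
  open ComplexLimits ℝ
  open Exponential ℝ
  open Distributivity ℂ-commutativeSemiring using (∑)

  -- The real exponential function, which serves to bound the modulus of `exp`.
  E : Carrier → Carrier
  E x = re (exp (ofReal x))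

  exp-ofReal-im : ∀ x → im (exp (ofReal x)) ≈ 0#
  exp-ofReal-im x = ⟶-unique (proj₂ (exp-⟶ (ofReal x)))
    (⟶-cong (λ N → sym (trans (reflexive (∑-im (expTerm (ofReal x)) (downFrom N))) (vanish (downFrom N)))) refl (⟶-const 0#))
    where
    vanish : ∀ ns → ∑ʳ (λ n → im (expTerm (ofReal x) n)) ns ≈ 0#
    vanish []       = refl
    vanish (n ∷ ns) = trans (+-cong (trans (*-congˡ (ofReal-^-im x n)) (zeroʳ _)) (vanish ns)) (+-identityˡ 0#)

  E-cong : ∀ {x y} → x ≈ y → E x ≈ E y
  E-cong eq = proj₁ (exp-cong (eq , refl))

  E-+ : ∀ x y → E (x + y) ≈ E x * E y
  E-+ x y = trans (proj₁ (exp-cong (refl , sym (+-identityˡ 0#)))) (trans (proj₁ (exp-+ (ofReal x) (ofReal y)))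
    (trans (+-congˡ (trans (-‿cong (trans (*-congʳ (exp-ofReal-im x)) (zeroˡ _))) -0#≈0#)) (+-identityʳ _)))

  -- For negative x the terms of the series change sign, so this comes from the functional equation:
  -- E x is the square of E (x/2).
  E-nonneg : ∀ x → 0# ≤ E x
  E-nonneg x = ≤-respʳ (trans (sym (E-+ (half x) (half x))) (E-cong (half+half x))) (square-nonneg _)

  term-≤-E : ∀ {y} → 0# ≤ y → ∀ n → re (expTerm (ofReal y) n) ≤ E y
  term-≤-E {y} 0≤y n = ≤-lim _ (proj₁ (exp-Cauchy (ofReal y))) _ (suc n) λ N n<N →
    ≤-respʳ (sym (∑-downFrom _ N)) (≤-respˡ (+-identityʳ _)
      (∑-mono-⊆ term-nonneg {n ∷ []} ([] ∷ []) (λ { (here ≡.refl) → ∈-downFrom⁺ n<N })))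
    where
    power-nonneg : ∀ n → 0# ≤ re (ofReal y ^ᶜ n)
    power-nonneg zero    = <⇒≤ 0<1
    power-nonneg (suc n) = ≤-respʳ (sym (ofReal-^-re y n)) (*-nonneg 0≤y (power-nonneg n))
    term-nonneg : ∀ n → 0# ≤ re (expTerm (ofReal y) n)
    term-nonneg n = *-nonneg (1/-nonneg (n !) {{ℕₚ._!≢0 n}}) (power-nonneg n)

  E-≥1 : ∀ {y} → 0# ≤ y → 1# ≤ E y
  E-≥1 {y} 0≤y = ≤-respˡ (proj₁ (expTerm-0 (ofReal y))) (term-≤-E 0≤y 0)

  E-≥½y² : ∀ {y} → 0# ≤ y → 1/ 2 * (y * y) ≤ E y
  E-≥½y² {y} 0≤y = ≤-respˡ (*-congˡ (trans (ofReal-^-re y 1) (*-congˡ (trans (ofReal-^-re y 0) (*-identityʳ y))))) (term-≤-E 0≤y 2)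

  E-0 : E 0# ≈ 1#
  E-0 = ≤-antisym (*-cancelˡ-≤ (E 0#) (<-≤-trans 0<1 (E-≥1 ≤-refl))
          (≤-respˡ (trans (E-cong (sym (+-identityˡ 0#))) (E-+ 0# 0#)) (≤-respʳ (sym (*-identityˡ _)) ≤-refl)))
        (E-≥1 ≤-refl)

  E-inverse : ∀ y → E (- y) * E y ≈ 1#
  E-inverse y = trans (sym (E-+ (- y) y)) (trans (E-cong (trans (+-comm _ _) (-‿inverseʳ y))) E-0)

  -- E (- y) is the inverse of E y, and the quadratic term of the series gives y²/2 ≤ E y. The bound
  -- uses (n + 1)(n + 2) instead of a square because that is the telescoping form which
  -- `series-Cauchy` sums.
  E-decay : ∀ n y → fromℕ (2 ℕ.+ n) ≤ y → E (- y) ≤ fromℕ 2 * 1/ (suc n ℕ.* suc (suc n))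
  E-decay n y n+2≤y = *-cancelˡ-≤ (1/ 2 * fromℕ P) (*-pos (1/-pos 2) (fromℕ-pos P))
    (≤-respˡ (*-comm _ _) (≤-respʳ (sym unit) (≤-respʳ (trans (*-comm _ _) (E-inverse y)) (*-monoˡ-≤ (E (- y)) (E-nonneg (- y)) half-P≤E))))
    where
    P = suc n ℕ.* suc (suc n)
    0≤y : 0# ≤ y
    0≤y = ≤-trans (fromℕ-nonneg (2 ℕ.+ n)) n+2≤y
    P≤y² : fromℕ P ≤ y * y
    P≤y² = ≤-trans (fromℕ-mono-≤ {P} {suc (suc n) ℕ.* suc (suc n)} (ℕₚ.*-monoˡ-≤ (suc (suc n)) (ℕₚ.n≤1+n (suc n))))
      (≤-respˡ (sym (×1-homo-* (suc (suc n)) (suc (suc n)))) (*-mono-≤ (fromℕ-nonneg (2 ℕ.+ n)) 0≤y n+2≤y n+2≤y))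
    half-P≤E : 1/ 2 * fromℕ P ≤ E y
    half-P≤E = ≤-trans (≤-respˡ (*-comm _ _) (≤-respʳ (*-comm _ _) (*-monoˡ-≤ (1/ 2) (1/-nonneg 2) P≤y²))) (E-≥½y² 0≤y)
    open Solver
    unit : (fromℕ 2 * 1/ P) * (1/ 2 * fromℕ P) ≈ 1#
    unit = trans (solve 4 (λ t r h p → (t :* r) :* (h :* p) := (h :* t) :* (r :* p)) refl (fromℕ 2) (1/ P) (1/ 2) (fromℕ P))
      (trans (*-cong (1/-inverse 2) (1/-inverse P)) (*-identityˡ 1#))

  conj : ℂ → ℂ
  conj z = re z +i (- im z)

  conj-^ : ∀ z n → conj z ^ᶜ n ≈ᶜ conj (z ^ᶜ n)
  conj-^ z zero    = refl , sym -0#≈0#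
  conj-^ z (suc n) = transᶜ (*ᶜ-cong reflᶜ (conj-^ z n)) (conj-re _ _ _ _ , conj-im _ _ _ _)
    where
    open Solver
    conj-re : ∀ a b x y → a * x - (- b) * (- y) ≈ a * x - b * y
    conj-re = solve 4 (λ a b x y → a :* x :- (:- b) :* (:- y) := a :* x :- b :* y) refl
    conj-im : ∀ a b x y → a * (- y) + (- b) * x ≈ - (a * y + b * x)
    conj-im = solve 4 (λ a b x y → a :* (:- y) :+ (:- b) :* x := :- (a :* y :+ b :* x)) refl

  ∑-conj : (f : A → ℂ) (xs : List A) → ∑ (conj ∘ f) xs ≈ᶜ conj (∑ f xs)
  ∑-conj f []       = refl , sym -0#≈0#
  ∑-conj f (x ∷ xs) = transᶜ (+ᶜ-cong reflᶜ (∑-conj f xs)) (refl , -‿+-comm _ _)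

  exp-conj : ∀ z → exp (conj z) ≈ᶜ conj (exp z)
  exp-conj z = ⟶ᶜ-unique (exp-⟶ (conj z)) (⟶ᶜ-cong
    (λ N → symᶜ (transᶜ (Distributivity.∑-cong ℂ-commutativeSemiring (downFrom N) λ n →
        *-congˡ (proj₁ (conj-^ z n)) , trans (*-congˡ (proj₂ (conj-^ z n))) (sym (-‿distribʳ-* _ _)))
      (∑-conj (expTerm z) (downFrom N)))) reflᶜ
    (proj₁ (exp-⟶ z) , ⟶-neg (proj₂ (exp-⟶ z))))

  -- ∣ exp z ∣² = exp z · exp z̄ = exp (2 Re z).
  exp-⊴ : ∀ z → exp z ⊴ E (re z)
  exp-⊴ z = E-nonneg (re z) , ≤-respʳ norm ≤-refl
    where
    open import Relation.Binary.Reasoning.Setoid setoid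
    flip : ∀ x y → x * x + y * y ≈ x * x - y * - y
    flip = solve 2 (λ x y → x :* x :+ y :* y := x :* x :- y :* (:- y)) refl
      where open Solver
    norm : re (exp z) * re (exp z) + im (exp z) * im (exp z) ≈ E (re z) * E (re z)
    norm = begin
      re (exp z) * re (exp z) + im (exp z) * im (exp z)   ≈⟨ flip _ _ ⟩
      re (exp z *ᶜ conj (exp z))                         ≈⟨ proj₁ (*ᶜ-cong reflᶜ (exp-conj z)) ⟨
      re (exp z *ᶜ exp (conj z))                         ≈⟨ proj₁ (exp-+ z (conj z)) ⟨
      re (exp (z +ᶜ conj z))                             ≈⟨ proj₁ (exp-cong (refl , -‿inverseʳ (im z))) ⟩
      E (re z + re z)                                    ≈⟨ E-+ (re z) (re z) ⟩
      E (re z) * E (re z)                                ∎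

  majorant : ℕ → ℤ → Carrier
  majorant K b = fromℕ K * 1/ (suc (level b) ℕ.* suc (suc (level b)))

  majorant-nonneg : ∀ K b → 0# ≤ majorant K b
  majorant-nonneg K b = *-nonneg (fromℕ-nonneg K) (1/-nonneg (suc (level b) ℕ.* suc (suc (level b))))

  majorant-mono : ∀ {K L} → K ℕ.≤ L → ∀ b → majorant K b ≤ majorant L b
  majorant-mono {K} {L} K≤L b = *-monoˡ-≤ _ (1/-nonneg (suc (level b) ℕ.* suc (suc (level b)))) (fromℕ-mono-≤ {K} {L} K≤L)

  majorant-convergent : ∀ K → ∃[ S ] (λ N → ∑ʳ (majorant K) (integersUpTo N)) ⟶ S
  majorant-convergent K = let (S , S-lim) = complete (partialSum f) f-Cauchy in S , ⟶-cong partial refl S-lim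
    where
    g = λ n → majorant K (ℤ.+ n)
    -- Each level contains two integers, whence the doubled constant.
    f = λ n → fromℕ (K ℕ.+ K) * 1/ (suc n ℕ.* suc (suc n))
    f-Cauchy : Cauchy (partialSum f)
    f-Cauchy = series-Cauchy f (K ℕ.+ K) 0 λ n _ →
        ≤-trans (≤-respʳ -0#≈0# (neg-mono-≤ (f-nonneg n))) (f-nonneg n) , ≤-refl
      where
      f-nonneg : ∀ n → 0# ≤ f n
      f-nonneg n = *-nonneg (fromℕ-nonneg (K ℕ.+ K)) (1/-nonneg (suc n ℕ.* suc (suc n)))
    partial : ∀ N → partialSum f N ≈ ∑ʳ (majorant K) (integersUpTo N)
    partial zero    = refl
    partial (suc N) = trans (+-comm _ _) (trans (+-cong (trans (*-congʳ (fromℕ-+ K K)) (distribʳ _ _ _)) (partial N)) (+-assoc _ _ _))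

  fromℤ-square : ∀ b → fromℤ (b ℤ.* b) ≈ fromℕ ℤ.∣ b ∣ * fromℕ ℤ.∣ b ∣
  fromℤ-square b = trans (fromℤ-* b b) (square b)
    where
    open Solver
    square : ∀ b → fromℤ b * fromℤ b ≈ fromℕ ℤ.∣ b ∣ * fromℕ ℤ.∣ b ∣
    square (ℤ.+ n)  = refl
    square -[1+ n ] = solve 1 (λ x → (:- x) :* (:- x) := x :* x) refl (fromℕ (suc n))

  fromℤ-bounded : ∀ b → Bounded (fromℕ ℤ.∣ b ∣) (fromℤ b)
  fromℤ-bounded (ℤ.+ n)  = ≤-trans (≤-respʳ -0#≈0# (neg-mono-≤ (fromℕ-nonneg n))) (fromℕ-nonneg n) , ≤-refl
  fromℤ-bounded -[1+ n ] = bounded-neg (fromℤ-bounded (ℤ.+ suc n))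

  level≤∣∣ : ∀ b → level b ℕ.≤ ℤ.∣ b ∣
  level≤∣∣ (ℤ.+ n)  = ℕₚ.≤-refl
  level≤∣∣ -[1+ n ] = ℕₚ.n≤1+n n

  -- With ∣ d ∣ ≤ D and P such that D + 1 ≤ c P, one has c n² + (D + 1) P ≥ (D + 1) n for every n,
  -- so c b² + d b + m ≥ ∣ b ∣ + 2 for m = (D + 1) P + 2.
  gaussian-decay : ∀ c d → 0# < c → ∃[ K ] ∀ b → E (- (c * fromℤ (b ℤ.* b)) - d * fromℤ b) ≤ majorant K b
  -- `Q` bounds the factor E m that the shift of the exponent by m costs, and 2 is the constant of
  -- `E-decay`.
  gaussian-decay c d 0<c = Q ℕ.* 2 , bound
    where
    D = proj₁ (natural-bound d)
    rate = rate-small (suc D) c 0<c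
    P = suc (proj₁ rate)
    m = suc D ℕ.* P ℕ.+ 2
    Q = proj₁ (natural-bound (E (fromℕ m)))
    D+1≤cP : fromℕ (suc D) ≤ c * fromℕ P
    D+1≤cP = ≤-respˡ (trans (*-assoc _ _ _) (trans (*-congˡ (1/-inverse P)) (*-identityʳ _)))
      (*-monoˡ-≤ (fromℕ P) (fromℕ-nonneg P) (<⇒≤ (proj₂ rate (proj₁ rate) ℕₚ.≤-refl)))
    linear : ∀ n → fromℕ (suc D) * fromℕ n ≤ c * (fromℕ n * fromℕ n) + fromℕ (suc D ℕ.* P)
    linear n with ℕₚ.≤-total n P
    ... | inj₁ n≤P = ≤-respˡ (trans (+-identityˡ _) (×1-homo-* (suc D) n))
      (+-mono-≤ (*-nonneg (<⇒≤ 0<c) (square-nonneg (fromℕ n))) (fromℕ-mono-≤ {suc D ℕ.* n} {suc D ℕ.* P} (ℕₚ.*-monoʳ-≤ (suc D) n≤P)))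
    ... | inj₂ P≤n = ≤-respˡ (+-identityʳ _) (+-mono-≤
      (≤-trans (*-monoˡ-≤ (fromℕ n) (fromℕ-nonneg n) D+1≤cP) (≤-respˡ (regroup c (fromℕ P) (fromℕ n))
        (≤-respˡ (*-comm _ _) (≤-respʳ (*-comm _ _) (*-monoˡ-≤ c (<⇒≤ 0<c) (*-monoˡ-≤ (fromℕ n) (fromℕ-nonneg n) (fromℕ-mono-≤ {P} {n} P≤n)))))))
      (fromℕ-nonneg (suc D ℕ.* P)))
      where
      open Solver
      regroup : ∀ c p n → c * (p * n) ≈ (c * p) * n
      regroup = solve 3 (λ c p n → c :* (p :* n) := (c :* p) :* n) refl
    module _ (b : ℤ) where
      n = ℤ.∣ b ∣
      y = (c * fromℤ (b ℤ.* b) + d * fromℤ b) + fromℕ m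
      y≥n+2 : fromℕ (2 ℕ.+ n) ≤ y
      y≥n+2 = ≤-respˡ lower (≤-respʳ upper (+-mono-≤ (linear n)
        (+-mono-≤ (proj₁ (bounded-* (proj₂ (natural-bound d)) (fromℤ-bounded b))) (≤-refl {fromℕ 2}))))
        where
        open Solver
        lower : fromℕ (suc D) * fromℕ n + (- (fromℕ D * fromℕ n) + fromℕ 2) ≈ fromℕ (2 ℕ.+ n)
        lower = trans (solve 4 (λ u D n t → (u :+ D) :* n :+ (:- (D :* n) :+ t) := t :+ u :* n) refl 1# (fromℕ D) (fromℕ n) (fromℕ 2))
          (trans (+-congˡ (*-identityˡ _)) (sym (fromℕ-+ 2 n)))
        upper : (c * (fromℕ n * fromℕ n) + fromℕ (suc D ℕ.* P)) + (d * fromℤ b + fromℕ 2) ≈ y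
        upper = trans (solve 4 (λ s p e t → (s :+ p) :+ (e :+ t) := (s :+ e) :+ (p :+ t)) refl _ _ _ _)
          (+-cong (+-congʳ (*-congˡ (sym (fromℤ-square b)))) (sym (fromℕ-+ (suc D ℕ.* P) 2)))
      bound : E (- (c * fromℤ (b ℤ.* b)) - d * fromℤ b) ≤ majorant (Q ℕ.* 2) b
      bound = ≤-respˡ (trans (sym (E-+ _ _)) (E-cong shift-back))
        (≤-respʳ (trans (sym (*-assoc _ _ _)) (*-congʳ (sym (×1-homo-* Q 2))))
          (*-mono-≤ (E-nonneg _) (*-nonneg (fromℕ-nonneg 2) (1/-nonneg (suc (level b) ℕ.* suc (suc (level b)))))
            (proj₂ (proj₂ (natural-bound (E (fromℕ m)))))
            (E-decay (level b) y (≤-trans (fromℕ-mono-≤ {2 ℕ.+ level b} {2 ℕ.+ n} (ℕ.s≤s (ℕ.s≤s (level≤∣∣ b)))) y≥n+2))))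
        where
        open Solver
        shift-back : fromℕ m - y ≈ - (c * fromℤ (b ℤ.* b)) - d * fromℤ b
        shift-back = solve 3 (λ s e m → m :- ((s :+ e) :+ m) := :- s :- e) refl (c * fromℤ (b ℤ.* b)) (d * fromℤ b) (fromℕ m)

-- Subgroups of ℤⁿ containing kℤⁿ

least : {P : Pred ℕ 0ℓ} → Decidable P → ∀ n → P n → ∃[ m ] P m × (∀ {j} → j ℕ.< m → ¬ P j)
least {P} P? = <-rec _ λ n rec Pn → search n (λ m<n → rec m<n) Pn (ℕₚ.anyUpTo? P? n)
  where
  search : ∀ n → (∀ {m} → m ℕ.< n → P m → ∃[ m ] P m × (∀ {j} → j ℕ.< m → ¬ P j)) → P n →
           Dec (∃[ j ] j ℕ.< n × P j) → ∃[ m ] P m × (∀ {j} → j ℕ.< m → ¬ P j)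
  search n rec Pn (yes (j , j<n , Pj)) = rec j<n Pj
  search n rec Pn (no none)            = n , Pn , λ j<n Pj → none (_ , j<n , Pj)

∣-small⇒≡0 : ∀ {k n} → k ℕ∣.∣ n → n ℕ.< k → n ≡ 0
∣-small⇒≡0 {n = zero}  _   _   = ≡.refl
∣-small⇒≡0 {n = suc n} k∣n n<k = ⊥-elim (ℕₚ.<⇒≱ n<k (ℕ∣.∣⇒≤ k∣n))

-- The remainder is a multiple of d that is smaller than d.
[q*d]/d≡q : ∀ q d .{{_ : NonZero d}} → (q ℤ.* ℤ.+ d) ℤ/./ℕ d ≡ q
[q*d]/d≡q q d = ≡.sym (ℤₚ.*-cancelʳ-≡ q Q (ℤ.+ d) {{d≢0 d}} (begin
  a                    ≡⟨ ℤ/.a≡a%ℕn+[a/ℕn]*n a d ⟩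
  ℤ.+ r ℤ.+ Q ℤ.* ℤ.+ d ≡⟨ ≡.cong (λ r → ℤ.+ r ℤ.+ Q ℤ.* ℤ.+ d) (∣-small⇒≡0 (ℤ∣ₛ.∣⇒∣ᵤ d∣r) (ℤ/.n%ℕd<d a d)) ⟩
  ℤ.+ 0 ℤ.+ Q ℤ.* ℤ.+ d ≡⟨ ℤₚ.+-identityˡ _ ⟩
  Q ℤ.* ℤ.+ d          ∎))
  where
  open ≡.≡-Reasoning
  d≢0 : ∀ d .{{_ : NonZero d}} → ℤ.NonZero (ℤ.+ d)
  d≢0 (suc d) = _
  a = q ℤ.* ℤ.+ d
  r = a ℤ/.%ℕ d
  Q = a ℤ/./ℕ d
  ring : ∀ q Q r d → r ℤ.+ Q ℤ.* d ℤ.- Q ℤ.* d ≡ r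
  ring = ℤ-solve-∀
  ring′ : ∀ q Q d → q ℤ.* d ℤ.- Q ℤ.* d ≡ (q ℤ.- Q) ℤ.* d
  ring′ = ℤ-solve-∀
  d∣r : ℤ.+ d ℤ∣ₛ.∣ ℤ.+ r
  d∣r = ℤ∣ₛ.divides (q ℤ.- Q) (≡.trans (≡.sym (ring q Q (ℤ.+ r) (ℤ.+ d)))
    (≡.trans (≡.cong (ℤ._- Q ℤ.* ℤ.+ d) (≡.sym (ℤ/.a≡a%ℕn+[a/ℕn]*n a d))) (ring′ q Q (ℤ.+ d))))

infixl 6 _⊞_
infixr 7 _•_

_⊞_ : ∀ {n} → Vec ℤ n → Vec ℤ n → Vec ℤ n
_⊞_ = Vec.zipWith ℤ._+_

_•_ : ∀ {n} → ℤ → Vec ℤ n → Vec ℤ n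
x • v = Vec.map (x ℤ.*_) v

zeros : ∀ {n} → Vec ℤ n
zeros = Vec.replicate _ (ℤ.+ 0)

record IsLinear {m n} (φ : Vec ℤ m → Vec ℤ n) : Set where
  field
    additive    : ∀ u v → φ (u ⊞ v) ≡ φ u ⊞ φ v
    homogeneous : ∀ x v → φ (x • v) ≡ x • φ v

record IsFullSubgroup (k : ℕ) {n} (P : Pred (Vec ℤ n) 0ℓ) : Set where
  field
    ⊞-closed : ∀ {u v} → P u → P v → P (u ⊞ v)
    •-closed : ∀ x {v} → P v → P (x • v)
    full     : ∀ v → P (ℤ.+ k • v)

-- β enumerates P without repetition and α is its inverse, with junk values off P.
record Parametrisation {n} (P : Pred (Vec ℤ n) 0ℓ) : Set where
  field
    β α    : Vec ℤ n → Vec ℤ n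
    linear : IsLinear β
    β∈     : ∀ v → P (β v)
    αβ     : ∀ v → α (β v) ≡ v
    βα     : ∀ {w} → P w → β (α w) ≡ w

private
  ⊞-shift : ∀ q {n} (u v : Vec ℤ n) → (q • u ⊞ v) ⊞ (ℤ.- q) • u ≡ v
  ⊞-shift q []      []      = ≡.refl
  ⊞-shift q (x ∷ u) (y ∷ v) = ≡.cong₂ _∷_ (ring q x y) (⊞-shift q u v)
    where
    ring : ∀ q x y → (q ℤ.* x ℤ.+ y) ℤ.+ (ℤ.- q) ℤ.* x ≡ y
    ring = ℤ-solve-∀

  ⊞-unshift : ∀ q {n} (u v : Vec ℤ n) → q • u ⊞ (v ⊞ (ℤ.- q) • u) ≡ v
  ⊞-unshift q []      []      = ≡.refl
  ⊞-unshift q (x ∷ u) (y ∷ v) = ≡.cong₂ _∷_ (ring q x y) (⊞-unshift q u v)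
    where
    ring : ∀ q x y → q ℤ.* x ℤ.+ (y ℤ.+ (ℤ.- q) ℤ.* x) ≡ y
    ring = ℤ-solve-∀

  combine-⊞ : ∀ p q {n} (w u v : Vec ℤ n) → (p ℤ.+ q) • w ⊞ (u ⊞ v) ≡ (p • w ⊞ u) ⊞ (q • w ⊞ v)
  combine-⊞ p q []      []      []      = ≡.refl
  combine-⊞ p q (z ∷ w) (x ∷ u) (y ∷ v) = ≡.cong₂ _∷_ (ring p q z x y) (combine-⊞ p q w u v)
    where
    ring : ∀ p q z x y → (p ℤ.+ q) ℤ.* z ℤ.+ (x ℤ.+ y) ≡ (p ℤ.* z ℤ.+ x) ℤ.+ (q ℤ.* z ℤ.+ y)
    ring = ℤ-solve-∀

  combine-• : ∀ x q {n} (w u : Vec ℤ n) → (x ℤ.* q) • w ⊞ x • u ≡ x • (q • w ⊞ u)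
  combine-• x q []      []      = ≡.refl
  combine-• x q (z ∷ w) (y ∷ u) = ≡.cong₂ _∷_ (ring x q z y) (combine-• x q w u)
    where
    ring : ∀ x q z y → (x ℤ.* q) ℤ.* z ℤ.+ x ℤ.* y ≡ x ℤ.* (q ℤ.* z ℤ.+ y)
    ring = ℤ-solve-∀

  residues : ∀ k .{{_ : NonZero k}} {n} → Vec ℤ n → Vec ℤ n
  residues k = Vec.map λ b → ℤ.+ (b ℤ/.%ℕ k)

  quotients : ∀ k .{{_ : NonZero k}} {n} → Vec ℤ n → Vec ℤ n
  quotients k = Vec.map λ b → ℤ.- (b ℤ/./ℕ k)

  residues-quotients : ∀ k .{{_ : NonZero k}} {n} (v : Vec ℤ n) → v ⊞ ℤ.+ k • quotients k v ≡ residues k v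
  residues-quotients k []      = ≡.refl
  residues-quotients k (b ∷ v) = ≡.cong₂ _∷_
    (≡.trans (≡.cong (ℤ._+ ℤ.+ k ℤ.* ℤ.- (b ℤ/./ℕ k)) (ℤ/.a≡a%ℕn+[a/ℕn]*n b k)) (ring (ℤ.+ (b ℤ/.%ℕ k)) (b ℤ/./ℕ k) (ℤ.+ k)))
    (residues-quotients k v)
    where
    ring : ∀ r q k → (r ℤ.+ q ℤ.* k) ℤ.+ k ℤ.* ℤ.- q ≡ r
    ring = ℤ-solve-∀

  residues∈ : ∀ k .{{_ : NonZero k}} {n} (v : Vec ℤ n) i → lookup (residues k v) i ∈ List.map ℤ.+_ (upTo k)
  residues∈ k (b ∷ v) Fin.zero    = ∈-map⁺ ℤ.+_ (∈-upTo⁺ (ℤ/.n%ℕd<d b k))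
  residues∈ k (b ∷ v) (Fin.suc i) = residues∈ k v i

-- Split off the first coordinate: it takes exactly the multiples of its least positive value d on P.
parametrise : ∀ k .{{_ : NonZero k}} {n} {P : Pred (Vec ℤ n) 0ℓ} → Decidable P → IsFullSubgroup k P → Parametrisation P
parametrise k {zero} {P} P? full = record
  { β = λ v → v ; α = λ v → v
  ; linear = record { additive = λ _ _ → ≡.refl ; homogeneous = λ _ _ → ≡.refl }
  ; β∈ = λ { [] → IsFullSubgroup.full full [] }
  ; αβ = λ _ → ≡.refl
  ; βα = λ _ → ≡.refl
  }
parametrise k {suc n} {P} P? subgroup = build (least first? k first-k)
  where
  open IsFullSubgroup subgroup

  First : Pred ℕ 0ℓ
  First d = 0 ℕ.< d × ∃[ v ] P (ℤ.+ d ∷ v)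

  -- `P` is stable under adding multiples of k, so the remaining coordinates may be reduced modulo
  -- k. A finite search therefore decides whether d occurs as a first coordinate.
  candidates : List (Vec ℤ n)
  candidates = box λ _ → List.map ℤ.+_ (upTo k)

  normalise : ∀ {a v} → P (a ∷ v) → P (a ∷ residues k v)
  normalise {a} {v} Pav = ≡.subst P (≡.cong₂ _∷_ (ring a (ℤ.+ k)) (residues-quotients k v))
    (⊞-closed Pav (full (ℤ.+ 0 ∷ quotients k v)))
    where
    ring : ∀ a k → a ℤ.+ k ℤ.* ℤ.+ 0 ≡ a
    ring = ℤ-solve-∀

  first? : Decidable First
  first? d = (0 ℕₚ.<? d) ×-dec map′
    (λ p → let (v , _ , Pdv) = find p in v , Pdv)
    (λ (v , Pdv) → lose (∈-box⁺ (residues k v) (residues∈ k v)) (normalise Pdv))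
    (Any.any? (λ v → P? (ℤ.+ d ∷ v)) candidates)

  -- The search for the least d starts from k, which occurs in k times the first unit vector.
  first-k : First k
  first-k = ℕ.>-nonZero⁻¹ k , ℤ.+ k • zeros , ≡.subst (λ x → P (x ∷ ℤ.+ k • zeros)) (ℤₚ.*-identityʳ (ℤ.+ k)) (full (ℤ.+ 1 ∷ zeros))

  build : ∃[ d ] First d × (∀ {j} → j ℕ.< d → ¬ First j) → Parametrisation P
  build (d , (0<d , v₀ , P₀) , minimal) = record
    { β = β ; α = α
    ; linear = record
      { additive    = λ { (p ∷ u) (q ∷ v) → ≡.cong₂ _∷_ (ℤₚ.*-distribʳ-+ (ℤ.+ d) p q)
          (≡.trans (≡.cong ((p ℤ.+ q) • v₀ ⊞_) (R.additive u v)) (combine-⊞ p q v₀ (R.β u) (R.β v))) }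
      ; homogeneous = λ { x (q ∷ v) → ≡.cong₂ _∷_ (ℤₚ.*-assoc x q (ℤ.+ d))
          (≡.trans (≡.cong ((x ℤ.* q) • v₀ ⊞_) (R.homogeneous x v)) (combine-• x q v₀ (R.β v))) }
      }
    ; β∈ = λ { (q ∷ v) → ≡.subst (λ x → P (x ∷ (q • v₀ ⊞ R.β v))) (ℤₚ.+-identityʳ _) (⊞-closed (•-closed q P₀) (R.β∈ v)) }
    ; αβ = λ { (q ∷ v) → ≡.cong₂ _∷_ ([q*d]/d≡q q d)
        (≡.trans (≡.cong (λ p → R.α ((q • v₀ ⊞ R.β v) ⊞ (ℤ.- p) • v₀)) ([q*d]/d≡q q d))
          (≡.trans (≡.cong R.α (⊞-shift q v₀ (R.β v))) (R.αβ v))) }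
    ; βα = λ { {a ∷ v} → βα a v }
    }
    where
    instance
      d≢0 : NonZero d
      d≢0 = ℕ.>-nonZero 0<d
    First≡0 : Pred (Vec ℤ n) 0ℓ
    First≡0 v = P (ℤ.+ 0 ∷ v)
    first≡0-subgroup : IsFullSubgroup k First≡0
    first≡0-subgroup = record
      { ⊞-closed = ⊞-closed
      ; •-closed = λ x {v} Pv → ≡.subst (λ y → P (y ∷ x • v)) (ℤₚ.*-zeroʳ x) (•-closed x Pv)
      ; full     = λ v → ≡.subst (λ y → P (y ∷ ℤ.+ k • v)) (ℤₚ.*-zeroʳ (ℤ.+ k)) (full (ℤ.+ 0 ∷ v))
      }
    rest : Parametrisation First≡0
    rest = parametrise k (λ v → P? (ℤ.+ 0 ∷ v)) first≡0-subgroup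
    module R where
      open Parametrisation rest public
      open IsLinear linear public
    -- One row of a Hermite normal form: (d, v₀), followed by a parametrisation of the vectors of
    -- `P` with first coordinate 0. `α` divides by d and removes that multiple of (d, v₀); off `P` a
    -- remainder of the division is silently dropped.
    β α : Vec ℤ (suc n) → Vec ℤ (suc n)
    β (q ∷ v) = (q ℤ.* ℤ.+ d) ∷ (q • v₀ ⊞ R.β v)
    α (a ∷ v) = (a ℤ/./ℕ d) ∷ R.α (v ⊞ (ℤ.- (a ℤ/./ℕ d)) • v₀)

    βα : ∀ a v → P (a ∷ v) → β (α (a ∷ v)) ≡ a ∷ v
    βα a v Pav = ≡.cong₂ _∷_
      (≡.sym (≡.trans division (≡.trans (≡.cong (λ r → ℤ.+ r ℤ.+ q ℤ.* ℤ.+ d) r≡0) (ℤₚ.+-identityˡ _))))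
      (≡.trans (≡.cong (q • v₀ ⊞_) (R.βα (≡.subst (λ r → P (ℤ.+ r ∷ v ⊞ (ℤ.- q) • v₀)) r≡0 Pr))) (⊞-unshift q v₀ v))
      where
      q = a ℤ/./ℕ d
      r = a ℤ/.%ℕ d
      division : a ≡ ℤ.+ r ℤ.+ q ℤ.* ℤ.+ d
      division = ℤ/.a≡a%ℕn+[a/ℕn]*n a d
      ring : ∀ r q d → (r ℤ.+ q ℤ.* d) ℤ.+ (ℤ.- q) ℤ.* d ≡ r
      ring = ℤ-solve-∀
      -- Subtracting q times (d, v₀) leaves the remainder r as a first coordinate. A positive r
      -- below d would contradict the minimality of d.
      Pr : P (ℤ.+ r ∷ v ⊞ (ℤ.- q) • v₀)
      Pr = ≡.subst (λ x → P (x ∷ v ⊞ (ℤ.- q) • v₀))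
        (≡.trans (≡.cong (ℤ._+ (ℤ.- q) ℤ.* ℤ.+ d) division) (ring (ℤ.+ r) q (ℤ.+ d)))
        (⊞-closed Pav (•-closed (ℤ.- q) P₀))
      zero-or-pos : ∀ r → r ℕ.< d → P (ℤ.+ r ∷ v ⊞ (ℤ.- q) • v₀) → r ≡ 0
      zero-or-pos zero    _   _  = ≡.refl
      zero-or-pos (suc r) r<d Pr = ⊥-elim (minimal r<d (ℕ.s≤s ℕ.z≤n , _ , Pr))
      r≡0 : r ≡ 0
      r≡0 = zero-or-pos r (ℤ/.n%ℕd<d a d) Pr

-- Theta series modulo k

-- k divides the difference of the two representatives, whose absolute value is below k.
residue-unique : ∀ k .{{_ : NonTrivial k}} {a a′ : Fin k} b → Code.Residue k a b → Code.Residue k a′ b → a ≡ a′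
residue-unique k {a} {a′} b p q = Finₚ.toℕ-injective (ℤₚ.+-injective (ℤₚ.i-j≡0⇒i≡j _ _ (ℤₚ.∣i∣≡0⇒i≡0 (∣-small⇒≡0 divides bounded))))
  where
  difference : (b ℤ.- ℤ.+ toℕ a′) ℤ.- (b ℤ.- ℤ.+ toℕ a) ≡ ℤ.+ toℕ a ℤ.- ℤ.+ toℕ a′
  difference = ring b (ℤ.+ toℕ a) (ℤ.+ toℕ a′)
    where
    ring : ∀ b x y → (b ℤ.- y) ℤ.- (b ℤ.- x) ≡ x ℤ.- y
    ring = ℤ-solve-∀
  divides : k ℕ∣.∣ ℤ.∣ ℤ.+ toℕ a ℤ.- ℤ.+ toℕ a′ ∣
  divides = ≡.subst (λ z → ℤ.+ k ℤ∣.∣ z) difference (ℤ∣ₛ.∣⇒∣ᵤ (ℤ∣ₛ.∣m∣n⇒∣m-n {ℤ.+ k} {b ℤ.- ℤ.+ toℕ a′} (ℤ∣ₛ.∣ᵤ⇒∣ q) (ℤ∣ₛ.∣ᵤ⇒∣ p)))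
  bounded : ℤ.∣ ℤ.+ toℕ a ℤ.- ℤ.+ toℕ a′ ∣ ℕ.< k
  bounded = ≡.subst (ℕ._< k) (≡.cong ℤ.∣_∣ (≡.sym (ℤₚ.m-n≡m⊖n (toℕ a) (toℕ a′))))
    (ℕₚ.≤-<-trans (ℤₚ.∣m⊝n∣≤m⊔n (toℕ a) (toℕ a′)) (ℕₚ.⊔-lub (Finₚ.toℕ<n a) (Finₚ.toℕ<n a′)))

module GaussianSums (ℝ : RealField c ℓ₁ ℓ₂) where
  open RealFacts ℝ
  open RealConstants ℝ using (π; πTerm; π-Cauchy)
  open Limits ℝ
  open Complex ℝ
  open ComplexLimits ℝ
  open Exponential ℝ
  open ExponentialBounds ℝ
  open Distributivity ℂ-commutativeSemiring
  private
    module ℝΣ = Distributivity (CommutativeRing.commutativeSemiring commutativeRing)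

  -- The Leibniz series is arranged with positive terms, so its first term 8/3 is a lower bound.
  π-pos : 0# < π
  π-pos = <-≤-trans (*-pos (fromℕ-pos 8) (1/-pos 3)) (≤-lim (partialSum πTerm) π-Cauchy _ 1 λ N 1≤N →
    ≤-respʳ (sym (∑-downFrom πTerm N)) (≤-respˡ (+-identityʳ _)
      (∑-mono-⊆ (λ n → *-nonneg (fromℕ-nonneg 8) (1/-nonneg (suc (4 ℕ.* n) ℕ.* suc (suc (suc (4 ℕ.* n))))))
        {0 ∷ []} ([] ∷ []) λ { (here ≡.refl) → ∈-downFrom⁺ 1≤N })))

  -- i x τ
  J : ℂ → Carrier → ℂ
  J τ x = (- (x * im τ)) +i (x * re τ)

  J-cong : ∀ τ {x y} → x ≈ y → J τ x ≈ᶜ J τ y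
  J-cong τ eq = -‿cong (*-congʳ eq) , *-congʳ eq

  J-+ : ∀ τ x y → J τ (x + y) ≈ᶜ J τ x +ᶜ J τ y
  J-+ τ x y = trans (-‿cong (distribʳ _ _ _)) (sym (-‿+-comm _ _)) , distribʳ _ _ _

  J-0 : ∀ τ → J τ 0# ≈ᶜ 0ᶜ
  J-0 τ = trans (-‿cong (zeroˡ _)) -0#≈0# , zeroˡ _

  𝕚-scale : ∀ p τ x → ofReal p *ᶜ 𝕚 *ᶜ τ *ᶜ ofReal x ≈ᶜ J τ (p * x)
  𝕚-scale p τ x = transᶜ (*ᶜ-cong (*ᶜ-cong (p𝕚 p) reflᶜ) reflᶜ) (re-part p (re τ) (im τ) x , im-part p (re τ) (im τ) x)
    where
    open Solver
    p𝕚 : ∀ p → ofReal p *ᶜ 𝕚 ≈ᶜ 0# +i p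
    p𝕚 p = trans (+-cong (zeroʳ p) (trans (-‿cong (zeroˡ 1#)) -0#≈0#)) (+-identityˡ 0#)
         , trans (+-cong (*-identityʳ p) (zeroˡ 0#)) (+-identityʳ p)
    re-part : ∀ p a b x → (0# * a - p * b) * x - (0# * b + p * a) * 0# ≈ - ((p * x) * b)
    re-part = solve 4 (λ p a b x → (con (ℤ.+ 0) :* a :- p :* b) :* x :- (con (ℤ.+ 0) :* b :+ p :* a) :* con (ℤ.+ 0) := :- ((p :* x) :* b)) refl
    im-part : ∀ p a b x → (0# * a - p * b) * 0# + (0# * b + p * a) * x ≈ (p * x) * a
    im-part = solve 4 (λ p a b x → (con (ℤ.+ 0) :* a :- p :* b) :* con (ℤ.+ 0) :+ (con (ℤ.+ 0) :* b :+ p :* a) :* x := (p :* x) :* a) refl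

  module _ (k : ℕ) .{{k≥2 : NonTrivial k}} where
    open Code k using (R₀; Residue)

    private instance
      k≢0 : NonZero k
      k≢0 = ℕ.nonTrivial⇒nonZero k

    -- 1 on the coordinates outside T
    χ : Bool → Carrier
    χ true  = 0#
    χ false = 1#

    -- The terms of ψ for s = true and those of φ for s = false.
    gaussian : Bool → (τ z : ℂ) → ℤ → ℂ
    gaussian s τ z b = exp (J τ ((1/ k * π) * fromℤ (b ℤ.* b)) +ᶜ J z ((fromℕ 2 * π) * (χ s * fromℤ b)))

    gaussian-ψ : ∀ τ z b → gaussian true τ z b ≈ᶜ exp (ofReal (1/ k * π) *ᶜ 𝕚 *ᶜ τ *ᶜ ofReal (fromℤ (b ℤ.* b)))
    gaussian-ψ τ z b = exp-cong (exponent (fromℤ (b ℤ.* b)) (fromℤ b))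
      where
      exponent : ∀ q x → J τ ((1/ k * π) * q) +ᶜ J z ((fromℕ 2 * π) * (0# * x)) ≈ᶜ ofReal (1/ k * π) *ᶜ 𝕚 *ᶜ τ *ᶜ ofReal q
      exponent q x = transᶜ
        (+ᶜ-cong (symᶜ (𝕚-scale (1/ k * π) τ q))
          (transᶜ (J-cong z (trans (*-congˡ (zeroˡ _)) (zeroʳ _))) (J-0 z)))
        (+-identityʳ _ , +-identityʳ _)

    gaussian-φ : ∀ τ z b → gaussian false τ z b ≈ᶜ
      exp (ofReal (1/ k * π) *ᶜ 𝕚 *ᶜ τ *ᶜ ofReal (fromℤ (b ℤ.* b)) +ᶜ ofReal (fromℕ 2 * π) *ᶜ 𝕚 *ᶜ z *ᶜ ofReal (fromℤ b))
    gaussian-φ τ z b = exp-cong (exponent (fromℤ (b ℤ.* b)) (fromℤ b))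
      where
      exponent : ∀ q x → J τ ((1/ k * π) * q) +ᶜ J z ((fromℕ 2 * π) * (1# * x)) ≈ᶜ
        ofReal (1/ k * π) *ᶜ 𝕚 *ᶜ τ *ᶜ ofReal q +ᶜ ofReal (fromℕ 2 * π) *ᶜ 𝕚 *ᶜ z *ᶜ ofReal x
      exponent q x = +ᶜ-cong (symᶜ (𝕚-scale (1/ k * π) τ q))
        (symᶜ (transᶜ (𝕚-scale (fromℕ 2 * π) z x) (J-cong z (*-congˡ (sym (*-identityˡ _))))))

    abstract
      -- The exponent has real part - (π/k) Im τ b² - 2π χ Im z b; the condition Im τ > 0 makes the
      -- quadratic coefficient handed to `gaussian-decay` positive.
      gaussian-⊴ : ∀ s τ z → 0# < im τ → ∃[ K ] ∀ b → gaussian s τ z b ⊴ majorant K b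
      gaussian-⊴ s τ z 0<τ = let (K , le) = gaussian-decay ((1/ k * π) * im τ) (((fromℕ 2 * π) * χ s) * im z) (*-pos (*-pos (1/-pos k) π-pos) 0<τ) in
        K , λ b → ⊴-mono (≤-respˡ (E-cong (exponent (1/ k * π) (im τ) (fromℤ (b ℤ.* b)) (fromℕ 2 * π) (χ s) (im z) (fromℤ b))) (le b)) (exp-⊴ _)
        where
        open Solver
        exponent : ∀ p t q d x z b → - ((p * t) * q) - ((d * x) * z) * b ≈ - ((p * q) * t) + - ((d * (x * b)) * z)
        exponent = solve 7 (λ p t q d x z b → :- ((p :* t) :* q) :- ((d :* x) :* z) :* b := :- ((p :* q) :* t) :+ :- ((d :* (x :* b)) :* z)) refl

    residue? : ∀ a → Decidable (Residue a)
    residue? a b = k ℕ∣.∣? ℤ.∣ b ℤ.- ℤ.+ toℕ a ∣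

    residuesUpTo : R₀ → ℕ → List ℤ
    residuesUpTo a N = List.filter (residue? a) (integersUpTo N)

    residuesUpTo-unique : ∀ a N → Unique (residuesUpTo a N)
    residuesUpTo-unique a N = Uniqueₚ.filter⁺ (residue? a) (integersUpTo-unique N)

    abstract
      -- The majorant is summable over all of ℤ, so a single constant K serves every residue class.
      residue-sum : ∀ f K → (∀ b → f b ⊴ majorant K b) → ∀ a →
                    ∃[ s ] ((λ N → ∑ f (residuesUpTo a N)) ⟶ᶜ s) × HasSum (Residue a) f s
      residue-sum f K f⊴ a = Dominated.summable {P = Residue a} f (majorant K) integersUpTo integersUpTo-unique
        (λ b _ → suc (level b) , λ N lt → ∈-integersUpTo⁺ b lt)
        (residuesUpTo a) (residuesUpTo-unique a) (λ N → Allₚ.all-filter (residue? a) (integersUpTo N))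
        (λ N p r → ∈-filter⁺ (residue? a) p r)
        (majorant-nonneg K) (λ b _ → ⊴⇒bounded (f⊴ b)) (⟶⇒Cauchy (proj₂ (majorant-convergent K)))

    -- Summing over the disjoint classes w ≡ key u (mod k), u ∈ X, each of which is a product.
    class-sum : ∀ {t} (X : List A) (uX : Unique X) (key : A → Fin t → R₀) →
      (∀ {u v} → u ∈ X → v ∈ X → (∀ i → key u i ≡ key v i) → u ≡ v) →
      (f : Fin t → ℤ → ℂ) (K : ℕ) → (∀ i b → f i b ⊴ majorant K b) →
      (s : Fin t → R₀ → ℂ) → (∀ i a → (λ N → ∑ (f i) (residuesUpTo a N)) ⟶ᶜ s i a) →
      HasSum (λ w → ∃[ u ] u ∈ X × ∀ i → Residue (key u i) (lookup w i))
             (λ w → ∏ λ i → f i (lookup w i)) (∑ (λ u → ∏ λ i → s i (key u i)) X)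
    class-sum {t = t} X uX key key-injective f K f⊴ s s-lim = Dominated.hasSum {P = λ w → ∃[ u ] u ∈ X × InClass u w} F g cube (λ N → box-unique λ _ → integersUpTo-unique N)
        (λ w _ → let (N , in-N) = cube-exhausts w in N , λ M le → ∈-box⁺ w (in-N M le))
        (λ N → List.concatMap (λ u → class u N) X)
        (λ N → unique-concatMap (λ u → class u N) uX (λ u → box-unique λ i → residuesUpTo-unique (key u i) N)
          λ {u} {v} {w} u∈ v∈ p q → key-injective u∈ v∈ λ i → residue-unique k (lookup w i) (class⇒residue N p i) (class⇒residue N q i))
        (λ N → All.tabulate λ w∈ → let (u , u∈ , w∈u) = find (∈-concatMap⁻ (λ u → class u N) w∈) in u , u∈ , class⇒residue N w∈u)
        (λ N {w} w∈ (u , u∈ , r) → ∈-concatMap⁺ (λ u → class u N)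
          (lose u∈ (∈-box⁺ w λ i → ∈-filter⁺ (residue? (key u i)) (∈-box⁻ w∈ i) (r i))))
        (λ w → proj₁ (F⊴ w)) (λ w _ → ⊴⇒bounded (F⊴ w))
        g-Cauchy
      (⟶ᶜ-cong (λ N → symᶜ (transᶜ (∑-concatMap F (λ u → class u N) X) (∑-cong X λ u → ∑-box f (λ i → residuesUpTo (key u i) N))))
        reflᶜ (⟶ᶜ-∑ (λ u → ⟶ᶜ-∏ λ i → s-lim i (key u i)) X))
      where
      F : Vec ℤ t → ℂ
      F w = ∏ λ i → f i (lookup w i)
      g : Vec ℤ t → Carrier
      g w = ∏ʳ λ i → majorant K (lookup w i)
      F⊴ : ∀ w → F w ⊴ g w
      F⊴ w = ⊴-∏ λ i → f⊴ i (lookup w i)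
      InClass : _ → Vec ℤ t → Set
      InClass u w = ∀ i → Residue (key u i) (lookup w i)
      class : _ → ℕ → List (Vec ℤ t)
      class u N = box λ i → residuesUpTo (key u i) N
      class⇒residue : ∀ {u} N {w} → w ∈ class u N → InClass u w
      class⇒residue {u} N w∈ i = proj₂ (∈-filter⁻ (residue? (key u i)) {xs = integersUpTo N} (∈-box⁻ w∈ i))
      cube : ℕ → List (Vec ℤ t)
      cube N = box λ _ → integersUpTo N
      cube-exhausts : ∀ {n} (w : Vec ℤ n) → ∃[ N ] ∀ M → N ℕ.≤ M → ∀ i → lookup w i ∈ integersUpTo M
      cube-exhausts []      = 0 , λ _ _ ()
      cube-exhausts (b ∷ w) = let (N , in-N) = cube-exhausts w in suc (level b) ℕ.⊔ N , λ M le → λ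
        { Fin.zero    → ∈-integersUpTo⁺ b (ℕₚ.≤-trans (ℕₚ.m≤m⊔n _ N) le)
        ; (Fin.suc i) → in-N M (ℕₚ.≤-trans (ℕₚ.m≤n⊔m (suc (level b)) N) le) i }
      -- Over a cube the sum of the majorant is the t-th power of a convergent one-dimensional sum.
      g-Cauchy : Cauchy (λ N → ∑ʳ g (cube N))
      g-Cauchy = ⟶⇒Cauchy (⟶-cong {λ N → ∏ʳ {t} λ _ → ∑ʳ (majorant K) (integersUpTo N)} {λ N → ∑ʳ g (cube N)} (λ N → sym (ℝΣ.∑-box {n = t} (λ _ → majorant K) (λ _ → integersUpTo N))) refl
        (⟶-∏ {n = t} {λ _ N → ∑ʳ (majorant K) (integersUpTo N)} λ _ → proj₂ (majorant-convergent K)))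

-- Codes

Vec-ext : ∀ {n} {u v : Vec A n} → (∀ i → lookup u i ≡ lookup v i) → u ≡ v
Vec-ext {u = u} {v} eq = ≡.trans (≡.sym (Vecₚ.tabulate∘lookup u)) (≡.trans (Vecₚ.tabulate-cong eq) (Vecₚ.tabulate∘lookup v))

-- A permutation h is recorded by the table of h⁻¹, on which equality is propositional.
module _ {n} (H : PermutationGroup n) (M : CommutativeMonoid c ℓ) where
  open PermutationGroup H
  open CommutativeMonoid M
  open ListSum M

  private
    table : Permutation′ n → Vec (Fin n) n
    table h = tabulate (h ⟨$⟩ˡ_)

    lookup-table : ∀ h i → lookup (table h) i ≡ h ⟨$⟩ˡ i
    lookup-table h = Vecₚ.lookup∘tabulate (h ⟨$⟩ˡ_)

    table-injective : ∀ g h → table g ≡ table h → g Perm.≈ h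
    table-injective g h eq i = ≡.trans (≡.sym (Perm.inverseʳ h)) (≡.cong (h ⟨$⟩ʳ_)
      (≡.trans (≡.sym (lookup-table h (g ⟨$⟩ʳ i))) (≡.trans (≡.cong (λ t → lookup t (g ⟨$⟩ʳ i)) (≡.sym eq))
        (≡.trans (lookup-table g (g ⟨$⟩ʳ i)) (Perm.inverseˡ g)))))

    table-cong : ∀ g h → g Perm.≈ h → table g ≡ table h
    table-cong g h g≈h = Vecₚ.tabulate-cong λ i →
      ≡.trans (≡.sym (Perm.inverseˡ h)) (≡.cong (h ⟨$⟩ˡ_) (≡.trans (≡.sym (g≈h (g ⟨$⟩ˡ i))) (Perm.inverseʳ g)))

    unique-tables : (φ : Permutation′ n → Permutation′ n) → (∀ g h → φ g Perm.≈ φ h → g Perm.≈ h) →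
                    ∀ {gs} → AllPairs (λ g h → ¬ g Perm.≈ h) gs → Unique (List.map (table ∘ φ) gs)
    unique-tables φ φ-injective []          = []
    unique-tables φ φ-injective (g∉ ∷ rest) =
      Allₚ.map⁺ (All.map (λ g≉h eq → g≉h (φ-injective _ _ (table-injective (φ _) (φ _) eq))) g∉) ∷ unique-tables φ φ-injective rest

    ∈-table : ∀ {g} → g ∈G → table g ∈ List.map table elements
    ∈-table {g} g∈ = let (h , h∈ , g≈h) = find g∈ in ≡.subst (_∈ List.map table elements) (≡.sym (table-cong g h g≈h)) (∈-map⁺ table h∈)

    listed : ∀ {h} → h ∈ elements → h ∈G
    listed h∈ = lose h∈ λ _ → ≡.refl

  -- The substitution h ↦ h g⁻¹ permutes the group and turns i h⁻¹ into j h⁻¹, where j = i g. Hence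
  -- averages over the group are constant on its orbits, for codes and for real vectors alike.
  sum-invariant : ∀ (f : Fin n → Carrier) {i j} → ∃[ g ] g ∈G × g ⟨$⟩ʳ i ≡ j →
                  ∑ (λ h → f (h ⟨$⟩ˡ i)) elements ≈ ∑ (λ h → f (h ⟨$⟩ˡ j)) elements
  sum-invariant f {i} {j} (g , g∈ , ≡.refl) = begin
    ∑ (λ h → f (h ⟨$⟩ˡ i)) elements                 ≈⟨ ∑-cong elements (λ h → reflexive (≡.cong f (≡.sym (lookup-table h i)))) ⟩
    ∑ (λ h → f (lookup (table h) i)) elements        ≡⟨ ∑-map (λ t → f (lookup t i)) table elements ⟨
    ∑ (λ t → f (lookup t i)) (List.map table elements)
      ≈⟨ ∑-↭ _ (⊆-antisym-↭ (unique-tables shifted shifted-injective distinct) (unique-tables (λ h → h) (λ _ _ eq → eq) distinct) shifted⊆ ⊆shifted) ⟩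
    ∑ (λ t → f (lookup t i)) (List.map (table ∘ shifted) elements)
                                                     ≡⟨ ∑-map (λ t → f (lookup t i)) (table ∘ shifted) elements ⟩
    ∑ (λ h → f (lookup (table (shifted h)) i)) elements
      ≈⟨ ∑-cong elements (λ h → reflexive (≡.cong f (lookup-table (shifted h) i))) ⟩
    ∑ (λ h → f (h ⟨$⟩ˡ (g ⟨$⟩ʳ i))) elements        ∎
    where
    open import Relation.Binary.Reasoning.Setoid setoid
    shifted : Permutation′ n → Permutation′ n
    shifted h = h ∘ₚ Perm.flip g
    shifted-injective : ∀ h h′ → shifted h Perm.≈ shifted h′ → h Perm.≈ h′
    shifted-injective h h′ eq i = ≡.trans (≡.sym (Perm.inverseʳ g)) (≡.trans (≡.cong (g ⟨$⟩ʳ_) (eq i)) (Perm.inverseʳ g))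
    shifted⊆ : List.map (table ∘ shifted) elements ⊆ List.map table elements
    shifted⊆ t∈ with h , h∈ , ≡.refl ← ∈-map⁻ (table ∘ shifted) t∈ = ∈-table {shifted h} (∘∈ {h} {Perm.flip g} (listed h∈) (⁻¹∈ {g} g∈))
    ⊆shifted : List.map table elements ⊆ List.map (table ∘ shifted) elements
    -- `h′` is the listed representative of h g, so shifting it gives back h.
    ⊆shifted t∈ with h , h∈ , ≡.refl ← ∈-map⁻ table t∈ with h′ , h′∈ , hg≈h′ ← find (∘∈ {h} {g} (listed h∈) g∈) =
      ≡.subst (_∈ List.map (table ∘ shifted) elements)
        (table-cong (shifted h′) h λ x → ≡.trans (≡.cong (g ⟨$⟩ˡ_) (≡.sym (hg≈h′ x))) (Perm.inverseˡ g))
        (∈-map⁺ (table ∘ shifted) h′∈)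

-- Arithmetic modulo k and the image of the code

module ResidueRing (k : ℕ) .{{k≥2 : NonTrivial k}} where
  open Code k

  private instance
    k≢0 : NonZero k
    k≢0 = ℕ.nonTrivial⇒nonZero k

  residue-divides : ∀ a b → Residue a b → ℤ.+ k ℤ∣ₛ.∣ b ℤ.- ℤ.+ toℕ a
  residue-divides _ _ = ℤ∣ₛ.∣ᵤ⇒∣

  divides-residue : ∀ a b → ℤ.+ k ℤ∣ₛ.∣ b ℤ.- ℤ.+ toℕ a → Residue a b
  divides-residue _ _ = ℤ∣ₛ.∣⇒∣ᵤ

  residue-shift : ∀ {a x y} → ℤ.+ k ℤ∣ₛ.∣ y ℤ.- x → Residue a x → Residue a y
  residue-shift {a} {x} {y} k∣ r = divides-residue a y (≡.subst (ℤ.+ k ℤ∣ₛ.∣_) (ring x y (ℤ.+ toℕ a))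
    (ℤ∣ₛ.∣m∣n⇒∣m+n k∣ (residue-divides a x r)))
    where
    ring : ∀ x y a → (y ℤ.- x) ℤ.+ (x ℤ.- a) ≡ y ℤ.- a
    ring = ℤ-solve-∀

  residue-mod : ∀ m → Residue (m ℕ/.mod k) (ℤ.+ m)
  residue-mod m = divides-residue (m ℕ/.mod k) (ℤ.+ m) (ℤ∣ₛ.divides (ℤ.+ (m ℕ./ k)) (begin
    ℤ.+ m ℤ.- ℤ.+ toℕ (m ℕ/.mod k)                ≡⟨ ≡.cong (λ r → ℤ.+ m ℤ.- ℤ.+ r) (Finₚ.toℕ-fromℕ< (ℕ/.m%n<n m k)) ⟩
    ℤ.+ m ℤ.- ℤ.+ (m ℕ.% k)                       ≡⟨ ≡.cong (λ m′ → ℤ.+ m′ ℤ.- ℤ.+ (m ℕ.% k)) (ℕ/.m≡m%n+[m/n]*n m k) ⟩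
    ℤ.+ (m ℕ.% k) ℤ.+ ℤ.+ (m ℕ./ k ℕ.* k) ℤ.- ℤ.+ (m ℕ.% k)
                                                  ≡⟨ ring (ℤ.+ (m ℕ.% k)) (ℤ.+ (m ℕ./ k ℕ.* k)) ⟩
    ℤ.+ (m ℕ./ k ℕ.* k)                           ≡⟨ ℤₚ.pos-* (m ℕ./ k) k ⟩
    ℤ.+ (m ℕ./ k) ℤ.* ℤ.+ k                       ∎))
    where
    open ≡.≡-Reasoning
    ring : ∀ r q → (r ℤ.+ q) ℤ.- r ≡ q
    ring = ℤ-solve-∀

  residue-toℕ : ∀ a → Residue a (ℤ.+ toℕ a)
  residue-toℕ a = divides-residue a (ℤ.+ toℕ a) (ℤ∣ₛ.divides (ℤ.+ 0) (ℤₚ.+-inverseʳ (ℤ.+ toℕ a)))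

  residue-⊕ : ∀ a b x y → Residue a x → Residue b y → Residue (a ⊕ b) (x ℤ.+ y)
  residue-⊕ a b x y p q = residue-shift {a ⊕ b} {ℤ.+ (toℕ a ℕ.+ toℕ b)} {x ℤ.+ y}
    (≡.subst (ℤ.+ k ℤ∣ₛ.∣_) (ring x y (ℤ.+ toℕ a) (ℤ.+ toℕ b)) (ℤ∣ₛ.∣m∣n⇒∣m+n (residue-divides a x p) (residue-divides b y q)))
    (residue-mod (toℕ a ℕ.+ toℕ b))
    where
    ring : ∀ x y a b → (x ℤ.- a) ℤ.+ (y ℤ.- b) ≡ (x ℤ.+ y) ℤ.- (a ℤ.+ b)
    ring = ℤ-solve-∀

  residue-⊗ : ∀ a b x y → Residue a x → Residue b y → Residue (a ⊗ b) (x ℤ.* y)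
  residue-⊗ a b x y p q = residue-shift {a ⊗ b} {ℤ.+ (toℕ a ℕ.* toℕ b)} {x ℤ.* y}
    (≡.subst (ℤ.+ k ℤ∣ₛ.∣_) (≡.trans (ring x y (ℤ.+ toℕ a) (ℤ.+ toℕ b)) (≡.cong (λ z → x ℤ.* y ℤ.- z) (≡.sym (ℤₚ.pos-* (toℕ a) (toℕ b)))))
      (ℤ∣ₛ.∣m∣n⇒∣m+n (ℤ∣ₛ.∣m⇒∣m*n y (residue-divides a x p)) (ℤ∣ₛ.∣n⇒∣m*n (ℤ.+ toℕ a) (residue-divides b y q))))
    (residue-mod (toℕ a ℕ.* toℕ b))
    where
    ring : ∀ x y a b → (x ℤ.- a) ℤ.* y ℤ.+ a ℤ.* (y ℤ.- b) ≡ x ℤ.* y ℤ.- a ℤ.* b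
    ring = ℤ-solve-∀

  residue-0 : ∀ b → Residue 0ᴿ (ℤ.+ k ℤ.* b)
  residue-0 b = residue-shift {0ᴿ} {ℤ.+ 0} {ℤ.+ k ℤ.* b} (ℤ∣ₛ.divides b (ring (ℤ.+ k) b)) (residue-mod 0)
    where
    ring : ∀ k b → k ℤ.* b ℤ.- ℤ.+ 0 ≡ b ℤ.* k
    ring = ℤ-solve-∀

  reduce : ℤ → R₀
  reduce b = Fin.fromℕ< (ℤ/.n%ℕd<d b k)

  residue-reduce : ∀ b → Residue (reduce b) b
  residue-reduce b = divides-residue (reduce b) b (ℤ∣ₛ.divides (b ℤ/./ℕ k)
    (≡.trans (≡.cong₂ (λ x r → x ℤ.- ℤ.+ r) (ℤ/.a≡a%ℕn+[a/ℕn]*n b k) (Finₚ.toℕ-fromℕ< (ℤ/.n%ℕd<d b k)))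
      (ring (ℤ.+ (b ℤ/.%ℕ k)) (b ℤ/./ℕ k ℤ.* ℤ.+ k))))
    where
    ring : ∀ r q → (r ℤ.+ q) ℤ.- r ≡ q
    ring = ℤ-solve-∀

  -- Identities in R₀ are inherited from ℤ.
  ⊕-assoc : ∀ a b d → (a ⊕ b) ⊕ d ≡ a ⊕ (b ⊕ d)
  ⊕-assoc a b d = residue-unique k {(a ⊕ b) ⊕ d} {a ⊕ (b ⊕ d)} (x ℤ.+ y ℤ.+ z)
    (residue-⊕ (a ⊕ b) d (x ℤ.+ y) z (residue-⊕ a b x y (residue-toℕ a) (residue-toℕ b)) (residue-toℕ d))
    (≡.subst (Residue (a ⊕ (b ⊕ d))) (≡.sym (ℤₚ.+-assoc x y z))
      (residue-⊕ a (b ⊕ d) x (y ℤ.+ z) (residue-toℕ a) (residue-⊕ b d y z (residue-toℕ b) (residue-toℕ d))))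
    where
    x = ℤ.+ toℕ a
    y = ℤ.+ toℕ b
    z = ℤ.+ toℕ d

  ⊕-comm : ∀ a b → a ⊕ b ≡ b ⊕ a
  ⊕-comm a b = ≡.cong (ℕ/._mod k) (ℕₚ.+-comm (toℕ a) (toℕ b))

  ⊕-identityˡ : ∀ a → 0ᴿ ⊕ a ≡ a
  ⊕-identityˡ a = residue-unique k {0ᴿ ⊕ a} {a} (ℤ.+ 0 ℤ.+ ℤ.+ toℕ a)
    (residue-⊕ 0ᴿ a (ℤ.+ 0) (ℤ.+ toℕ a) (residue-mod 0) (residue-toℕ a)) (residue-toℕ a)

  ⊗-distribˡ-⊕ : ∀ a b d → a ⊗ (b ⊕ d) ≡ (a ⊗ b) ⊕ (a ⊗ d)
  ⊗-distribˡ-⊕ a b d = residue-unique k {a ⊗ (b ⊕ d)} {(a ⊗ b) ⊕ (a ⊗ d)} (x ℤ.* (y ℤ.+ z))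
    (residue-⊗ a (b ⊕ d) x (y ℤ.+ z) (residue-toℕ a) (residue-⊕ b d y z (residue-toℕ b) (residue-toℕ d)))
    (≡.subst (Residue ((a ⊗ b) ⊕ (a ⊗ d))) (≡.sym (ℤₚ.*-distribˡ-+ x y z))
      (residue-⊕ (a ⊗ b) (a ⊗ d) (x ℤ.* y) (x ℤ.* z)
        (residue-⊗ a b x y (residue-toℕ a) (residue-toℕ b)) (residue-⊗ a d x z (residue-toℕ a) (residue-toℕ d))))
    where
    x = ℤ.+ toℕ a
    y = ℤ.+ toℕ b
    z = ℤ.+ toℕ d

  ⊗-exchange : ∀ a b d → a ⊗ (b ⊗ d) ≡ b ⊗ (a ⊗ d)
  ⊗-exchange a b d = residue-unique k {a ⊗ (b ⊗ d)} {b ⊗ (a ⊗ d)} (x ℤ.* (y ℤ.* z))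
    (residue-⊗ a (b ⊗ d) x (y ℤ.* z) (residue-toℕ a) (residue-⊗ b d y z (residue-toℕ b) (residue-toℕ d)))
    (≡.subst (Residue (b ⊗ (a ⊗ d))) (ring x y z)
      (residue-⊗ b (a ⊗ d) y (x ℤ.* z) (residue-toℕ b) (residue-⊗ a d x z (residue-toℕ a) (residue-toℕ d))))
    where
    x = ℤ.+ toℕ a
    y = ℤ.+ toℕ b
    z = ℤ.+ toℕ d
    ring : ∀ a b d → b ℤ.* (a ℤ.* d) ≡ a ℤ.* (b ℤ.* d)
    ring = ℤ-solve-∀

  ⊗-zeroʳ : ∀ a → a ⊗ 0ᴿ ≡ 0ᴿ
  ⊗-zeroʳ a = residue-unique k {a ⊗ 0ᴿ} {0ᴿ} (ℤ.+ toℕ a ℤ.* ℤ.+ 0)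
    (residue-⊗ a 0ᴿ (ℤ.+ toℕ a) (ℤ.+ 0) (residue-toℕ a) (residue-mod 0))
    (≡.subst (Residue 0ᴿ) (≡.sym (ℤₚ.*-zeroʳ (ℤ.+ toℕ a))) (residue-mod 0))

  ⊕-commutativeMonoid : CommutativeMonoid 0ℓ 0ℓ
  ⊕-commutativeMonoid = record
    { Carrier = R₀ ; _≈_ = _≡_ ; _∙_ = _⊕_ ; ε = 0ᴿ
    ; isCommutativeMonoid = record
      { isMonoid = record
        { isSemigroup = record
          { isMagma = record { isEquivalence = ≡.isEquivalence ; ∙-cong = ≡.cong₂ _⊕_ }
          ; assoc = ⊕-assoc
          }
        ; identity = ⊕-identityˡ , λ a → ≡.trans (⊕-comm a 0ᴿ) (⊕-identityˡ a)
        }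
      ; comm = ⊕-comm
      }
    }

  open ListSum ⊕-commutativeMonoid

  module _ {n} (H : PermutationGroup n) (r : R₀) where
    open PermutationGroup H

    lookup-θ : ∀ v i → lookup (θ H r v) i ≡ r ⊗ ∑ (λ h → lookup v (h ⟨$⟩ˡ i)) elements
    lookup-θ v i = ≡.trans (Vecₚ.lookup-map i (r ⊗_) (orbitSum elements)) (≡.cong (r ⊗_) (go elements))
      where
      orbitSum : List (Permutation′ n) → V n
      orbitSum = List.foldr (λ h s → v ◃ h ⊕ᵛ s) 0ᵛ
      go : ∀ hs → lookup (orbitSum hs) i ≡ ∑ (λ h → lookup v (h ⟨$⟩ˡ i)) hs
      go []       = Vecₚ.lookup-replicate i 0ᴿ
      go (h ∷ hs) = ≡.trans (Vecₚ.lookup-zipWith _⊕_ i (v ◃ h) (orbitSum hs)) (≡.cong₂ _⊕_ (Vecₚ.lookup∘tabulate _ i) (go hs))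

    θ-⊕ : ∀ u v → θ H r (u ⊕ᵛ v) ≡ θ H r u ⊕ᵛ θ H r v
    θ-⊕ u v = Vec-ext λ i → begin
      lookup (θ H r (u ⊕ᵛ v)) i
        ≡⟨ lookup-θ (u ⊕ᵛ v) i ⟩
      r ⊗ ∑ (λ h → lookup (u ⊕ᵛ v) (h ⟨$⟩ˡ i)) elements
        ≡⟨ ≡.cong (r ⊗_) (≡.trans (∑-cong elements λ h → Vecₚ.lookup-zipWith _⊕_ (h ⟨$⟩ˡ i) u v) (∑-∙ _ _ elements)) ⟩
      r ⊗ (∑ (λ h → lookup u (h ⟨$⟩ˡ i)) elements ⊕ ∑ (λ h → lookup v (h ⟨$⟩ˡ i)) elements)
        ≡⟨ ⊗-distribˡ-⊕ r _ _ ⟩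
      (r ⊗ ∑ (λ h → lookup u (h ⟨$⟩ˡ i)) elements) ⊕ (r ⊗ ∑ (λ h → lookup v (h ⟨$⟩ˡ i)) elements)
        ≡⟨ ≡.cong₂ _⊕_ (lookup-θ u i) (lookup-θ v i) ⟨
      lookup (θ H r u) i ⊕ lookup (θ H r v) i
        ≡⟨ Vecₚ.lookup-zipWith _⊕_ i (θ H r u) (θ H r v) ⟨
      lookup (θ H r u ⊕ᵛ θ H r v) i ∎
      where open ≡.≡-Reasoning

    θ-⊗ : ∀ s v → θ H r (s ⊗ᵛ v) ≡ s ⊗ᵛ θ H r v
    θ-⊗ s v = Vec-ext λ i → begin
      lookup (θ H r (s ⊗ᵛ v)) i
        ≡⟨ lookup-θ (s ⊗ᵛ v) i ⟩
      r ⊗ ∑ (λ h → lookup (s ⊗ᵛ v) (h ⟨$⟩ˡ i)) elements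
        ≡⟨ ≡.cong (r ⊗_) (≡.trans (∑-cong elements λ h → Vecₚ.lookup-map (h ⟨$⟩ˡ i) (s ⊗_) v) (≡.sym (factor elements))) ⟩
      r ⊗ (s ⊗ ∑ (λ h → lookup v (h ⟨$⟩ˡ i)) elements)
        ≡⟨ ⊗-exchange r s _ ⟩
      s ⊗ (r ⊗ ∑ (λ h → lookup v (h ⟨$⟩ˡ i)) elements)
        ≡⟨ ≡.cong (s ⊗_) (lookup-θ v i) ⟨
      s ⊗ lookup (θ H r v) i
        ≡⟨ Vecₚ.lookup-map i (s ⊗_) (θ H r v) ⟨
      lookup (s ⊗ᵛ θ H r v) i ∎
      where
      open ≡.≡-Reasoning
      factor : ∀ {f : Permutation′ n → R₀} hs → s ⊗ ∑ f hs ≡ ∑ (λ h → s ⊗ f h) hs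
      factor []       = ⊗-zeroʳ s
      factor (h ∷ hs) = ≡.trans (⊗-distribˡ-⊕ s _ _) (≡.cong (_ ⊕_) (factor hs))

    lookup-θ-0 : ∀ i → lookup (θ H r 0ᵛ) i ≡ 0ᴿ
    lookup-θ-0 i = ≡.trans (lookup-θ 0ᵛ i) (≡.trans (≡.cong (r ⊗_) (vanish elements)) (⊗-zeroʳ r))
      where
      vanish : ∀ hs → ∑ (λ h → lookup (0ᵛ {n}) (h ⟨$⟩ˡ i)) hs ≡ 0ᴿ
      vanish []       = ≡.refl
      vanish (h ∷ hs) = ≡.trans (≡.cong₂ _⊕_ (Vecₚ.lookup-replicate (h ⟨$⟩ˡ i) 0ᴿ) (vanish hs)) (⊕-identityˡ 0ᴿ)

    θ-invariant : (O : Orbits H) → let open Orbits O in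
                  ∀ v {i j} → orbitOf i ≡ orbitOf j → lookup (θ H r v) i ≡ lookup (θ H r v) j
    θ-invariant O v {i} {j} eq = ≡.trans (lookup-θ v i) (≡.trans
      (≡.cong (r ⊗_) (sum-invariant H ⊕-commutativeMonoid (lookup v) (Equivalence.to (Orbits.same O i j) eq)))
      (≡.sym (lookup-θ v j)))

    module _ {G : PermutationGroup n} (C : GCode G) where
      open GCode C

      private
        X = imageθ H r C

        ∈-allV : ∀ {m} (v : V m) → v ∈ allV m
        ∈-allV []      = here ≡.refl
        ∈-allV (a ∷ v) = ∈-cartesianProductWith⁺ _∷_ (∈-allFin a) (∈-allV v)

      imageθ-unique : Unique X
      imageθ-unique = DecUnique.deduplicate-! (Vecₚ.≡-dec Finₚ._≟_) _

      ∈-imageθ⁺ : ∀ {v} → v ∈C → θ H r v ∈ X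
      ∈-imageθ⁺ {v} v∈C = ∈-deduplicate⁺ (Vecₚ.≡-dec Finₚ._≟_) (∈-map⁺ (θ H r) (∈-filter⁺ _∈C? (∈-allV v) v∈C))

      ∈-imageθ⁻ : ∀ {u} → u ∈ X → ∃[ v ] v ∈C × u ≡ θ H r v
      ∈-imageθ⁻ u∈X = let (v , v∈ , eq) = ∈-map⁻ (θ H r) (∈-deduplicate⁻ (Vecₚ.≡-dec Finₚ._≟_) _ u∈X) in
        v , proj₂ (∈-filter⁻ _∈C? {xs = allV n} v∈) , eq

      module _ (O : Orbits H) where
        open Orbits O

        -- Words in the image of θ are constant on orbits, so their values at the representatives
        -- determine them.
        coord-injective : ∀ {u v} → u ∈ X → v ∈ X → (∀ i → coord O u i ≡ coord O v i) → u ≡ v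
        coord-injective u∈ v∈ eq with u′ , _ , ≡.refl ← ∈-imageθ⁻ u∈ with v′ , _ , ≡.refl ← ∈-imageθ⁻ v∈ =
          Vec-ext λ j → ≡.trans (≡.sym (θ-invariant O u′ (rep∈ (orbitOf j))))
            (≡.trans (eq (orbitOf j)) (θ-invariant O v′ (rep∈ (orbitOf j))))

        -- Construction A on orbit coordinates: the preimage in ℤᵗ of the averaged code.
        CodeLattice : Pred (Vec ℤ t) 0ℓ
        CodeLattice w = ∃[ u ] u ∈ X × ∀ i → Residue (coord O u i) (lookup w i)

        codeLattice? : (∀ a → Decidable (Residue a)) → Decidable CodeLattice
        codeLattice? residue? w = map′ find (λ (u , u∈ , p) → lose u∈ p)
          (Any.any? (λ u → Finₚ.all? λ i → residue? (coord O u i) (lookup w i)) X)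

        -- θ is linear over R₀, so the averaged code is a submodule. An integer scalar acts through
        -- its residue, and multiples of k reduce to the image of the zero word.
        codeLattice-full : IsFullSubgroup k CodeLattice
        codeLattice-full = record
          { ⊞-closed = λ {w} {w′} (u , u∈ , p) (u′ , u′∈ , p′) → u ⊕ᵛ u′ , closed-⊕ u∈ u′∈ , λ i →
              ≡.subst₂ Residue (≡.sym (Vecₚ.lookup-zipWith _⊕_ (rep i) u u′)) (≡.sym (Vecₚ.lookup-zipWith ℤ._+_ i w w′))
                (residue-⊕ (coord O u i) (coord O u′ i) (lookup w i) (lookup w′ i) (p i) (p′ i))
          ; •-closed = λ x {w} (u , u∈ , p) → reduce x ⊗ᵛ u , closed-⊗ (reduce x) u∈ , λ i →
              ≡.subst₂ Residue (≡.sym (Vecₚ.lookup-map (rep i) (reduce x ⊗_) u)) (≡.sym (Vecₚ.lookup-map i (x ℤ.*_) w))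
                (residue-⊗ (reduce x) (coord O u i) x (lookup w i) (residue-reduce x) (p i))
          ; full = λ w → θ H r 0ᵛ , ∈-imageθ⁺ 0∈ , λ i →
              ≡.subst₂ Residue (≡.sym (lookup-θ-0 (rep i))) (≡.sym (Vecₚ.lookup-map i (ℤ.+ k ℤ.*_) w)) (residue-0 (lookup w i))
          }
          where
          closed-⊕ : ∀ {u v} → u ∈ X → v ∈ X → u ⊕ᵛ v ∈ X
          closed-⊕ u∈ v∈ with u′ , u′∈ , ≡.refl ← ∈-imageθ⁻ u∈ with v′ , v′∈ , ≡.refl ← ∈-imageθ⁻ v∈ =
            ≡.subst (_∈ X) (θ-⊕ u′ v′) (∈-imageθ⁺ (⊕∈ u′∈ v′∈))
          closed-⊗ : ∀ s {u} → u ∈ X → s ⊗ᵛ u ∈ X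
          closed-⊗ s u∈ with u′ , u′∈ , ≡.refl ← ∈-imageθ⁻ u∈ =
            ≡.subst (_∈ X) (θ-⊗ s u′) (∈-imageθ⁺ (⊗∈ s u′∈))

-- Jacobi monomials as products over orbits

module JacobiMonomial (R : CommutativeSemiring c ℓ) where
  open CommutativeSemiring R hiding (zero)
  open Distributivity R using (∏; ∏-cong; ∏-*)
  open RawSemiringDefinitions rawSemiring using (_^_; product)
  open import Algebra.Properties.CommutativeSemigroup *-commutativeSemigroup using (x∙yz≈y∙xz)
  open import Relation.Binary.Reasoning.Setoid setoid

  product≈∏ : ∀ {n} (f : Fin n → Carrier) → product f ≈ ∏ f
  product≈∏ {zero}  f = refl
  product≈∏ {suc n} f = *-congˡ (product≈∏ (f ∘ Fin.suc))

  ∏-1 : ∀ n → ∏ {n} (λ _ → 1#) ≈ 1#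
  ∏-1 zero    = refl
  ∏-1 (suc n) = trans (*-congˡ (∏-1 n)) (*-identityˡ 1#)

  ∏-single : ∀ {n} (j : Fin n) (f : Fin n → Carrier) → ∏ (λ i → if does (j Finₚ.≟ i) then f i else 1#) ≈ f j
  ∏-single {suc n} Fin.zero    f = trans (*-congˡ (∏-1 n)) (*-identityʳ (f Fin.zero))
  ∏-single (Fin.suc j) f = trans (*-identityˡ _) (∏-single j (f ∘ Fin.suc))

  ^-∷ : ∀ x b {n} (S : Subset n) → x ^ ∣ b ∷ S ∣ ≈ (if b then x else 1#) * x ^ ∣ S ∣
  ^-∷ x true  S = refl
  ^-∷ x false S = sym (*-identityˡ _)

  -- The left side collects equal values, the right side keeps one factor per orbit. Splitting off
  -- the first orbit raises exactly one exponent, the one at a = u 0, and `∏-single` extracts that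
  -- factor.
  monomial : ∀ {k t} (x y : Fin k → Carrier) (T : Subset t) (u : Fin t → Fin k) →
    ∏ (λ a → x a ^ ∣ T ∩ tabulate (λ i → does (u i Finₚ.≟ a)) ∣ * y a ^ ∣ ∁ T ∩ tabulate (λ i → does (u i Finₚ.≟ a)) ∣)
      ≈ ∏ λ i → if lookup T i then x (u i) else y (u i)
  monomial {k} x y [] u = trans (∏-cong {k} λ _ → *-identityˡ 1#) (∏-1 k)
  monomial {k} x y (true ∷ T) u = begin
    ∏ (λ a → x a ^ ∣ does (u Fin.zero Finₚ.≟ a) ∷ T ∩ S a ∣ * y a ^ ∣ ∁ T ∩ S a ∣)
      ≈⟨ ∏-cong {k} (λ a → trans (*-congʳ (^-∷ (x a) (does (u Fin.zero Finₚ.≟ a)) (T ∩ S a))) (*-assoc _ _ _)) ⟩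
    ∏ (λ a → (if does (u Fin.zero Finₚ.≟ a) then x a else 1#) * (x a ^ ∣ T ∩ S a ∣ * y a ^ ∣ ∁ T ∩ S a ∣))
      ≈⟨ ∏-* {k} _ _ ⟩
    ∏ (λ a → if does (u Fin.zero Finₚ.≟ a) then x a else 1#) * ∏ (λ a → x a ^ ∣ T ∩ S a ∣ * y a ^ ∣ ∁ T ∩ S a ∣)
      ≈⟨ *-cong (∏-single (u Fin.zero) x) (monomial x y T (u ∘ Fin.suc)) ⟩
    x (u Fin.zero) * ∏ (λ i → if lookup T i then x (u (Fin.suc i)) else y (u (Fin.suc i))) ∎
    where S = λ a → tabulate (λ i → does (u (Fin.suc i) Finₚ.≟ a))
  monomial {k} x y (false ∷ T) u = begin
    ∏ (λ a → x a ^ ∣ T ∩ S a ∣ * y a ^ ∣ does (u Fin.zero Finₚ.≟ a) ∷ ∁ T ∩ S a ∣)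
      ≈⟨ ∏-cong {k} (λ a → trans (*-congˡ (^-∷ (y a) (does (u Fin.zero Finₚ.≟ a)) (∁ T ∩ S a))) (x∙yz≈y∙xz _ _ _)) ⟩
    ∏ (λ a → (if does (u Fin.zero Finₚ.≟ a) then y a else 1#) * (x a ^ ∣ T ∩ S a ∣ * y a ^ ∣ ∁ T ∩ S a ∣))
      ≈⟨ ∏-* {k} _ _ ⟩
    ∏ (λ a → if does (u Fin.zero Finₚ.≟ a) then y a else 1#) * ∏ (λ a → x a ^ ∣ T ∩ S a ∣ * y a ^ ∣ ∁ T ∩ S a ∣)
      ≈⟨ *-cong (∏-single (u Fin.zero) y) (monomial x y T (u ∘ Fin.suc)) ⟩
    y (u Fin.zero) * ∏ (λ i → if lookup T i then x (u (Fin.suc i)) else y (u (Fin.suc i))) ∎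
    where S = λ a → tabulate (λ i → does (u (Fin.suc i) Finₚ.≟ a))

-- Lattices

unit : ∀ {n} → Fin n → Vec ℤ n
unit Fin.zero    = ℤ.+ 1 ∷ zeros
unit (Fin.suc j) = ℤ.+ 0 ∷ unit j

module Scaled {k n} .{{_ : NonZero k}} {P : Pred (Vec ℤ n) 0ℓ} (subgroup : IsFullSubgroup k P) (param : Parametrisation P) where
  open IsFullSubgroup subgroup
  open Parametrisation param
  open IsLinear linear

  -- k β⁻¹, defined on all of ℤⁿ
  γ : Vec ℤ n → Vec ℤ n
  γ w = α (ℤ.+ k • w)

  βγ : ∀ w → β (γ w) ≡ ℤ.+ k • w
  βγ w = βα (full w)

  β-injective : ∀ {u v} → β u ≡ β v → u ≡ v
  β-injective {u} {v} eq = ≡.trans (≡.sym (αβ u)) (≡.trans (≡.cong α eq) (αβ v))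

  γβ : ∀ v → γ (β v) ≡ ℤ.+ k • v
  γβ v = β-injective (≡.trans (βγ (β v)) (≡.sym (homogeneous (ℤ.+ k) v)))

  -- `α` comes with no linearity of its own. After composition with the injective map `β`, however,
  -- `γ` becomes multiplication by k.
  γ-linear : IsLinear γ
  γ-linear = record
    { additive    = λ u v → β-injective (≡.trans (βγ (u ⊞ v)) (≡.trans (•-distrib (ℤ.+ k) u v)
        (≡.sym (≡.trans (additive (γ u) (γ v)) (≡.cong₂ _⊞_ (βγ u) (βγ v))))))
    ; homogeneous = λ x v → β-injective (≡.trans (βγ (x • v)) (≡.trans (•-exchange (ℤ.+ k) x v)
        (≡.sym (≡.trans (homogeneous x (γ v)) (≡.cong (x •_) (βγ v))))))
    }
    where
    •-distrib : ∀ x {m} (u v : Vec ℤ m) → x • (u ⊞ v) ≡ x • u ⊞ x • v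
    •-distrib x []      []      = ≡.refl
    •-distrib x (y ∷ u) (z ∷ v) = ≡.cong₂ _∷_ (ℤₚ.*-distribˡ-+ x y z) (•-distrib x u v)
    •-exchange : ∀ x y {m} (v : Vec ℤ m) → x • y • v ≡ y • x • v
    •-exchange x y []      = ≡.refl
    •-exchange x y (z ∷ v) = ≡.cong₂ _∷_
      (≡.trans (≡.sym (ℤₚ.*-assoc x y z)) (≡.trans (≡.cong (ℤ._* z) (ℤₚ.*-comm x y)) (ℤₚ.*-assoc y x z))) (•-exchange x y v)

module RealLattice (ℝ : RealField c ℓ₁ ℓ₂) where
  open RealFacts ℝ
  open RealConstants ℝ using (√; √-square)
  open Exponential ℝ using (fromℕ-cancel)
  open Theta ℝ
  open import Algebra.Properties.Semiring.Sum semiring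
    using (sum; sum-cong-≋; ∑-comm; *-distribˡ-sum; *-distribʳ-sum)
  open ListSum (CommutativeRing.+-commutativeMonoid commutativeRing)
  open import Relation.Binary.Reasoning.Setoid setoid

  sum-zero : ∀ {n} {f : Fin n → Carrier} → (∀ i → f i ≈ 0#) → sum f ≈ 0#
  sum-zero {zero}  eq = refl
  sum-zero {suc n} eq = trans (+-cong (eq Fin.zero) (sum-zero (eq ∘ Fin.suc))) (+-identityˡ 0#)

  fromℤ-1 : fromℤ (ℤ.+ 1) ≈ 1#
  fromℤ-1 = +-identityʳ 1#

  sum-unit : ∀ {n} (a : Fin n → Carrier) l → sum (λ j → a j * fromℤ (lookup (unit j) l)) ≈ a l
  sum-unit a Fin.zero    = trans (+-cong (trans (*-congˡ fromℤ-1) (*-identityʳ _)) (sum-zero λ j → zeroʳ (a (Fin.suc j)))) (+-identityʳ _)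
  sum-unit a (Fin.suc l) = trans (+-cong (trans (*-congˡ (reflexive (≡.cong fromℤ (Vecₚ.lookup-replicate l (ℤ.+ 0))))) (zeroʳ _))
    (sum-unit (a ∘ Fin.suc) l)) (+-identityˡ _)

  functional-expand : ∀ {n} (φ : Vec ℤ n → ℤ) → (∀ u v → φ (u ⊞ v) ≡ φ u ℤ.+ φ v) → (∀ x v → φ (x • v) ≡ x ℤ.* φ v) →
                      ∀ v → fromℤ (φ v) ≈ sum λ j → fromℤ (lookup v j) * fromℤ (φ (unit j))
  functional-expand φ φ-+ φ-• []      = reflexive (≡.cong fromℤ (φ-• (ℤ.+ 0) []))
  functional-expand {suc n} φ φ-+ φ-• (x ∷ v) = begin
    fromℤ (φ (x ∷ v))
      ≡⟨ ≡.cong fromℤ (≡.trans (≡.cong φ (split x v)) (≡.trans (φ-+ _ _) (≡.cong (ℤ._+ φ (ℤ.+ 0 ∷ v)) (φ-• x (unit Fin.zero))))) ⟩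
    fromℤ (x ℤ.* φ (unit Fin.zero) ℤ.+ φ (ℤ.+ 0 ∷ v))
      ≈⟨ trans (fromℤ-+ (x ℤ.* φ (unit Fin.zero)) (φ (ℤ.+ 0 ∷ v))) (+-congʳ (fromℤ-* x (φ (unit Fin.zero)))) ⟩
    fromℤ x * fromℤ (φ (unit Fin.zero)) + fromℤ (φ (ℤ.+ 0 ∷ v))
      ≈⟨ +-congˡ (functional-expand (λ v → φ (ℤ.+ 0 ∷ v)) (λ u v → φ-+ (ℤ.+ 0 ∷ u) (ℤ.+ 0 ∷ v))
           (λ y v → ≡.trans (≡.cong (λ z → φ (z ∷ y • v)) (≡.sym (ℤₚ.*-zeroʳ y))) (φ-• y (ℤ.+ 0 ∷ v))) v) ⟩
    sum (λ j → fromℤ (lookup (x ∷ v) j) * fromℤ (φ (unit j))) ∎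
    where
    zeros-absorb : ∀ {m} x (v : Vec ℤ m) → v ≡ x • zeros ⊞ v
    zeros-absorb x []      = ≡.refl
    zeros-absorb x (y ∷ v) = ≡.cong₂ _∷_ (≡.sym (≡.trans (≡.cong (ℤ._+ y) (ℤₚ.*-zeroʳ x)) (ℤₚ.+-identityˡ y))) (zeros-absorb x v)
    split : ∀ x (v : Vec ℤ n) → x ∷ v ≡ x • unit Fin.zero ⊞ (ℤ.+ 0 ∷ v)
    split x v = ≡.cong₂ _∷_ (≡.sym (≡.trans (ℤₚ.+-identityʳ _) (ℤₚ.*-identityʳ x))) (zeros-absorb x v)

  -- Row j is the image of the j-th unit vector. In this form a linear map of integer vectors acts
  -- on real row vectors, through `·ᴹ`.
  matrix : ∀ {m n} → (Vec ℤ m → Vec ℤ n) → Fin m → Fin n → Carrier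
  matrix φ j i = fromℤ (lookup (φ (unit j)) i)

  matrix-apply : ∀ {m n} {φ : Vec ℤ m → Vec ℤ n} → IsLinear φ → ∀ v i →
                 fromℤ (lookup (φ v) i) ≈ sum λ j → fromℤ (lookup v j) * matrix φ j i
  matrix-apply {φ = φ} linear v i = functional-expand (λ v → lookup (φ v) i)
    (λ u v → ≡.trans (≡.cong (λ w → lookup w i) (IsLinear.additive linear u v)) (Vecₚ.lookup-zipWith ℤ._+_ i (φ u) (φ v)))
    (λ x v → ≡.trans (≡.cong (λ w → lookup w i) (IsLinear.homogeneous linear x v)) (Vecₚ.lookup-map i (x ℤ.*_) (φ v)))
    v

  infixl 7 _·ᴹ_
  _·ᴹ_ : ∀ {m n} → (Fin m → Carrier) → (Fin m → Fin n → Carrier) → Fin n → Carrier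
  (a ·ᴹ M) i = sum λ j → a j * M j i

  ·ᴹ-assoc : ∀ {l m n} (a : Fin l → Carrier) (M : Fin l → Fin m → Carrier) (N : Fin m → Fin n → Carrier) i →
             (a ·ᴹ M ·ᴹ N) i ≈ sum λ j → a j * (M j ·ᴹ N) i
  ·ᴹ-assoc a M N i = begin
    sum (λ h → sum (λ j → a j * M j h) * N h i)      ≈⟨ sum-cong-≋ (λ h → *-distribʳ-sum (N h i) (λ j → a j * M j h)) ⟩
    sum (λ h → sum (λ j → a j * M j h * N h i))      ≈⟨ ∑-comm (λ h j → a j * M j h * N h i) ⟩
    sum (λ j → sum (λ h → a j * M j h * N h i))      ≈⟨ sum-cong-≋ (λ j → trans (sum-cong-≋ λ h → *-assoc (a j) (M j h) (N h i))
                                                           (sym (*-distribˡ-sum (a j) (λ h → M j h * N h i)))) ⟩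
    sum (λ j → a j * sum (λ h → M j h * N h i))      ∎

  -- On unit vectors the integral identity says that the product of the matrices is k times the
  -- identity matrix, and this no longer refers to integer coefficients.
  scaled-inverse : ∀ {m n} k (φ : Vec ℤ m → Vec ℤ n) (ψ : Vec ℤ n → Vec ℤ m) → IsLinear ψ → (∀ v → ψ (φ v) ≡ ℤ.+ k • v) →
                   ∀ a i → (a ·ᴹ matrix φ ·ᴹ matrix ψ) i ≈ fromℕ k * a i
  scaled-inverse k φ ψ ψ-linear ψφ a i = begin
    (a ·ᴹ matrix φ ·ᴹ matrix ψ) i                                ≈⟨ ·ᴹ-assoc a (matrix φ) (matrix ψ) i ⟩
    sum (λ j → a j * (matrix φ j ·ᴹ matrix ψ) i)                 ≈⟨ sum-cong-≋ (λ j → *-congˡ (product j)) ⟩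
    sum (λ j → a j * (fromℕ k * fromℤ (lookup (unit j) i)))      ≈⟨ sum-cong-≋ (λ j → exchange (a j) (fromℕ k) (fromℤ (lookup (unit j) i))) ⟩
    sum (λ j → fromℕ k * (a j * fromℤ (lookup (unit j) i)))      ≈⟨ *-distribˡ-sum (fromℕ k) (λ j → a j * fromℤ (lookup (unit j) i)) ⟨
    fromℕ k * sum (λ j → a j * fromℤ (lookup (unit j) i))        ≈⟨ *-congˡ (sum-unit a i) ⟩
    fromℕ k * a i                                                ∎
    where
    exchange : ∀ x y z → x * (y * z) ≈ y * (x * z)
    exchange = solve 3 (λ x y z → x :* (y :* z) := y :* (x :* z)) refl
      where open Solver
    product : ∀ j → (matrix φ j ·ᴹ matrix ψ) i ≈ fromℕ k * fromℤ (lookup (unit j) i)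
    product j = begin
      sum (λ h → fromℤ (lookup (φ (unit j)) h) * matrix ψ h i)   ≈⟨ matrix-apply ψ-linear (φ (unit j)) i ⟨
      fromℤ (lookup (ψ (φ (unit j))) i)                          ≡⟨ ≡.cong fromℤ (≡.trans (≡.cong (λ w → lookup w i) (ψφ (unit j)))
                                                                       (Vecₚ.lookup-map i (ℤ.+ k ℤ.*_) (unit j))) ⟩
      fromℤ (ℤ.+ k ℤ.* lookup (unit j) i)                        ≈⟨ fromℤ-* (ℤ.+ k) (lookup (unit j) i) ⟩
      fromℕ k * fromℤ (lookup (unit j) i)                        ∎

  module _ {n} {H : PermutationGroup n} (O : Orbits H) where
    open PermutationGroup H
    open Orbits O

    θᴿ-invariant : ∀ v {i j} → orbitOf i ≡ orbitOf j → θᴿ H v i ≈ θᴿ H v j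
    θᴿ-invariant v {i} {j} eq = *-congˡ (sum-invariant H (CommutativeRing.+-commutativeMonoid commutativeRing) v
      (Equivalence.to (same i j) eq))

    -- A vector that is constant on the orbits equals its own average, so it serves as its own
    -- preimage.
    invariant⇒InΓθ : ∀ u → (∀ i j → orbitOf i ≡ orbitOf j → u i ≈ u j) → InΓθ H u
    invariant⇒InΓθ u inv = u , λ i → sym (begin
      1/ order * ∑ (λ h → u (h ⟨$⟩ˡ i)) elements      ≈⟨ *-congˡ (∑-cong-∈ elements λ {h} h∈ →
                                                           inv _ _ (Equivalence.from (same (h ⟨$⟩ˡ i) i) (h , lose h∈ (λ _ → ≡.refl) , Perm.inverseʳ h))) ⟩
      1/ order * ∑ (λ _ → u i) elements                ≈⟨ *-congˡ (constant (u i) elements) ⟩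
      1/ order * (fromℕ order * u i)                   ≈⟨ *-assoc _ _ _ ⟨
      1/ order * fromℕ order * u i                     ≈⟨ *-congʳ (1/-inverse order) ⟩
      1# * u i                                         ≈⟨ *-identityˡ _ ⟩
      u i                                              ∎)
      where
      constant : ∀ x (hs : List (Permutation′ n)) → ∑ (λ _ → x) hs ≈ fromℕ (List.length hs) * x
      constant x []       = sym (zeroˡ x)
      constant x (h ∷ hs) = trans (+-cong (sym (*-identityˡ x)) (constant x hs)) (sym (distribʳ _ _ _))

    -- The lattice of all Σ (wᵢ/√k) Ōᵢ with w in P.
    module Build (k : ℕ) .{{k≢0 : NonZero k}} {P : Pred (Vec ℤ t) 0ℓ} (subgroup : IsFullSubgroup k P) (param : Parametrisation P) where
      open Parametrisation param
      open Scaled subgroup param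

      Mβ Mγ : Fin t → Fin t → Carrier
      Mβ = matrix β
      Mγ = matrix γ

      -- This is 1/√k, written so because `1/` inverts natural numbers.
      √k/k : Carrier
      √k/k = √ k * 1/ k

      -- The entry on the orbit i of Ōᵢ/√k, and its inverse.
      s s⁻¹ : Fin t → Carrier
      s i   = (√ (size i) * 1/ (size i)) * √k/k
      s⁻¹ i = √ (size i) * √ k

      s-inverse : ∀ i → s i * s⁻¹ i ≈ 1#
      s-inverse i = trans (regroup (√ (size i)) (1/ (size i)) (√ k) (1/ k))
        (trans (*-cong (trans (*-congˡ (√-square (size i))) (1/-inverse (size i))) (trans (*-congˡ (√-square k)) (1/-inverse k))) (*-identityˡ 1#))
        where
        regroup : ∀ x r y q → ((x * r) * (y * q)) * (x * y) ≈ (r * (x * x)) * (q * (y * y))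
        regroup = solve 4 (λ x r y q → ((x :* r) :* (y :* q)) :* (x :* y) := (r :* (x :* x)) :* (q :* (y :* y))) refl
          where open Solver

      basis : Fin t → Γ n
      basis j p = Mβ j (orbitOf p) * s (orbitOf p)

      combination-basis : ∀ a p → combination a basis p ≈ (a ·ᴹ Mβ) (orbitOf p) * s (orbitOf p)
      combination-basis a p = trans (sum-cong-≋ λ j → sym (*-assoc (a j) (Mβ j (orbitOf p)) (s (orbitOf p))))
        (sym (*-distribʳ-sum (s (orbitOf p)) (λ j → a j * Mβ j (orbitOf p))))

      lattice : Lattice H
      lattice = record
        { rank        = t
        ; basis       = basis
        ; basis∈      = λ j → invariant⇒InΓθ (basis j) λ p q eq → reflexive (≡.cong (λ o → Mβ j o * s o) eq)
        ; independent = independent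
        ; spanning    = spanning
        }
        where
        independent : ∀ a → combination a basis ≈ᵛ (λ _ → 0#) → ∀ j → a j ≈ 0#
        -- Applying `Mγ` to the vanishing row a Mβ yields k a, and k can be cancelled.
        independent a a≈0 l = fromℕ-cancel k (begin
          fromℕ k * a l                    ≈⟨ scaled-inverse k β γ γ-linear γβ a l ⟨
          (a ·ᴹ Mβ ·ᴹ Mγ) l                  ≈⟨ sum-zero (λ i → trans (*-congʳ (aB≈0 i)) (zeroˡ _)) ⟩
          0#                               ≈⟨ zeroʳ _ ⟨
          fromℕ k * 0#                     ∎)
          where
          aB≈0 : ∀ i → (a ·ᴹ Mβ) i ≈ 0#
          aB≈0 i = begin
            (a ·ᴹ Mβ) i                     ≈⟨ *-identityʳ _ ⟨
            (a ·ᴹ Mβ) i * 1#                ≈⟨ *-congˡ (s-inverse i) ⟨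
            (a ·ᴹ Mβ) i * (s i * s⁻¹ i)     ≈⟨ *-assoc _ _ _ ⟨
            (a ·ᴹ Mβ) i * s i * s⁻¹ i       ≡⟨ ≡.cong (λ o → (a ·ᴹ Mβ) o * s o * s⁻¹ i) (rep∈ i) ⟨
            (a ·ᴹ Mβ) (orbitOf (rep i)) * s (orbitOf (rep i)) * s⁻¹ i
                                           ≈⟨ *-congʳ (combination-basis a (rep i)) ⟨
            combination a basis (rep i) * s⁻¹ i
                                           ≈⟨ *-congʳ (a≈0 (rep i)) ⟩
            0# * s⁻¹ i                     ≈⟨ zeroˡ _ ⟩
            0#                             ∎
        spanning : ∀ u → InΓθ H u → ∃[ a ] u ≈ᵛ combination a basis
        spanning u (v , u≈θv) = a , λ p → sym (begin
          combination a basis p                        ≈⟨ combination-basis a p ⟩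
          (a ·ᴹ Mβ) (orbitOf p) * s (orbitOf p)         ≈⟨ *-congʳ (aB≈x (orbitOf p)) ⟩
          x (orbitOf p) * s (orbitOf p)                ≈⟨ *-assoc _ _ _ ⟩
          u (rep (orbitOf p)) * (s⁻¹ (orbitOf p) * s (orbitOf p))
                                                       ≈⟨ *-congˡ (trans (*-comm _ _) (s-inverse (orbitOf p))) ⟩
          u (rep (orbitOf p)) * 1#                     ≈⟨ *-identityʳ _ ⟩
          u (rep (orbitOf p))                          ≈⟨ u≈θv (rep (orbitOf p)) ⟩
          θᴿ H v (rep (orbitOf p))                     ≈⟨ θᴿ-invariant v (rep∈ (orbitOf p)) ⟩
          θᴿ H v p                                     ≈⟨ u≈θv p ⟨
          u p                                          ∎)
          where
          -- `x` is √k times the coordinate vector of u with respect to the Ōᵢ. Since Mγ Mβ is k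
          -- times the identity, x Mγ / k gives the coefficients of u in the basis.
          x : Fin t → Carrier
          x i = u (rep i) * s⁻¹ i
          a : Fin t → Carrier
          a j = 1/ k * (x ·ᴹ Mγ) j
          aB≈x : ∀ i → (a ·ᴹ Mβ) i ≈ x i
          aB≈x i = begin
            sum (λ j → 1/ k * (x ·ᴹ Mγ) j * Mβ j i)          ≈⟨ sum-cong-≋ (λ j → *-assoc (1/ k) ((x ·ᴹ Mγ) j) (Mβ j i)) ⟩
            sum (λ j → 1/ k * ((x ·ᴹ Mγ) j * Mβ j i))        ≈⟨ *-distribˡ-sum (1/ k) (λ j → (x ·ᴹ Mγ) j * Mβ j i) ⟨
            1/ k * (x ·ᴹ Mγ ·ᴹ Mβ) i                         ≈⟨ *-congˡ (scaled-inverse k γ β linear βγ x i) ⟩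
            1/ k * (fromℕ k * x i)                         ≈⟨ *-assoc _ _ _ ⟨
            1/ k * fromℕ k * x i                           ≈⟨ *-congʳ (1/-inverse k) ⟩
            1# * x i                                       ≈⟨ *-identityˡ _ ⟩
            x i                                            ∎

      open Lattice lattice using (point)

      coord-point : ∀ b i → coordᴿ O (point b) i ≈ fromℤ (lookup (β b) i) * √k/k
      coord-point b i = begin
        √ (size i) * point b (rep i)
          ≈⟨ *-congˡ (combination-basis (fromℤ ∘ lookup b) (rep i)) ⟩
        √ (size i) * (((fromℤ ∘ lookup b) ·ᴹ Mβ) (orbitOf (rep i)) * s (orbitOf (rep i)))
          ≡⟨ ≡.cong (λ o → √ (size i) * (((fromℤ ∘ lookup b) ·ᴹ Mβ) o * s o)) (rep∈ i) ⟩
        √ (size i) * (((fromℤ ∘ lookup b) ·ᴹ Mβ) i * s i)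
          ≈⟨ *-congˡ (*-congʳ (matrix-apply linear b i)) ⟨
        √ (size i) * (fromℤ (lookup (β b) i) * ((√ (size i) * 1/ (size i)) * √k/k))
          ≈⟨ regroup (√ (size i)) (fromℤ (lookup (β b) i)) (1/ (size i)) √k/k ⟩
        (1/ (size i) * (√ (size i) * √ (size i))) * (fromℤ (lookup (β b) i) * √k/k)
          ≈⟨ *-congʳ (trans (*-congˡ (√-square (size i))) (1/-inverse (size i))) ⟩
        1# * (fromℤ (lookup (β b) i) * √k/k)
          ≈⟨ *-identityˡ _ ⟩
        fromℤ (lookup (β b) i) * √k/k ∎
        where
        regroup : ∀ x w r y → x * (w * ((x * r) * y)) ≈ (r * (x * x)) * (w * y)
        regroup = solve 4 (λ x w r y → x :* (w :* ((x :* r) :* y)) := (r :* (x :* x)) :* (w :* y)) refl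
          where open Solver

      inner-product : ∀ b b′ → ⟨_,_⟩ O (point b) (point b′) ≈ sum λ i → fromℤ (lookup (β b) i ℤ.* lookup (β b′) i) * 1/ k
      inner-product b b′ = sum-cong-≋ λ i → begin
        coordᴿ O (point b) i * coordᴿ O (point b′) i     ≈⟨ *-cong (coord-point b i) (coord-point b′ i) ⟩
        (fromℤ (lookup (β b) i) * √k/k) * (fromℤ (lookup (β b′) i) * √k/k)
                                                         ≈⟨ regroup _ _ (√ k) (1/ k) ⟩
        (fromℤ (lookup (β b) i) * fromℤ (lookup (β b′) i)) * ((1/ k * (√ k * √ k)) * 1/ k)
                                                         ≈⟨ *-cong (sym (fromℤ-* (lookup (β b) i) (lookup (β b′) i))) (trans (*-congʳ (trans (*-congˡ (√-square k)) (1/-inverse k))) (*-identityˡ _)) ⟩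
        fromℤ (lookup (β b) i ℤ.* lookup (β b′) i) * 1/ k ∎
        where
        regroup : ∀ x y s r → (x * (s * r)) * (y * (s * r)) ≈ (x * y) * ((r * (s * s)) * r)
        regroup = solve 4 (λ x y s r → (x :* (s :* r)) :* (y :* (s :* r)) := (x :* y) :* ((r :* (s :* s)) :* r)) refl
          where open Solver

-- The Jacobi theta series of the code lattice

module JacobiTheta (ℝ : RealField c ℓ₁ ℓ₂) where
  open RealFacts ℝ
  open RealConstants ℝ using (π)
  open Complex ℝ
  open Limits ℝ
  open ComplexLimits ℝ
  open Exponential ℝ
  open ExponentialBounds ℝ
  open GaussianSums ℝ
  open RealLattice ℝ
  open Theta ℝ
  open Distributivity ℂ-commutativeSemiring using (∑; ∏; ∏-cong; ∑-cong)
  open JacobiMonomial ℂ-commutativeSemiring using (monomial; product≈∏)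
  open import Algebra.Properties.Semiring.Sum semiring using (sum; sum-cong-≋; *-distribˡ-sum)

  exp-∏ : ∀ τ z {n} (x y : Fin n → Carrier) →
          exp (J τ (sum x) +ᶜ J z (sum y)) ≈ᶜ ∏ λ i → exp (J τ (x i) +ᶜ J z (y i))
  exp-∏ τ z {zero}  x y = transᶜ (exp-cong (transᶜ (+ᶜ-cong (J-0 τ) (J-0 z)) (+-identityʳ 0# , +-identityʳ 0#)))
    (E-0 , exp-ofReal-im 0#)
  exp-∏ τ z {suc n} x y = transᶜ (exp-cong (transᶜ (+ᶜ-cong (J-+ τ x₀ x₊) (J-+ z y₀ y₊))
      (interchange (J τ x₀) (J τ x₊) (J z y₀) (J z y₊))))
    (transᶜ (exp-+ (J τ x₀ +ᶜ J z y₀) (J τ x₊ +ᶜ J z y₊)) (*ᶜ-cong reflᶜ (exp-∏ τ z (x ∘ Fin.suc) (y ∘ Fin.suc))))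
    where
    open import Algebra.Properties.CommutativeSemigroup (CommutativeRing.+-commutativeSemigroup ℂ-commutativeRing) using (interchange)
    x₀ = x Fin.zero
    y₀ = y Fin.zero
    x₊ = sum (x ∘ Fin.suc)
    y₊ = sum (y ∘ Fin.suc)

  module Modulus (k : ℕ) .{{k≥2 : NonTrivial k}} where
    open Code k
    open ResidueRing k

    private instance
      k≢0 : NonZero k
      k≢0 = ℕ.nonTrivial⇒nonZero k

    module Theorem {n} {G : PermutationGroup n} (C : GCode G) (H : PermutationGroup n) (r : R₀) (O : Orbits H) (T : Subset (Orbits.t O)) where
      open Orbits O

      private
        X = imageθ H r C
        subgroup = codeLattice-full H r C O
        param = parametrise k (codeLattice? H r C O (residue? k)) subgroup

      open Parametrisation param
      open Scaled subgroup param using (γ; βγ)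
      open Build O k subgroup param using (lattice; inner-product)
      open Lattice lattice using (point)

      -- The integer counterpart of `χ`; it is an integer so that `γ` can be applied.
      outside : Bool → ℤ
      outside true  = ℤ.+ 0
      outside false = ℤ.+ 1

      -- √k on the orbits outside T and 0 on those in T
      y-index : Vec ℤ t
      y-index = γ (Vec.map outside T)

      y : Γ n
      y = point y-index

      D : Lattice H
      D = lattice

      χ-outside : ∀ s → fromℤ (outside s) ≈ χ k s
      χ-outside true  = refl
      χ-outside false = +-identityʳ 1#

      norm : ∀ b → π * ⟨_,_⟩ O (point b) (point b) ≈ sum λ i → (1/ k * π) * fromℤ (lookup (β b) i ℤ.* lookup (β b) i)
      norm b = trans (*-congˡ (inner-product b b)) (trans (*-distribˡ-sum π (λ i → fromℤ (lookup (β b) i ℤ.* lookup (β b) i) * 1/ k))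
        (sum-cong-≋ λ i → regroup π (fromℤ (lookup (β b) i ℤ.* lookup (β b) i)) (1/ k)))
        where
        open Solver
        regroup : ∀ p q r → p * (q * r) ≈ (r * p) * q
        regroup = solve 3 (λ p q r → p :* (q :* r) := (r :* p) :* q) refl

      -- The entries k of `β y-index` cancel the factor 1/k of the inner product. This is why the
      -- linear exponent of φ carries no 1/k although the quadratic one does.
      pairing : ∀ b → (fromℕ 2 * π) * ⟨_,_⟩ O (point b) y ≈ sum λ i → (fromℕ 2 * π) * (χ k (lookup T i) * fromℤ (lookup (β b) i))
      pairing b = trans (*-congˡ (trans (inner-product b y-index) (sum-cong-≋ entry)))
        (*-distribˡ-sum (fromℕ 2 * π) (λ i → χ k (lookup T i) * fromℤ (lookup (β b) i)))
        where
        open import Relation.Binary.Reasoning.Setoid setoid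
        regroup : ∀ w k x r → (w * (k * x)) * r ≈ (r * k) * (x * w)
        regroup = solve 4 (λ w k x r → (w :* (k :* x)) :* r := (r :* k) :* (x :* w)) refl
          where open Solver
        lookup-y : ∀ i → lookup (β y-index) i ≡ ℤ.+ k ℤ.* outside (lookup T i)
        lookup-y i = ≡.trans (≡.cong (λ v → lookup v i) (βγ (Vec.map outside T)))
          (≡.trans (Vecₚ.lookup-map i (ℤ.+ k ℤ.*_) (Vec.map outside T)) (≡.cong (ℤ.+ k ℤ.*_) (Vecₚ.lookup-map i outside T)))
        entry : ∀ i → fromℤ (lookup (β b) i ℤ.* lookup (β y-index) i) * 1/ k ≈ χ k (lookup T i) * fromℤ (lookup (β b) i)
        entry i = begin
          fromℤ (w ℤ.* lookup (β y-index) i) * 1/ k              ≡⟨ ≡.cong (λ x → fromℤ (w ℤ.* x) * 1/ k) (lookup-y i) ⟩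
          fromℤ (w ℤ.* (ℤ.+ k ℤ.* outside (lookup T i))) * 1/ k   ≈⟨ *-congʳ (trans (fromℤ-* w (ℤ.+ k ℤ.* outside (lookup T i)))
                                                                     (*-congˡ (fromℤ-* (ℤ.+ k) (outside (lookup T i))))) ⟩
          (fromℤ w * (fromℕ k * fromℤ (outside (lookup T i)))) * 1/ k
                                                                 ≈⟨ regroup (fromℤ w) (fromℕ k) (fromℤ (outside (lookup T i))) (1/ k) ⟩
          (1/ k * fromℕ k) * (fromℤ (outside (lookup T i)) * fromℤ w)
                                                                 ≈⟨ *-cong (1/-inverse k) (*-congʳ (χ-outside (lookup T i))) ⟩
          1# * (χ k (lookup T i) * fromℤ w)                      ≈⟨ *-identityˡ _ ⟩
          χ k (lookup T i) * fromℤ w                             ∎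
          where w = lookup (β b) i

      theta-term : ∀ τ z b → (∏ λ i → gaussian k (lookup T i) τ z (lookup (β b) i)) ≈ᶜ
        exp (ofReal π *ᶜ 𝕚 *ᶜ τ *ᶜ ofReal (⟨_,_⟩ O (point b) (point b))
             +ᶜ ofReal (fromℕ 2 * π) *ᶜ 𝕚 *ᶜ z *ᶜ ofReal (⟨_,_⟩ O (point b) y))
      theta-term τ z b = symᶜ (transᶜ (exp-cong (+ᶜ-cong
          (transᶜ (𝕚-scale π τ (⟨_,_⟩ O (point b) (point b))) (J-cong τ (norm b)))
          (transᶜ (𝕚-scale (fromℕ 2 * π) z (⟨_,_⟩ O (point b) y)) (J-cong z (pairing b)))))
        (exp-∏ τ z (λ i → (1/ k * π) * fromℤ (lookup (β b) i ℤ.* lookup (β b) i))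
                   (λ i → (fromℕ 2 * π) * (χ k (lookup T i) * fromℤ (lookup (β b) i)))))

      CJ-value : (ψ φ : R₀ → ℂ) →
        ∑ (λ u → ∏ λ i → if lookup T i then ψ (coord O u i) else φ (coord O u i)) X ≈ᶜ CJ O ℂ-rawSemiring X T ψ φ
      CJ-value ψ φ = ∑-cong X λ u → symᶜ (transᶜ
        (product≈∏ λ a → ψ a ^ᶜ count O a T u *ᶜ φ a ^ᶜ count O a (∁ T) u)
        (monomial ψ φ T (coord O u)))

      module _ (τ z : ℂ) (0<τ : 0# < im τ) where
        private
          K : Bool → ℕ
          K s = proj₁ (gaussian-⊴ k s τ z 0<τ)

          -- `class-sum` asks for one constant that majorises the factors of both kinds, those on T
          -- and those outside.
          Kmax : ℕ
          Kmax = K true ℕ.+ K false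

          K≤Kmax : ∀ s → K s ℕ.≤ Kmax
          K≤Kmax true  = ℕₚ.m≤m+n (K true) (K false)
          K≤Kmax false = ℕₚ.m≤n+m (K false) (K true)

          bound : ∀ s b → gaussian k s τ z b ⊴ majorant Kmax b
          bound s b = ⊴-mono (majorant-mono {K s} {Kmax} (K≤Kmax s) b) (proj₂ (gaussian-⊴ k s τ z 0<τ) b)

          sums : ∀ s a → ∃[ v ] ((λ N → ∑ (gaussian k s τ z) (residuesUpTo k a N)) ⟶ᶜ v) × HasSum (Residue a) (gaussian k s τ z) v
          sums s = residue-sum k (gaussian k s τ z) Kmax (bound s)

        ψ-value φ-value : R₀ → ℂ
        ψ-value a = proj₁ (sums true a)
        φ-value a = proj₁ (sums false a)

        ψ-correct : ∀ a → IsPsiValue k a τ (ψ-value a)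
        ψ-correct a = HasSum-cong {P = Residue a} {gaussian k true τ z} {ψ-term} {ψ-value a} {ψ-value a} (gaussian-ψ k τ z) (refl , refl) (proj₂ (proj₂ (sums true a)))
          where
          ψ-term : ℤ → ℂ
          ψ-term b = exp (ofReal (1/ k * π) *ᶜ 𝕚 *ᶜ τ *ᶜ ofReal (fromℤ (b ℤ.* b)))

        φ-correct : ∀ a → IsPhiValue k a τ z (φ-value a)
        φ-correct a = HasSum-cong {P = Residue a} {gaussian k false τ z} {φ-term} {φ-value a} {φ-value a} (gaussian-φ k τ z) (refl , refl) (proj₂ (proj₂ (sums false a)))
          where
          φ-term : ℤ → ℂ
          φ-term b = exp (ofReal (1/ k * π) *ᶜ 𝕚 *ᶜ τ *ᶜ ofReal (fromℤ (b ℤ.* b))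
            +ᶜ ofReal (fromℕ 2 * π) *ᶜ 𝕚 *ᶜ z *ᶜ ofReal (fromℤ b))

        value : Bool → R₀ → ℂ
        value s a = if s then ψ-value a else φ-value a

        value-limit : ∀ s a → (λ N → ∑ (gaussian k s τ z) (residuesUpTo k a N)) ⟶ᶜ value s a
        value-limit true  a = proj₁ (proj₂ (sums true a))
        value-limit false a = proj₁ (proj₂ (sums false a))

        -- `class-sum` evaluates the sum over the code lattice, and reindexing along `β` turns it
        -- into a sum over all integer coefficient vectors, as `IsThetaValue` requires. The limits
        -- that define the values of ψ and φ are the ones fed into the products.
        theta-correct : IsThetaValue O D y τ z (CJ O ℂ-rawSemiring X T ψ-value φ-value)
        theta-correct = HasSum-cong (theta-term τ z) (CJ-value ψ-value φ-value)
          (HasSum-reindex β α β∈ αβ (λ _ → βα)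
            (class-sum k X (imageθ-unique H r C) (coord O) (coord-injective H r C O)
              (λ i → gaussian k (lookup T i) τ z) Kmax (λ i → bound (lookup T i)) (λ i → value (lookup T i)) (λ i → value-limit (lookup T i))))

theorem6p2 : ∀ {c ℓ₁ ℓ₂} (ℝ : RealField c ℓ₁ ℓ₂) →
    let open RealField ℝ
        open Complex ℝ
        open Theta ℝ
    in
    (k : ℕ) .{{k≥2 : NonTrivial k}} →
    let open Code k in
    (n : ℕ) (G : PermutationGroup n) (C : GCode G)
    (H : PermutationGroup n) → H ≤ᴳ G →
    (|H|⁻¹ : R₀) → fromℕᴿ (PermutationGroup.order H) ⊗ |H|⁻¹ ≡ 1ᴿ →
    (O : Orbits H) (T : Subset (Orbits.t O)) →
    Σ[ D ∈ Lattice H ] Σ[ y ∈ Γ n ] Lattice._∈D D y ×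
      (∀ (τ z : ℂ) → 0# < im τ →
        Σ[ ψ ∈ (R₀ → ℂ) ] Σ[ φ ∈ (R₀ → ℂ) ]
          (∀ a → IsPsiValue k a τ (ψ a)) ×
          (∀ a → IsPhiValue k a τ z (φ a)) ×
          IsThetaValue O D y τ z (CJ O ℂ-rawSemiring (imageθ H |H|⁻¹ C) T ψ φ))
theorem6p2 ℝ k n G C H H≤G |H|⁻¹ |H|⁻¹-inverse O T =
  J.D , J.y , (J.y-index , λ i → RealFacts.refl ℝ) , λ τ z 0<τ →
    J.ψ-value τ z 0<τ , J.φ-value τ z 0<τ , J.ψ-correct τ z 0<τ , J.φ-correct τ z 0<τ , J.theta-correct τ z 0<τ
  where
  module J = JacobiTheta.Modulus.Theorem ℝ k C H |H|⁻¹ O T
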